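{- Let $I,J\subset S$ be finitary and let $I_\bullet$ and $I'_\bullet$ be reduced expressions for an $(I,J)$-coset $p$. Assume further that $I'_\bullet$ is of the form $I'_\bullet=[[I\supset \mathrm{LR}(p)]]\circ K_\bullet$, i.e. it begins by removing the elements of $I\setminus\mathrm{LR}(p)$ from $I$ one at a time until reaching $\mathrm{LR}(p)$, and then continues with an expression $K_\bullet$ starting at $\mathrm{LR}(p)$. Then, up to a grading shift, $\mathrm{BS}(I'_\bullet)$ is the restriction of $\mathrm{BS}(K_\bullet)$ from left $R^{\mathrm{LR}(p)}$-modules to left $R^I$-modules, and hence admits an action of $R^{\mathrm{LR}(p)}$. If $f\in\mathrm{Hom}_{<p}(\mathrm{BS}(I_\bullet),\mathrm{BS}(I'_\bullet))$, then $$\operatorname{Im} f\cap\left(R^{\mathrm{LR}(p)}\cdot 1^\otimes_{I'_\bullet}\right)=0.$$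
   Context: Cosets. $(W,S)$ is a Coxeter system with length function $\ell$. For $I\subset S$, $W_I$ is the subgroup generated by $I$; $I$ is finitary if $W_I$ is finite, and then $w_I$ is its longest element and $\ell(I):=\ell(w_I)$. The $*$-product on $W$ is the associative monoid product determined by $s*w=sw$ if $sw>w$ and $s*w=w$ if $sw<w$ ($s\in S$, $w\in W$). For finitary $I,J$, an $(I,J)$-coset is an element $p\in W_I\backslash W/W_J$ (regarded as a triple $(p,I,J)$), with maximal and minimal elements $\overline p,\underline p$; $p\le q$ means $\underline p\le\underline q$ in Bruhat order. The left redundancy of an $(I,J)$-coset $p$ is $\mathrm{LR}(p)=I\cap\underline p J\underline p^{ -1}$. Expressions. A (singlestep) expression is a sequence $I_\bullet=[I_0,\dots,I_d]$ of finitary subsets of $S$, consecutive ones differing by adding or removing one element. It expresses the unique $(I_0,I_d)$-coset $q$ with $\overline q=w_{I_0}*\cdots*w_{I_d}$. Recording local maxima and minima gives $I_0=L_0\subset K_1\supset L_1\subset\cdots\subset K_m\supset L_m=I_d$ (with $L_0=K_1$ if $I_\bullet$ starts by decreasing and $K_m=L_m$ if it ends by increasing); $I_\bullet$ is reduced if $\overline q=(w_{K_1}w_{L_1}^{ -1})\cdots(w_{K_{m-1}}w_{L_{m-1}}^{ -1})w_{K_m}$ with lengths of the factors adding up to $\ell(\overline q)$. $\circ$ denotes concatenation of expressions with matching end and start. Realization. $V$ is a realization of $(W,S)$ over a field $\Bbbk$: a finite-dimensional $\Bbbk$-vector space with $\alpha_s^\vee\in V$, $\alpha_s\in V^*$ ($s\in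 S$), $\langle\alpha_s^\vee,\alpha_s\rangle=2$, such that $s(v)=v-\alpha_s(v)\alpha_s^\vee$ defines a representation of $W$, with the standard Elias–Williamson technical condition that the two-coloured quantum numbers $[m_{st}]_s,[m_{st}]_t$ vanish when $m_{st}<\infty$ (defined by $[0]=0$, $[1]=1$, $[2]_s=-\langle\alpha_s^\vee,\alpha_t\rangle$, $[2]_t=-\langle\alpha_t^\vee,\alpha_s\rangle$, $[2]_s[n]_t=[n+1]_s+[n-1]_s$ and symmetrically). It is assumed balanced ($[m_{st}-1]_s=[m_{st}-1]_t=1$ for $m_{st}<\infty$), reflection faithful ($W$ acts faithfully, and $x\in W$ fixes a codimension one subspace exactly when it is conjugate to an element of $S$) and to satisfy generalized Demazure surjectivity (for each finitary $I$ the Demazure operator $\partial_{w_I}:R\to R^I$, composed from $\partial_s(f)=(f-sf)/\alpha_s$ along a reduced word of $w_I$, is surjective). $R=\mathrm{Sym}(V^*)$ is graded with $V^*$ in degree 2, and $R^I$ is the subring of $W_I$-invariants. Bimodules. $M(i)$ is the grading shift with $M(i)^j=M^{i+j}$. For $I\subset J$ finitary, $\mathrm{BS}([I,J])=R^I$ as $(R^I,R^J)$-bimodule and $\mathrm{BS}([J,I])=R^I(\ell(J)-\ell(I))$ as $(R^J,R^I)$-bimodule; $\mathrm{BS}([I])=R^I$, and $\mathrm{BS}(I_\bullet)=\mathrm{BS}([I_0,I_1])\otimes_{R^{I_1}}\cdots\otimes_{R^{I_{d-1}}}\mathrm{BS}([I_{d-1},I_d])$. The one-tensor is $1^\otimes_{I_\bullet}=1\otimes1\otimes\cdots\otimes1\in\mathrm{BS}(I_\bullet)$.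 $\mathrm{Hom}(M,N)=\bigoplus_{i\in\mathbb Z}\mathrm{Hom}^i(M,N)$, where $\mathrm{Hom}^i(M,N)$ is the space of degree zero bimodule maps $M\to N(i)$. Lower terms. For a downward-closed set $C$ of $(I,J)$-cosets, $\mathrm{Hom}_C$ is the two-sided ideal in the category of graded $(R^I,R^J)$-bimodules generated by the identity maps of $\mathrm{BS}(M_\bullet)$ for all expressions $M_\bullet$ expressing some $q\in C$; i.e. it consists of finite sums of morphisms each factoring through such a $\mathrm{BS}(M_\bullet)$. $\mathrm{Hom}_{<p}$ is $\mathrm{Hom}_C$ for $C=\{q\mid q<p\}$. -}

module Defs where

open import Level using (Level; Setω; suc)
open import Axiom.ExcludedMiddle using (ExcludedMiddle)
open import Algebra.Apartness.Bundles using (HeytingCommutativeRing; HeytingField)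
open import Algebra.Bundles using (AbelianGroup; CommutativeRing; Group; Ring)
open import Algebra.Bundles.Raw using (RawRing)
import Algebra.Definitions.RawMonoid as RawMonoidDefs
open import Algebra.Module.Bundles using (Bimodule; Module)
open import Algebra.Module.Bundles.Raw using (RawLeftModule)
import Algebra.Module.Construct.TensorUnit as TensorUnit
import Algebra.Module.Morphism.Construct.Composition as Composition
open import Algebra.Module.Morphism.Structures
  using (IsLeftModuleHomomorphism; IsBimoduleHomomorphism; IsBimoduleIsomorphism)
open import Algebra.Morphism.Structures using (IsRingHomomorphism; IsRingMonomorphism)
import Algebra.Morphism.Construct.Identity as Identity
import Algebra.Morphism.RingMonomorphism as RingMonomorphism
import Algebra.Properties.AbelianGroup as AbelianGroupProperties
import Algebra.Properties.CommutativeSemigroup as CommutativeSemigroupProperties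
open import Data.Bool.Base using (if_then_else_)
open import Data.Fin.Base using (Fin)
open import Data.Integer.Base as ℤ using (ℤ; 0ℤ; _⊖_)
open import Data.List.Base
  using (List; []; _∷_; _++_; concat; replicate; filter; foldr; length; map)
open import Data.List.Extrema.Nat using (argmax)
open import Data.List.Relation.Unary.All using (All)
import Data.List.Relation.Unary.All as All
open import Data.List.Relation.Unary.Any using (Any)
open import Data.Maybe.Base using (Maybe; just)
open import Data.Nat.Base as ℕ using (ℕ; _<ᵇ_)
open import Data.Nat.Induction using (Acc; acc; <-wellFounded)
import Data.Nat.Properties as ℕ
open import Data.Product.Base using (Σ; Σ-syntax; ∃-syntax; ∃₂; _×_; _,_; proj₁; proj₂)
open import Data.Sum.Base using (_⊎_; inj₁; inj₂)
open import Function.Base using (id)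
open import Function.Bundles using (_⇔_)
open import Relation.Binary.Construct.Closure.Equivalence using (EqClosure)
open import Relation.Binary.Construct.Closure.ReflexiveTransitive using (Star)
open import Relation.Binary.PropositionalEquality.Core using (_≡_; _≢_)
open import Relation.Nullary using (¬_; yes; no)
open import Relation.Unary using (Pred; _∈_; _∉_; _⊆_; _≐_; _∪_; ｛_｝)

-- Excluded middle at every level.  It is what makes length functions and
-- longest elements available as functions, and it makes a `HeytingField` the
-- same thing as a field in the classical sense.
Classical : Setω
Classical = ∀ {a} → ExcludedMiddle a

------------------------------------------------------------------------
-- Linear forms and symmetric algebras

module Linear {u} {K : CommutativeRing u u} where

  open CommutativeRing K

  module _ (V W : Module K u u) where

    private
      module V = Module V
      module W = Module W
      open AbelianGroupProperties W.+ᴹ-abelianGroup using (inverseˡ-unique)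

    -- Compatibility with zero and negation follows from the other laws.
    linear : (f : V.Carrierᴹ → W.Carrierᴹ) →
             (∀ {x y} → x V.≈ᴹ y → f x W.≈ᴹ f y) →
             (∀ x y → f (x V.+ᴹ y) W.≈ᴹ (f x W.+ᴹ f y)) →
             (∀ c x → f (c V.*ₗ x) W.≈ᴹ (c W.*ₗ f x)) →
             IsLeftModuleHomomorphism V.rawLeftModule W.rawLeftModule f
    linear f f-cong f-+ f-* = record
      { +ᴹ-isGroupHomomorphism = record
        { isMonoidHomomorphism = record
          { isMagmaHomomorphism = record
            { isRelHomomorphism = record { cong = f-cong }
            ; homo = f-+
            }
          ; ε-homo = f-0
          }
        ; ⁻¹-homo = λ x → inverseˡ-unique (f (V.-ᴹ x)) (f x)
            (W.≈ᴹ-trans (W.≈ᴹ-sym (f-+ (V.-ᴹ x) x))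
              (W.≈ᴹ-trans (f-cong (V.-ᴹ‿inverseˡ x)) f-0))
        }
      ; *ₗ-homo = f-*
      }
      where
      f-0 : f V.0ᴹ W.≈ᴹ W.0ᴹ
      f-0 = W.≈ᴹ-trans (f-cong (V.≈ᴹ-sym (V.*ₗ-zeroˡ V.0ᴹ)))
              (W.≈ᴹ-trans (f-* 0# V.0ᴹ) (W.*ₗ-zeroˡ (f V.0ᴹ)))

  record FiniteBasis (V : Module K u u) : Set u where
    open Module V
    open RawMonoidDefs +ᴹ-rawMonoid using (sum)
    field
      dimension   : ℕ
      basis       : Fin dimension → Carrierᴹ
      spanning    : ∀ v → Σ[ c ∈ (Fin dimension → Carrier) ] v ≈ᴹ sum (λ i → c i *ₗ basis i)
      independent : ∀ (c : Fin dimension → Carrier) → sum (λ i → c i *ₗ basis i) ≈ᴹ 0ᴹ → ∀ i → c i ≈ 0#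

  module Dual (V : Module K u u) where

    private module V = Module V

    line : Module K u u
    line = TensorUnit.⟨module⟩ {R = K}

    record LinearForm : Set u where
      constructor form
      field
        ⟦_⟧      : V.Carrierᴹ → Carrier
        isLinear : IsLeftModuleHomomorphism V.rawLeftModule
                     (Module.rawLeftModule line) ⟦_⟧
      open IsLeftModuleHomomorphism isLinear public
    open LinearForm using (⟦_⟧)

    -- Pointwise operations; `form′` rebuilds the linearity proof.
    form′ : (f : V.Carrierᴹ → Carrier) →
            (∀ {x y} → x V.≈ᴹ y → f x ≈ f y) →
            (∀ x y → f (x V.+ᴹ y) ≈ f x + f y) →
            (∀ c x → f (c V.*ₗ x) ≈ c * f x) → LinearForm
    form′ f f-cong f-+ f-* = form f (linear V line f f-cong f-+ f-*)

    open CommutativeSemigroupProperties +-commutativeSemigroup using (interchange)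
    open CommutativeSemigroupProperties *-commutativeSemigroup using (x∙yz≈y∙xz)

    _+*_ : LinearForm → LinearForm → LinearForm
    φ +* ψ = form′ (λ v → ⟦ φ ⟧ v + ⟦ ψ ⟧ v)
      (λ e → +-cong (φ.⟦⟧-cong e) (ψ.⟦⟧-cong e))
      (λ x y → trans (+-cong (φ.+ᴹ-homo x y) (ψ.+ᴹ-homo x y)) (interchange _ _ _ _))
      (λ c x → trans (+-cong (φ.*ₗ-homo c x) (ψ.*ₗ-homo c x)) (sym (distribˡ _ _ _)))
      where
      module φ = LinearForm φ
      module ψ = LinearForm ψ

    _·*_ : Carrier → LinearForm → LinearForm
    a ·* φ = form′ (λ v → a * ⟦ φ ⟧ v)
      (λ e → *-congˡ (φ.⟦⟧-cong e))
      (λ x y → trans (*-congˡ (φ.+ᴹ-homo x y)) (distribˡ _ _ _))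
      (λ c x → trans (*-congˡ (φ.*ₗ-homo c x)) (x∙yz≈y∙xz _ _ _))
      where module φ = LinearForm φ

    0* : LinearForm
    0* = form′ (λ _ → 0#) (λ _ → refl) (λ _ _ → sym (+-identityʳ 0#)) (λ c _ → sym (zeroʳ c))

    dual : RawLeftModule Carrier u u
    dual = record
      { Carrierᴹ = LinearForm
      ; _≈ᴹ_     = λ φ ψ → ∀ v → ⟦ φ ⟧ v ≈ ⟦ ψ ⟧ v
      ; _+ᴹ_     = _+*_
      ; _*ₗ_     = _·*_
      ; 0ᴹ       = 0*
      ; -ᴹ_      = (- 1#) ·*_
      }

    reflection : LinearForm → V.Carrierᴹ → V.Carrierᴹ → V.Carrierᴹ
    reflection φ a v = v V.+ᴹ V.-ᴹ (⟦ φ ⟧ v V.*ₗ a)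

    reflection-linear : ∀ φ a →
      IsLeftModuleHomomorphism V.rawLeftModule V.rawLeftModule (reflection φ a)
    reflection-linear φ a = linear V V (reflection φ a)
      (λ e → V.+ᴹ-cong e (V.-ᴹ‿cong (V.*ₗ-congʳ (φ.⟦⟧-cong e))))
      (λ x y → V.≈ᴹ-trans
        (V.+ᴹ-congˡ (V.≈ᴹ-trans
          (V.-ᴹ‿cong (V.≈ᴹ-trans (V.*ₗ-congʳ (φ.+ᴹ-homo x y)) (V.*ₗ-distribʳ _ _ _)))
          (V.≈ᴹ-sym (⁻¹-∙-comm _ _))))
        (V-interchange _ _ _ _))
      (λ c x → V.≈ᴹ-trans
        (V.+ᴹ-congˡ (V.≈ᴹ-trans
          (V.-ᴹ‿cong (V.≈ᴹ-trans (V.*ₗ-congʳ (φ.*ₗ-homo c x)) (V.*ₗ-assoc _ _ _)))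
          (V.≈ᴹ-sym (c-neg c _))))
        (V.≈ᴹ-sym (V.*ₗ-distribˡ c x _)))
      where
      module φ = LinearForm φ
      open AbelianGroupProperties V.+ᴹ-abelianGroup using (⁻¹-∙-comm; inverseˡ-unique)
      open CommutativeSemigroupProperties
        (AbelianGroup.commutativeSemigroup V.+ᴹ-abelianGroup)
        using () renaming (interchange to V-interchange)
      c-neg : ∀ c m → (c V.*ₗ (V.-ᴹ m)) V.≈ᴹ V.-ᴹ (c V.*ₗ m)
      c-neg c m = inverseˡ-unique _ _
        (V.≈ᴹ-trans (V.≈ᴹ-sym (V.*ₗ-distribˡ c _ _))
          (V.≈ᴹ-trans (V.*ₗ-congˡ (V.-ᴹ‿inverseˡ m)) (V.*ₗ-zeroʳ c)))

  -- The symmetric algebra, presented as the commutative K-algebra freely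
  -- generated by the module M.
  module Sym (M : RawLeftModule Carrier u u) where

    private module M = RawLeftModule M

    infix  8 -ˢ_
    infixl 7 _*ˢ_
    infixl 6 _+ˢ_ _-ˢ_
    infix  4 _≈ˢ_

    data Element : Set u where
      con   : Carrier → Element
      var   : M.Carrierᴹ → Element
      _+ˢ_  : Element → Element → Element
      _*ˢ_  : Element → Element → Element
      -ˢ_   : Element → Element

    _-ˢ_ : Element → Element → Element
    f -ˢ g = f +ˢ -ˢ g

    data _≈ˢ_ : Element → Element → Set u where
      reflˢ      : ∀ {f} → f ≈ˢ f
      symˢ       : ∀ {f g} → f ≈ˢ g → g ≈ˢ f
      transˢ     : ∀ {f g h} → f ≈ˢ g → g ≈ˢ h → f ≈ˢ h
      +-congˢ    : ∀ {f f′ g g′} → f ≈ˢ f′ → g ≈ˢ g′ → f +ˢ g ≈ˢ f′ +ˢ g′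
      *-congˢ    : ∀ {f f′ g g′} → f ≈ˢ f′ → g ≈ˢ g′ → f *ˢ g ≈ˢ f′ *ˢ g′
      neg-congˢ  : ∀ {f f′} → f ≈ˢ f′ → -ˢ f ≈ˢ -ˢ f′
      +-assocˢ   : ∀ f g h → (f +ˢ g) +ˢ h ≈ˢ f +ˢ (g +ˢ h)
      +-commˢ    : ∀ f g → f +ˢ g ≈ˢ g +ˢ f
      +-identˢ   : ∀ f → con 0# +ˢ f ≈ˢ f
      +-inverseˢ : ∀ f → -ˢ f +ˢ f ≈ˢ con 0#
      *-assocˢ   : ∀ f g h → (f *ˢ g) *ˢ h ≈ˢ f *ˢ (g *ˢ h)
      *-commˢ    : ∀ f g → f *ˢ g ≈ˢ g *ˢ f
      *-identˢ   : ∀ f → con 1# *ˢ f ≈ˢ f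
      distribˢ   : ∀ f g h → f *ˢ (g +ˢ h) ≈ˢ f *ˢ g +ˢ f *ˢ h
      con-cong   : ∀ {a b} → a ≈ b → con a ≈ˢ con b
      con-+      : ∀ a b → con (a + b) ≈ˢ con a +ˢ con b
      con-*      : ∀ a b → con (a * b) ≈ˢ con a *ˢ con b
      var-cong   : ∀ {m n} → m M.≈ᴹ n → var m ≈ˢ var n
      var-+      : ∀ m n → var (m M.+ᴹ n) ≈ˢ var m +ˢ var n
      var-*      : ∀ a m → var (a M.*ₗ m) ≈ˢ con a *ˢ var m

    algebra : CommutativeRing u u
    algebra = record
      { Carrier = Element ; _≈_ = _≈ˢ_ ; _+_ = _+ˢ_ ; _*_ = _*ˢ_ ; -_ = -ˢ_
      ; 0# = con 0# ; 1# = con 1#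
      ; isCommutativeRing = record
        { isRing = record
          { +-isAbelianGroup = record
            { isGroup = record
              { isMonoid = record
                { isSemigroup = record
                  { isMagma = record
                    { isEquivalence = record { refl = reflˢ ; sym = symˢ ; trans = transˢ }
                    ; ∙-cong = +-congˢ
                    }
                  ; assoc = +-assocˢ
                  }
                ; identity = +-identˢ , λ f → transˢ (+-commˢ f _) (+-identˢ f)
                }
              ; inverse = +-inverseˢ , λ f → transˢ (+-commˢ f _) (+-inverseˢ f)
              ; ⁻¹-cong = neg-congˢ
              }
            ; comm = +-commˢ
            }
          ; *-cong = *-congˢ
          ; *-assoc = *-assocˢ
          ; *-identity = *-identˢ , λ f → transˢ (*-commˢ f _) (*-identˢ f)
          ; distrib = distribˢ , λ f g h → transˢ (*-commˢ _ f)
              (transˢ (distribˢ f g h) (+-congˢ (*-commˢ f g) (*-commˢ f h)))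
          }
        ; *-comm = *-commˢ
        }
      }

    -- Homogeneous elements of a given degree, the generators having degree 2.
    data Homogeneous : ℤ → Element → Set u where
      con-homo   : ∀ a → Homogeneous 0ℤ (con a)
      var-homo   : ∀ m → Homogeneous (ℤ.+ 2) (var m)
      0-homo     : ∀ i → Homogeneous i (con 0#)
      +-homo     : ∀ {i f g} → Homogeneous i f → Homogeneous i g → Homogeneous i (f +ˢ g)
      neg-homo   : ∀ {i f} → Homogeneous i f → Homogeneous i (-ˢ f)
      *-homo     : ∀ {i j f g} → Homogeneous i f → Homogeneous j g → Homogeneous (i ℤ.+ j) (f *ˢ g)
      ≈-homo     : ∀ {i f g} → f ≈ˢ g → Homogeneous i f → Homogeneous i g

    -- Functoriality in M.
    mapˢ : (M.Carrierᴹ → M.Carrierᴹ) → Element → Element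
    mapˢ θ (con a)  = con a
    mapˢ θ (var m)  = var (θ m)
    mapˢ θ (f +ˢ g) = mapˢ θ f +ˢ mapˢ θ g
    mapˢ θ (f *ˢ g) = mapˢ θ f *ˢ mapˢ θ g
    mapˢ θ (-ˢ f)   = -ˢ mapˢ θ f

------------------------------------------------------------------------
-- Bimodules

module _ {u} {A A′ B B′ : Ring u u} where

  private
    module A  = Ring A
    module A′ = Ring A′
    module B  = Ring B
    module B′ = Ring B′

  restrict : {f : A′.Carrier → A.Carrier} {g : B′.Carrier → B.Carrier} →
             IsRingHomomorphism A′.rawRing A.rawRing f →
             IsRingHomomorphism B′.rawRing B.rawRing g →
             Bimodule A B u u → Bimodule A′ B′ u u
  restrict {f} {g} f-hom g-hom M = record
    { Carrierᴹ = Carrierᴹ ; _≈ᴹ_ = _≈ᴹ_ ; _+ᴹ_ = _+ᴹ_ ; 0ᴹ = 0ᴹ ; -ᴹ_ = -ᴹ_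
    ; _*ₗ_ = λ a m → f a *ₗ m
    ; _*ᵣ_ = λ m b → m *ᵣ g b
    ; isBimodule = record
      { isBisemimodule = record
        { +ᴹ-isCommutativeMonoid = +ᴹ-isCommutativeMonoid
        ; isPreleftSemimodule = record
          { *ₗ-cong = λ e e′ → *ₗ-cong (f.⟦⟧-cong e) e′
          ; *ₗ-zeroˡ = λ m → ≈ᴹ-trans (*ₗ-congʳ f.0#-homo) (*ₗ-zeroˡ m)
          ; *ₗ-distribʳ = λ m a a′ → ≈ᴹ-trans (*ₗ-congʳ (f.+-homo a a′)) (*ₗ-distribʳ m (f a) (f a′))
          ; *ₗ-identityˡ = λ m → ≈ᴹ-trans (*ₗ-congʳ f.1#-homo) (*ₗ-identityˡ m)
          ; *ₗ-assoc = λ a a′ m → ≈ᴹ-trans (*ₗ-congʳ (f.*-homo a a′)) (*ₗ-assoc (f a) (f a′) m)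
          ; *ₗ-zeroʳ = λ a → *ₗ-zeroʳ (f a)
          ; *ₗ-distribˡ = λ a → *ₗ-distribˡ (f a)
          }
        ; isPrerightSemimodule = record
          { *ᵣ-cong = λ e e′ → *ᵣ-cong e (g.⟦⟧-cong e′)
          ; *ᵣ-zeroʳ = λ m → ≈ᴹ-trans (*ᵣ-congˡ g.0#-homo) (*ᵣ-zeroʳ m)
          ; *ᵣ-distribˡ = λ m b b′ → ≈ᴹ-trans (*ᵣ-congˡ (g.+-homo b b′)) (*ᵣ-distribˡ m (g b) (g b′))
          ; *ᵣ-identityʳ = λ m → ≈ᴹ-trans (*ᵣ-congˡ g.1#-homo) (*ᵣ-identityʳ m)
          ; *ᵣ-assoc = λ m b b′ → ≈ᴹ-trans (*ᵣ-assoc m (g b) (g b′)) (*ᵣ-congˡ (≈ᴮ-sym (g.*-homo b b′)))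
          ; *ᵣ-zeroˡ = λ b → *ᵣ-zeroˡ (g b)
          ; *ᵣ-distribʳ = λ b → *ᵣ-distribʳ (g b)
          }
        ; *ₗ-*ᵣ-assoc = λ a m b → *ₗ-*ᵣ-assoc (f a) m (g b)
        }
      ; -ᴹ‿cong = -ᴹ‿cong
      ; -ᴹ‿inverse = -ᴹ‿inverse
      }
    }
    where
    open Bimodule M
    open Ring B using () renaming (sym to ≈ᴮ-sym)
    module f = IsRingHomomorphism f-hom
    module g = IsRingHomomorphism g-hom

module Tensor {u} {A B C : Ring u u} (M : Bimodule A B u u) (N : Bimodule B C u u) where

  private
    module A = Ring A
    module B = Ring B
    module C = Ring C
    module M = Bimodule M
    module N = Bimodule N

  infix  8 -ᵗ_
  infix  7 _⊗_
  infixl 6 _+ᵗ_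
  infix  4 _≈ᵗ_

  data Element : Set u where
    _⊗_  : M.Carrierᴹ → N.Carrierᴹ → Element
    _+ᵗ_ : Element → Element → Element
    0ᵗ   : Element
    -ᵗ_  : Element → Element

  data _≈ᵗ_ : Element → Element → Set u where
    reflᵗ      : ∀ {x} → x ≈ᵗ x
    symᵗ       : ∀ {x y} → x ≈ᵗ y → y ≈ᵗ x
    transᵗ     : ∀ {x y z} → x ≈ᵗ y → y ≈ᵗ z → x ≈ᵗ z
    +-congᵗ    : ∀ {x x′ y y′} → x ≈ᵗ x′ → y ≈ᵗ y′ → x +ᵗ y ≈ᵗ x′ +ᵗ y′
    neg-congᵗ  : ∀ {x x′} → x ≈ᵗ x′ → -ᵗ x ≈ᵗ -ᵗ x′
    +-assocᵗ   : ∀ x y z → (x +ᵗ y) +ᵗ z ≈ᵗ x +ᵗ (y +ᵗ z)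
    +-commᵗ    : ∀ x y → x +ᵗ y ≈ᵗ y +ᵗ x
    +-identᵗ   : ∀ x → 0ᵗ +ᵗ x ≈ᵗ x
    +-inverseᵗ : ∀ x → -ᵗ x +ᵗ x ≈ᵗ 0ᵗ
    ⊗-cong     : ∀ {m m′ n n′} → m M.≈ᴹ m′ → n N.≈ᴹ n′ → m ⊗ n ≈ᵗ m′ ⊗ n′
    ⊗-distribʳ : ∀ m m′ n → (m M.+ᴹ m′) ⊗ n ≈ᵗ m ⊗ n +ᵗ m′ ⊗ n
    ⊗-distribˡ : ∀ m n n′ → m ⊗ (n N.+ᴹ n′) ≈ᵗ m ⊗ n +ᵗ m ⊗ n′
    ⊗-balanced : ∀ m b n → (m M.*ᵣ b) ⊗ n ≈ᵗ m ⊗ (b N.*ₗ n)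

  abelianGroup : AbelianGroup u u
  abelianGroup = record
    { Carrier = Element ; _≈_ = _≈ᵗ_ ; _∙_ = _+ᵗ_ ; ε = 0ᵗ ; _⁻¹ = -ᵗ_
    ; isAbelianGroup = record
      { isGroup = record
        { isMonoid = record
          { isSemigroup = record
            { isMagma = record
              { isEquivalence = record { refl = reflᵗ ; sym = symᵗ ; trans = transᵗ }
              ; ∙-cong = +-congᵗ
              }
            ; assoc = +-assocᵗ
            }
          ; identity = +-identᵗ , λ x → transᵗ (+-commᵗ x _) (+-identᵗ x)
          }
        ; inverse = +-inverseᵗ , λ x → transᵗ (+-commᵗ x _) (+-inverseᵗ x)
        ; ⁻¹-cong = neg-congᵗ
        }
      ; comm = +-commᵗ
      }
    }

  _·ˡ_ : A.Carrier → Element → Element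
  a ·ˡ (m ⊗ n)  = (a M.*ₗ m) ⊗ n
  a ·ˡ (x +ᵗ y) = (a ·ˡ x) +ᵗ (a ·ˡ y)
  a ·ˡ 0ᵗ       = 0ᵗ
  a ·ˡ (-ᵗ x)   = -ᵗ (a ·ˡ x)

  _·ʳ_ : Element → C.Carrier → Element
  (m ⊗ n)  ·ʳ c = m ⊗ (n N.*ᵣ c)
  (x +ᵗ y) ·ʳ c = (x ·ʳ c) +ᵗ (y ·ʳ c)
  0ᵗ       ·ʳ c = 0ᵗ
  (-ᵗ x)   ·ʳ c = -ᵗ (x ·ʳ c)

  private
    open AbelianGroupProperties abelianGroup
      using (identityˡ-unique; ε⁻¹≈ε; ⁻¹-∙-comm)
    open CommutativeSemigroupProperties (AbelianGroup.commutativeSemigroup abelianGroup)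
      using (interchange)

    0⊗ : ∀ n → M.0ᴹ ⊗ n ≈ᵗ 0ᵗ
    0⊗ n = identityˡ-unique _ _
      (transᵗ (symᵗ (⊗-distribʳ _ _ n)) (⊗-cong (M.+ᴹ-identityˡ M.0ᴹ) N.≈ᴹ-refl))

    ⊗0 : ∀ m → m ⊗ N.0ᴹ ≈ᵗ 0ᵗ
    ⊗0 m = identityˡ-unique _ _
      (transᵗ (symᵗ (⊗-distribˡ m _ _)) (⊗-cong M.≈ᴹ-refl (N.+ᴹ-identityˡ N.0ᴹ)))

    ·ˡ-congˡ : ∀ a {x y} → x ≈ᵗ y → a ·ˡ x ≈ᵗ a ·ˡ y
    ·ˡ-congˡ a reflᵗ              = reflᵗ
    ·ˡ-congˡ a (symᵗ e)           = symᵗ (·ˡ-congˡ a e)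
    ·ˡ-congˡ a (transᵗ e e′)      = transᵗ (·ˡ-congˡ a e) (·ˡ-congˡ a e′)
    ·ˡ-congˡ a (+-congᵗ e e′)     = +-congᵗ (·ˡ-congˡ a e) (·ˡ-congˡ a e′)
    ·ˡ-congˡ a (neg-congᵗ e)      = neg-congᵗ (·ˡ-congˡ a e)
    ·ˡ-congˡ a (+-assocᵗ x y z)   = +-assocᵗ _ _ _
    ·ˡ-congˡ a (+-commᵗ x y)      = +-commᵗ _ _
    ·ˡ-congˡ a (+-identᵗ x)       = +-identᵗ _
    ·ˡ-congˡ a (+-inverseᵗ x)     = +-inverseᵗ _
    ·ˡ-congˡ a (⊗-cong e e′)      = ⊗-cong (M.*ₗ-congˡ e) e′
    ·ˡ-congˡ a (⊗-distribʳ m m′ n) = transᵗ (⊗-cong (M.*ₗ-distribˡ a m m′) N.≈ᴹ-refl) (⊗-distribʳ _ _ n)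
    ·ˡ-congˡ a (⊗-distribˡ m n n′) = ⊗-distribˡ _ n n′
    ·ˡ-congˡ a (⊗-balanced m b n) =
      transᵗ (⊗-cong (M.≈ᴹ-sym (M.*ₗ-*ᵣ-assoc a m b)) N.≈ᴹ-refl) (⊗-balanced _ b n)

    ·ʳ-congʳ : ∀ c {x y} → x ≈ᵗ y → x ·ʳ c ≈ᵗ y ·ʳ c
    ·ʳ-congʳ c reflᵗ              = reflᵗ
    ·ʳ-congʳ c (symᵗ e)           = symᵗ (·ʳ-congʳ c e)
    ·ʳ-congʳ c (transᵗ e e′)      = transᵗ (·ʳ-congʳ c e) (·ʳ-congʳ c e′)
    ·ʳ-congʳ c (+-congᵗ e e′)     = +-congᵗ (·ʳ-congʳ c e) (·ʳ-congʳ c e′)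
    ·ʳ-congʳ c (neg-congᵗ e)      = neg-congᵗ (·ʳ-congʳ c e)
    ·ʳ-congʳ c (+-assocᵗ x y z)   = +-assocᵗ _ _ _
    ·ʳ-congʳ c (+-commᵗ x y)      = +-commᵗ _ _
    ·ʳ-congʳ c (+-identᵗ x)       = +-identᵗ _
    ·ʳ-congʳ c (+-inverseᵗ x)     = +-inverseᵗ _
    ·ʳ-congʳ c (⊗-cong e e′)      = ⊗-cong e (N.*ᵣ-congʳ e′)
    ·ʳ-congʳ c (⊗-distribʳ m m′ n) = ⊗-distribʳ m m′ _
    ·ʳ-congʳ c (⊗-distribˡ m n n′) = transᵗ (⊗-cong M.≈ᴹ-refl (N.*ᵣ-distribʳ c n n′)) (⊗-distribˡ m _ _)
    ·ʳ-congʳ c (⊗-balanced m b n) =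
      transᵗ (⊗-balanced m b _) (⊗-cong M.≈ᴹ-refl (N.≈ᴹ-sym (N.*ₗ-*ᵣ-assoc b n c)))

    ·ˡ-congʳ : ∀ {a a′} → a A.≈ a′ → ∀ x → a ·ˡ x ≈ᵗ a′ ·ˡ x
    ·ˡ-congʳ e (m ⊗ n)  = ⊗-cong (M.*ₗ-congʳ e) N.≈ᴹ-refl
    ·ˡ-congʳ e (x +ᵗ y) = +-congᵗ (·ˡ-congʳ e x) (·ˡ-congʳ e y)
    ·ˡ-congʳ e 0ᵗ       = reflᵗ
    ·ˡ-congʳ e (-ᵗ x)   = neg-congᵗ (·ˡ-congʳ e x)

    ·ʳ-congˡ : ∀ {c c′} → c C.≈ c′ → ∀ x → x ·ʳ c ≈ᵗ x ·ʳ c′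
    ·ʳ-congˡ e (m ⊗ n)  = ⊗-cong M.≈ᴹ-refl (N.*ᵣ-congˡ e)
    ·ʳ-congˡ e (x +ᵗ y) = +-congᵗ (·ʳ-congˡ e x) (·ʳ-congˡ e y)
    ·ʳ-congˡ e 0ᵗ       = reflᵗ
    ·ʳ-congˡ e (-ᵗ x)   = neg-congᵗ (·ʳ-congˡ e x)

    0+0 : 0ᵗ +ᵗ 0ᵗ ≈ᵗ 0ᵗ
    0+0 = +-identᵗ 0ᵗ

    ·ˡ-zeroˡ : ∀ x → A.0# ·ˡ x ≈ᵗ 0ᵗ
    ·ˡ-zeroˡ (m ⊗ n)  = transᵗ (⊗-cong (M.*ₗ-zeroˡ m) N.≈ᴹ-refl) (0⊗ n)
    ·ˡ-zeroˡ (x +ᵗ y) = transᵗ (+-congᵗ (·ˡ-zeroˡ x) (·ˡ-zeroˡ y)) 0+0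
    ·ˡ-zeroˡ 0ᵗ       = reflᵗ
    ·ˡ-zeroˡ (-ᵗ x)   = transᵗ (neg-congᵗ (·ˡ-zeroˡ x)) ε⁻¹≈ε

    ·ʳ-zeroʳ : ∀ x → x ·ʳ C.0# ≈ᵗ 0ᵗ
    ·ʳ-zeroʳ (m ⊗ n)  = transᵗ (⊗-cong M.≈ᴹ-refl (N.*ᵣ-zeroʳ n)) (⊗0 m)
    ·ʳ-zeroʳ (x +ᵗ y) = transᵗ (+-congᵗ (·ʳ-zeroʳ x) (·ʳ-zeroʳ y)) 0+0
    ·ʳ-zeroʳ 0ᵗ       = reflᵗ
    ·ʳ-zeroʳ (-ᵗ x)   = transᵗ (neg-congᵗ (·ʳ-zeroʳ x)) ε⁻¹≈ε

    ·ˡ-distribʳ : ∀ x a a′ → (a A.+ a′) ·ˡ x ≈ᵗ (a ·ˡ x) +ᵗ (a′ ·ˡ x)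
    ·ˡ-distribʳ (m ⊗ n)  a a′ = transᵗ (⊗-cong (M.*ₗ-distribʳ m a a′) N.≈ᴹ-refl) (⊗-distribʳ _ _ n)
    ·ˡ-distribʳ (x +ᵗ y) a a′ =
      transᵗ (+-congᵗ (·ˡ-distribʳ x a a′) (·ˡ-distribʳ y a a′)) (interchange _ _ _ _)
    ·ˡ-distribʳ 0ᵗ       a a′ = symᵗ 0+0
    ·ˡ-distribʳ (-ᵗ x)   a a′ = transᵗ (neg-congᵗ (·ˡ-distribʳ x a a′)) (symᵗ (⁻¹-∙-comm _ _))

    ·ʳ-distribˡ : ∀ x c c′ → x ·ʳ (c C.+ c′) ≈ᵗ (x ·ʳ c) +ᵗ (x ·ʳ c′)
    ·ʳ-distribˡ (m ⊗ n)  c c′ = transᵗ (⊗-cong M.≈ᴹ-refl (N.*ᵣ-distribˡ n c c′)) (⊗-distribˡ m _ _)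
    ·ʳ-distribˡ (x +ᵗ y) c c′ =
      transᵗ (+-congᵗ (·ʳ-distribˡ x c c′) (·ʳ-distribˡ y c c′)) (interchange _ _ _ _)
    ·ʳ-distribˡ 0ᵗ       c c′ = symᵗ 0+0
    ·ʳ-distribˡ (-ᵗ x)   c c′ = transᵗ (neg-congᵗ (·ʳ-distribˡ x c c′)) (symᵗ (⁻¹-∙-comm _ _))

    ·ˡ-identity : ∀ x → A.1# ·ˡ x ≈ᵗ x
    ·ˡ-identity (m ⊗ n)  = ⊗-cong (M.*ₗ-identityˡ m) N.≈ᴹ-refl
    ·ˡ-identity (x +ᵗ y) = +-congᵗ (·ˡ-identity x) (·ˡ-identity y)
    ·ˡ-identity 0ᵗ       = reflᵗ
    ·ˡ-identity (-ᵗ x)   = neg-congᵗ (·ˡ-identity x)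

    ·ʳ-identity : ∀ x → x ·ʳ C.1# ≈ᵗ x
    ·ʳ-identity (m ⊗ n)  = ⊗-cong M.≈ᴹ-refl (N.*ᵣ-identityʳ n)
    ·ʳ-identity (x +ᵗ y) = +-congᵗ (·ʳ-identity x) (·ʳ-identity y)
    ·ʳ-identity 0ᵗ       = reflᵗ
    ·ʳ-identity (-ᵗ x)   = neg-congᵗ (·ʳ-identity x)

    ·ˡ-assoc : ∀ a a′ x → (a A.* a′) ·ˡ x ≈ᵗ a ·ˡ (a′ ·ˡ x)
    ·ˡ-assoc a a′ (m ⊗ n)  = ⊗-cong (M.*ₗ-assoc a a′ m) N.≈ᴹ-refl
    ·ˡ-assoc a a′ (x +ᵗ y) = +-congᵗ (·ˡ-assoc a a′ x) (·ˡ-assoc a a′ y)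
    ·ˡ-assoc a a′ 0ᵗ       = reflᵗ
    ·ˡ-assoc a a′ (-ᵗ x)   = neg-congᵗ (·ˡ-assoc a a′ x)

    ·ʳ-assoc : ∀ x c c′ → (x ·ʳ c) ·ʳ c′ ≈ᵗ x ·ʳ (c C.* c′)
    ·ʳ-assoc (m ⊗ n)  c c′ = ⊗-cong M.≈ᴹ-refl (N.*ᵣ-assoc n c c′)
    ·ʳ-assoc (x +ᵗ y) c c′ = +-congᵗ (·ʳ-assoc x c c′) (·ʳ-assoc y c c′)
    ·ʳ-assoc 0ᵗ       c c′ = reflᵗ
    ·ʳ-assoc (-ᵗ x)   c c′ = neg-congᵗ (·ʳ-assoc x c c′)

    ·ˡ-·ʳ-assoc : ∀ a x c → (a ·ˡ x) ·ʳ c ≈ᵗ a ·ˡ (x ·ʳ c)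
    ·ˡ-·ʳ-assoc a (m ⊗ n)  c = reflᵗ
    ·ˡ-·ʳ-assoc a (x +ᵗ y) c = +-congᵗ (·ˡ-·ʳ-assoc a x c) (·ˡ-·ʳ-assoc a y c)
    ·ˡ-·ʳ-assoc a 0ᵗ       c = reflᵗ
    ·ˡ-·ʳ-assoc a (-ᵗ x)   c = neg-congᵗ (·ˡ-·ʳ-assoc a x c)

  bimodule : Bimodule A C u u
  bimodule = record
    { Carrierᴹ = Element ; _≈ᴹ_ = _≈ᵗ_ ; _+ᴹ_ = _+ᵗ_ ; 0ᴹ = 0ᵗ ; -ᴹ_ = -ᵗ_
    ; _*ₗ_ = _·ˡ_ ; _*ᵣ_ = _·ʳ_
    ; isBimodule = record
      { isBisemimodule = record
        { +ᴹ-isCommutativeMonoid = isCommutativeMonoid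
        ; isPreleftSemimodule = record
          { *ₗ-cong = λ {a} {a′} {x} {x′} e e′ → transᵗ (·ˡ-congʳ e x) (·ˡ-congˡ a′ e′)
          ; *ₗ-zeroˡ = ·ˡ-zeroˡ
          ; *ₗ-distribʳ = ·ˡ-distribʳ
          ; *ₗ-identityˡ = ·ˡ-identity
          ; *ₗ-assoc = ·ˡ-assoc
          ; *ₗ-zeroʳ = λ _ → reflᵗ
          ; *ₗ-distribˡ = λ _ _ _ → reflᵗ
          }
        ; isPrerightSemimodule = record
          { *ᵣ-cong = λ {x} {x′} {c} {c′} e e′ → transᵗ (·ʳ-congʳ c e) (·ʳ-congˡ e′ x′)
          ; *ᵣ-zeroʳ = ·ʳ-zeroʳ
          ; *ᵣ-distribˡ = ·ʳ-distribˡ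
          ; *ᵣ-identityʳ = ·ʳ-identity
          ; *ᵣ-assoc = ·ʳ-assoc
          ; *ᵣ-zeroˡ = λ _ → reflᵗ
          ; *ᵣ-distribʳ = λ _ _ _ → reflᵗ
          }
        ; *ₗ-*ᵣ-assoc = ·ˡ-·ʳ-assoc
        }
      ; -ᴹ‿cong = neg-congᵗ
      ; -ᴹ‿inverse = AbelianGroup.inverse abelianGroup
      }
    }
    where open AbelianGroup abelianGroup using (isCommutativeMonoid)

-- A bimodule with its family of homogeneous parts Mⁱ, given as predicates.
record GradedBimodule {u} (A B : Ring u u) : Set (suc u) where
  field
    bimodule    : Bimodule A B u u
    Homogeneous : ℤ → Pred (Bimodule.Carrierᴹ bimodule) u
  open Bimodule bimodule public

module _ {u} {A B : Ring u u} where

  infixl 9 _⟨_⟩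

  _⟨_⟩ : GradedBimodule A B → ℤ → GradedBimodule A B
  M ⟨ i ⟩ = record
    { bimodule    = bimodule
    ; Homogeneous = λ j → Homogeneous (i ℤ.+ j)
    } where open GradedBimodule M

  -- Degree zero bimodule maps.
  record Hom⁰ (M N : GradedBimodule A B) : Set u where
    private
      module M = GradedBimodule M
      module N = GradedBimodule N
    field
      ⟦_⟧                    : M.Carrierᴹ → N.Carrierᴹ
      isBimoduleHomomorphism : IsBimoduleHomomorphism M.rawBimodule N.rawBimodule ⟦_⟧
      degree-zero            : ∀ j {x} → x ∈ M.Homogeneous j → ⟦ x ⟧ ∈ N.Homogeneous j

  Hom^ : ℤ → GradedBimodule A B → GradedBimodule A B → Set u
  Hom^ i M N = Hom⁰ M (N ⟨ i ⟩)

  -- Elements of the direct sum over i of Hom^ i, written as formal finite sums.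
  -- They are only ever used through the map `apply`.
  Hom : GradedBimodule A B → GradedBimodule A B → Set u
  Hom M N = List (∃[ i ] Hom^ i M N)

  sumᴹ : (M : GradedBimodule A B) →
         List (GradedBimodule.Carrierᴹ M) → GradedBimodule.Carrierᴹ M
  sumᴹ M = foldr _+ᴹ_ 0ᴹ where open GradedBimodule M

  apply : (M N : GradedBimodule A B) → Hom M N →
          GradedBimodule.Carrierᴹ M → GradedBimodule.Carrierᴹ N
  apply M N f x = sumᴹ N (map (λ (_ , g) → Hom⁰.⟦_⟧ g x) f)

  Image : (M N : GradedBimodule A B) → Hom M N → Pred (GradedBimodule.Carrierᴹ N) u
  Image M N f y = ∃[ x ] apply M N f x ≈ᴹ y where open GradedBimodule N

  record IsGradedIsomorphism (M N : GradedBimodule A B)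
      (Φ : GradedBimodule.Carrierᴹ M → GradedBimodule.Carrierᴹ N) : Set u where
    private
      module M = GradedBimodule M
      module N = GradedBimodule N
    field
      isBimoduleIsomorphism : IsBimoduleIsomorphism M.rawBimodule N.rawBimodule Φ
      graded                : ∀ j x → x ∈ M.Homogeneous j ⇔ Φ x ∈ N.Homogeneous j
    open IsBimoduleIsomorphism isBimoduleIsomorphism public

    Φ⁻¹ : N.Carrierᴹ → M.Carrierᴹ
    Φ⁻¹ y = proj₁ (surjective y)

module GradedTensor {u} {A B C : Ring u u} (M : GradedBimodule A B) (N : GradedBimodule B C) where

  private
    module M = GradedBimodule M
    module N = GradedBimodule N

  open Tensor M.bimodule N.bimodule

  data Homogeneousᵗ : ℤ → Element → Set u where
    ⊗-homo   : ∀ {i j m n} → m ∈ M.Homogeneous i → n ∈ N.Homogeneous j →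
               Homogeneousᵗ (i ℤ.+ j) (m ⊗ n)
    +-homo   : ∀ {i x y} → Homogeneousᵗ i x → Homogeneousᵗ i y → Homogeneousᵗ i (x +ᵗ y)
    0-homo   : ∀ i → Homogeneousᵗ i 0ᵗ
    neg-homo : ∀ {i x} → Homogeneousᵗ i x → Homogeneousᵗ i (-ᵗ x)
    ≈-homo   : ∀ {i x y} → x ≈ᵗ y → Homogeneousᵗ i x → Homogeneousᵗ i y

  _⊗ᵍ_ : GradedBimodule A C
  _⊗ᵍ_ = record { bimodule = bimodule ; Homogeneous = Homogeneousᵗ }

open GradedTensor using (_⊗ᵍ_)

------------------------------------------------------------------------
-- Coxeter systems

-- Insertion of a relator (s t)^{m s t}.  As m s s = 1, inverses of the
-- generators are not needed: these relations also present the group as a monoid.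
data Insertion {u} {S : Set u} (m : S → S → Maybe ℕ) : List S → List S → Set u where
  relator : ∀ a b {s t n} → m s t ≡ just n →
            Insertion m (a ++ b) (a ++ concat (replicate n (s ∷ t ∷ [])) ++ b)

record CoxeterSystem (u : Level) : Set (suc u) where
  field
    group : Group u u
  open Group group public renaming (Carrier to W)
  field
    S      : Set u
    ι      : S → W
    -- The Coxeter matrix; `nothing` stands for ∞.
    m      : S → S → Maybe ℕ
    m-sym  : ∀ s t → m s t ≡ m t s
    m-diag : ∀ s → m s s ≡ just 1
    m-off  : ∀ {s t n} → s ≢ t → m s t ≡ just n → 2 ℕ.≤ n

  Word : Set u
  Word = List S

  ∏ : Word → W
  ∏ = foldr (λ s w → ι s ∙ w) ε

  field
    generated : ∀ w → Σ[ a ∈ Word ] ∏ a ≈ w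
    presented : ∀ a b → ∏ a ≈ ∏ b ⇔ EqClosure (Insertion m) a b

  -- The subgroup generated by I; again inverses of generators are not needed.
  Parabolic : Pred S u → Pred W u
  Parabolic I w = Σ[ a ∈ Word ] All I a × ∏ a ≈ w

  parabolic-mono : ∀ {I J} → I ⊆ J → Parabolic I ⊆ Parabolic J
  parabolic-mono I⊆J (a , a⊆I , e) = a , All.map I⊆J a⊆I , e

  -- A finitary subset: some finite list exhausts W_I.
  record Finitary : Set (suc u) where
    field
      set    : Pred S u
      finite : Σ[ l ∈ List W ] (∀ w → w ∈ Parabolic set → Any (w ≈_) l)
  open Finitary public using (set)

  -- I ⋖ J : the set J arises from I by adding one element.
  record _⋖_ (I J : Finitary) : Set u where
    field
      added : S
      fresh : added ∉ set I
      union : set J ≐ (set I ∪ ｛ added ｝)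

  ⋖⇒⊆ : ∀ {I J} → I ⋖ J → set I ⊆ set J
  ⋖⇒⊆ d i = proj₂ (_⋖_.union d) (inj₁ i)

  data Step (I J : Finitary) : Set u where
    up   : I ⋖ J → Step I J
    down : J ⋖ I → Step I J

  -- Singlestep expressions.  Subsets are compared extensionally, so the
  -- expression [I] also runs from I to any J with the same elements.
  data Expr : Finitary → Finitary → Set (suc u) where
    nil : ∀ {I J} → set I ≐ set J → Expr I J
    _∷_ : ∀ {I K J} → Step I K → Expr K J → Expr I J

  -- Removing elements one at a time.
  data Descent : Finitary → Finitary → Set (suc u) where
    []  : ∀ {I} → Descent I I
    _∷_ : ∀ {I K L} → K ⋖ I → Descent K L → Descent I L

  _◦_ : ∀ {I L J} → Descent I L → Expr L J → Expr I J
  []      ◦ e = e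
  (d ∷ D) ◦ e = down d ∷ (D ◦ e)

  descent-⊆ : ∀ {I L} → Descent I L → set L ⊆ set I
  descent-⊆ []      = id
  descent-⊆ (d ∷ D) = λ i → ⋖⇒⊆ d (descent-⊆ D i)

  -- The list (K₁ , L₁) , … , (K_{m-1} , L_{m-1}) together with K_m.
  Zigzag : Set (suc u)
  Zigzag = List (Finitary × Finitary) × Finitary

  -- `climb` looks for the next local maximum; `descend K` looks for the next
  -- local minimum, K being the last local maximum met.
  mutual
    climb : ∀ {I J} → Expr I J → Zigzag
    climb {I} (nil _)      = [] , I
    climb     (up _ ∷ e)   = climb e
    climb {I} (down _ ∷ e) = descend I e

    descend : Finitary → ∀ {I J} → Expr I J → Zigzag
    descend K     (nil _)      = [] , K
    descend K {I} (up _ ∷ e)   = let ps , Kₘ = climb e in (K , I) ∷ ps , Kₘ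
    descend K     (down _ ∷ e) = descend K e

  -- An (I, J)-coset, given by any of its elements.
  record Coset (I J : Finitary) : Set u where
    field
      representative : W

  _∈ᶜ_ : ∀ {I J} → W → Coset I J → Set u
  _∈ᶜ_ {I} {J} x p = ∃₂ λ a b →
    a ∈ Parabolic (set I) × b ∈ Parabolic (set J) × x ≈ (a ∙ Coset.representative p) ∙ b

  _≈ᶜ_ : ∀ {I J} → Coset I J → Coset I J → Set u
  p ≈ᶜ q = Coset.representative p ∈ᶜ q

module Coxeter {u} (em : Classical) (𝒲 : CoxeterSystem u) where

  open CoxeterSystem 𝒲

  ReducedWord : W → Set u
  ReducedWord w = Σ[ a ∈ Word ] ∏ a ≈ w × (∀ b → ∏ b ≈ w → length a ℕ.≤ length b)

  reducedWord : ∀ w → ReducedWord w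
  reducedWord w = let a , e = generated w in go a e (<-wellFounded (length a))
    where
    go : ∀ a → ∏ a ≈ w → Acc ℕ._<_ (length a) → ReducedWord w
    go a e (acc rec) with em {P = Σ[ b ∈ Word ] ∏ b ≈ w × length b ℕ.< length a}
    ... | yes (b , e′ , b<a) = go b e′ (rec b<a)
    ... | no ¬shorter = a , e , λ b e′ → ℕ.≮⇒≥ (λ b<a → ¬shorter (b , e′ , b<a))

  reduced : W → Word
  reduced w = proj₁ (reducedWord w)

  ℓ : W → ℕ
  ℓ w = length (reduced w)

  _<·_ : W → W → Set u
  x <· y = ∃₂ λ w s → y ≈ x ∙ ((w ∙ ι s) ∙ w ⁻¹) × ℓ x ℕ.< ℓ y

  -- Bruhat order.
  _≤ᴮ_ : W → W → Set u
  _≤ᴮ_ = Star (λ x y → x ≈ y ⊎ x <· y)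

  w₀ : Finitary → W
  w₀ I = argmax ℓ ε (filter (λ w → em {P = w ∈ Parabolic (set I)}) (proj₁ finite))
    where open Finitary I

  -- s * w; here sw > w is tested on lengths.
  _⋆ˢ_ : S → W → W
  s ⋆ˢ w = if ℓ w <ᵇ ℓ (ι s ∙ w) then ι s ∙ w else w

  -- If x = s₁ ⋯ s_k is reduced, then also x = s₁ * ⋯ * s_k, so associativity
  -- forces x * y = s₁ * (⋯ * (s_k * y)).
  _⋆_ : W → W → W
  x ⋆ y = foldr _⋆ˢ_ y (reduced x)

  module _ {I J : Finitary} where

    IsMinimal IsMaximal : Coset I J → W → Set u
    IsMinimal p x = x ∈ᶜ p × (∀ y → y ∈ᶜ p → x ≤ᴮ y)
    IsMaximal p x = x ∈ᶜ p × (∀ y → y ∈ᶜ p → y ≤ᴮ x)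

    _≤ᶜ_ _<ᶜ_ : Coset I J → Coset I J → Set u
    p ≤ᶜ q = ∃₂ λ x y → IsMinimal p x × IsMinimal q y × x ≤ᴮ y
    p <ᶜ q = p ≤ᶜ q × ¬ p ≈ᶜ q

    LR : Coset I J → Pred S u
    LR p s = s ∈ set I ×
      ∃₂ λ x t → IsMinimal p x × t ∈ set J × ι s ≈ (x ∙ ι t) ∙ x ⁻¹

  -- w_{I₀} * ⋯ * w_{I_d}
  ⋆-product : ∀ {I J} → Expr I J → W
  ⋆-product {I} (nil _) = w₀ I
  ⋆-product {I} (_ ∷ e) = w₀ I ⋆ ⋆-product e

  Expresses : ∀ {I J} → Expr I J → Coset I J → Set u
  Expresses e q = IsMaximal q (⋆-product e)

  factors : Zigzag → List W
  factors (ps , Kₘ) = map (λ (K , L) → w₀ K ∙ w₀ L ⁻¹) ps ++ w₀ Kₘ ∷ []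

  IsReduced : ∀ {I J} → Expr I J → Set u
  IsReduced e =
    ⋆-product e ≈ foldr _∙_ ε (factors (climb e)) ×
    ℓ (⋆-product e) ≡ foldr (λ x n → ℓ x ℕ.+ n) 0 (factors (climb e))

  IsReducedExpressionFor : ∀ {I J} → Expr I J → Coset I J → Set u
  IsReducedExpressionFor e p = Expresses e p × IsReduced e

------------------------------------------------------------------------
-- Realizations

-- quantum K x y n is [n]_s, where x = [2]_s and y = [2]_t.
quantum : ∀ {u} (K : CommutativeRing u u) → let open CommutativeRing K in
          Carrier → Carrier → ℕ → Carrier
quantum K x y 0 = CommutativeRing.0# K
quantum K x y 1 = CommutativeRing.1# K
quantum K x y (ℕ.suc (ℕ.suc n)) = x * quantum K y x (ℕ.suc n) - quantum K x y n
  where open CommutativeRing K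

record Realization {u} (𝒲 : CoxeterSystem u) (𝕜 : HeytingField u u u) : Set (suc u) where
  open CoxeterSystem 𝒲 using (W; S; ι; m; Word; ∏; generated)
  private module 𝒲 = CoxeterSystem 𝒲

  scalars : CommutativeRing u u
  scalars = HeytingCommutativeRing.commutativeRing (HeytingField.heytingCommutativeRing 𝕜)

  open CommutativeRing scalars

  field
    V        : Module scalars u u
    finiteᵛ  : Linear.FiniteBasis V

  open Module V
  open Linear.Dual V
  open LinearForm using (⟦_⟧)

  field
    α∨       : S → Carrierᴹ
    α        : S → LinearForm

  ⟨_,_⟩ : S → S → Carrier
  ⟨ s , t ⟩ = ⟦ α t ⟧ (α∨ s)

  reflect : S → Carrierᴹ → Carrierᴹ
  reflect s = reflection (α s) (α∨ s)

  actᵃ : Word → Carrierᴹ → Carrierᴹ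
  actᵃ a v = foldr reflect v a

  [_]⟨_,_⟩ : ℕ → S → S → Carrier
  [ n ]⟨ s , t ⟩ = quantum scalars (- ⟨ s , t ⟩) (- ⟨ t , s ⟩) n

  field
    pairing        : ∀ s → ⟨ s , s ⟩ ≈ 1# + 1#
    representation : ∀ a b → ∏ a 𝒲.≈ ∏ b → ∀ v → actᵃ a v ≈ᴹ actᵃ b v
    technical      : ∀ {s t n} → s ≢ t → m s t ≡ just n → [ n ]⟨ s , t ⟩ ≈ 0#

  -- The action of W on V, the contragredient action on V*, and the induced
  -- action on R = Sym V*.

  act : W → Carrierᴹ → Carrierᴹ
  act w = actᵃ (proj₁ (generated w))

  act-linear : ∀ w → IsLeftModuleHomomorphism rawLeftModule rawLeftModule (act w)
  act-linear w = go (proj₁ (generated w))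
    where
    go : ∀ a → IsLeftModuleHomomorphism rawLeftModule rawLeftModule (actᵃ a)
    go []      = linear-id
      where
      linear-id : IsLeftModuleHomomorphism rawLeftModule rawLeftModule id
      linear-id = Linear.linear V V id id (λ _ _ → ≈ᴹ-refl) (λ _ _ → ≈ᴹ-refl)
    go (s ∷ a) = Composition.isLeftModuleHomomorphism ≈ᴹ-trans
      (go a) (reflection-linear (α s) (α∨ s))

  act* : W → LinearForm → LinearForm
  act* w φ = form (λ v → ⟦ φ ⟧ (act (w 𝒲.⁻¹) v))
    (Composition.isLeftModuleHomomorphism trans (act-linear (w 𝒲.⁻¹)) (LinearForm.isLinear φ))

  module R = Linear.Sym {K = scalars} dual
  open R using (_≈ˢ_; _*ˢ_; _-ˢ_; var; mapˢ; +-congˢ; *-congˢ; neg-congˢ; reflˢ)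

  R : CommutativeRing u u
  R = R.algebra

  _•_ : W → R.Element → R.Element
  w • f = mapˢ (act* w) f

  Invariant : Pred S u → Pred R.Element u
  Invariant I f = ∀ w → w ∈ 𝒲.Parabolic I → w • f ≈ˢ f

  -- The ring R^I of W_I-invariants.
  R^_ : Pred S u → CommutativeRing u u
  R^ I = record
    { RawRing raw
    ; isCommutativeRing = RingMonomorphism.isCommutativeRing mono
        (CommutativeRing.isCommutativeRing R)
    }
    where
    module 𝐑 = CommutativeRing R
    raw : RawRing u u
    raw = record
      { Carrier = Σ R.Element (Invariant I)
      ; _≈_ = λ (f , _) (g , _) → f ≈ˢ g
      ; _+_ = λ (f , f-inv) (g , g-inv) → f 𝐑.+ g , λ w i → +-congˢ (f-inv w i) (g-inv w i)
      ; _*_ = λ (f , f-inv) (g , g-inv) → f 𝐑.* g , λ w i → *-congˢ (f-inv w i) (g-inv w i)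
      ; -_  = λ (f , f-inv) → 𝐑.- f , λ w i → neg-congˢ (f-inv w i)
      ; 0#  = 𝐑.0# , λ _ _ → reflˢ
      ; 1#  = 𝐑.1# , λ _ _ → reflˢ
      }
    mono : IsRingMonomorphism raw 𝐑.rawRing proj₁
    mono = record
      { isRingHomomorphism = record
        { isSemiringHomomorphism = record
          { isNearSemiringHomomorphism = record
            { +-isMonoidHomomorphism = record
              { isMagmaHomomorphism = record
                { isRelHomomorphism = record { cong = id }
                ; homo = λ _ _ → reflˢ
                }
              ; ε-homo = reflˢ
              }
            ; *-homo = λ _ _ → reflˢ
            }
          ; 1#-homo = reflˢ
          }
        ; -‿homo = λ _ → reflˢ
        }
      ; injective = id
      }

  R^ᵣ_ : Pred S u → Ring u u
  R^ᵣ I = CommutativeRing.ring (R^ I)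

  include : ∀ {L I} → L ⊆ I →
            CommutativeRing.Carrier (R^ I) → CommutativeRing.Carrier (R^ L)
  include L⊆I (f , f-inv) = f , λ w i → f-inv w (𝒲.parabolic-mono L⊆I i)

  include-isRingHomomorphism : ∀ {L I} (L⊆I : L ⊆ I) →
    IsRingHomomorphism (CommutativeRing.rawRing (R^ I)) (CommutativeRing.rawRing (R^ L))
      (include L⊆I)
  include-isRingHomomorphism L⊆I = record
    { isSemiringHomomorphism = record
      { isNearSemiringHomomorphism = record
        { +-isMonoidHomomorphism = record
          { isMagmaHomomorphism = record
            { isRelHomomorphism = record { cong = id }
            ; homo = λ _ _ → reflˢ
            }
          ; ε-homo = reflˢ
          }
        ; *-homo = λ _ _ → reflˢ
        }
      ; 1#-homo = reflˢ
      }
    ; -‿homo = λ _ → reflˢ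
    }

  Balanced : Set u
  Balanced = ∀ {s t n} → s ≢ t → m s t ≡ just (ℕ.suc n) → [ n ]⟨ s , t ⟩ ≈ 1#

  -- The fixed space of x has codimension one: V / Vˣ has a basis {v}.
  FixesHyperplane : W → Set u
  FixesHyperplane x = ∃[ v ]
    (∀ c → Fixed (c *ₗ v) → c ≈ 0#) × (∀ v′ → ∃[ c ] Fixed (v′ +ᴹ -ᴹ (c *ₗ v)))
    where
    Fixed : Carrierᴹ → Set u
    Fixed v = act x v ≈ᴹ v

  ReflectionFaithful : Set u
  ReflectionFaithful =
    (∀ w → (∀ v → act w v ≈ᴹ v) → w 𝒲.≈ 𝒲.ε) ×
    (∀ x → FixesHyperplane x ⇔ (∃₂ λ w s → x 𝒲.≈ (w 𝒲.∙ ι s) 𝒲.∙ w 𝒲.⁻¹))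

  -- ∂ a f g : the element g is ∂_{s₁} (⋯ (∂_{s_k} f)), where a = s₁ ⋯ s_k.  Each
  -- ∂_s is given by the equation defining the quotient (f − s f) / α_s.
  data ∂ : Word → R.Element → R.Element → Set u where
    []  : ∀ {f g} → f ≈ˢ g → ∂ [] f g
    _∷_ : ∀ {s a f g h} → var (α s) *ˢ h ≈ˢ g -ˢ (ι s • g) → ∂ a f g → ∂ (s ∷ a) f h

  GeneralizedDemazureSurjectivity : Classical → Set (suc u)
  GeneralizedDemazureSurjectivity em = ∀ (I : 𝒲.Finitary) g → g ∈ Invariant (𝒲.set I) →
    ∃[ f ] ∂ (reduced (w₀ I)) f g
    where open Coxeter em 𝒲

------------------------------------------------------------------------
-- Singular Bott–Samelson bimodules

module BottSamelson {u} (em : Classical) {𝒲 : CoxeterSystem u} {𝕜 : HeytingField u u u}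
                    (𝔥 : Realization 𝒲 𝕜) where

  open CoxeterSystem 𝒲
  open Coxeter em 𝒲
  open Realization 𝔥 using (R^_; R^ᵣ_; include; include-isRingHomomorphism; module R)

  module _ {I L : Pred S u} (L⊆I : L ⊆ I) {B : Ring u u} where

    -- Restriction of scalars on the left, from R^L to R^I.
    restrictˡ : GradedBimodule (R^ᵣ L) B → GradedBimodule (R^ᵣ I) B
    restrictˡ M = record
      { bimodule    = restrict (include-isRingHomomorphism L⊆I) id-hom bimodule
      ; Homogeneous = Homogeneous
      }
      where
      open GradedBimodule M
      id-hom : IsRingHomomorphism (Ring.rawRing B) (Ring.rawRing B) id
      id-hom = Identity.isRingHomomorphism (Ring.rawRing B) (Ring.refl B)

  invariants : ∀ {I J} L → L ⊆ I → L ⊆ J → GradedBimodule (R^ᵣ I) (R^ᵣ J)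
  invariants L L⊆I L⊆J = record
    { bimodule    = restrict (include-isRingHomomorphism L⊆I) (include-isRingHomomorphism L⊆J)
                      (TensorUnit.bimodule {R = R^ᵣ L})
    ; Homogeneous = λ j (f , _) → R.Homogeneous j f
    }

  BSˢ : ∀ {I J} → Step I J → GradedBimodule (R^ᵣ set I) (R^ᵣ set J)
  BSˢ {I} {J} (up d)   = invariants (set I) id (⋖⇒⊆ d)
  BSˢ {J} {I} (down d) = invariants (set I) (⋖⇒⊆ d) id ⟨ ℓ (w₀ J) ⊖ ℓ (w₀ I) ⟩

  -- The iterated tensor product carries a last factor BS([I_d]) = R^{I_d}, the
  -- unit for the tensor product over R^{I_d}.
  BS : ∀ {I J} → Expr I J → GradedBimodule (R^ᵣ set I) (R^ᵣ set J)
  BS {I} (nil (I⊆J , _)) = invariants (set I) id I⊆J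
  BS     (st ∷ e)        = BSˢ st ⊗ᵍ BS e

  module BS {I J : Finitary} (e : Expr I J) = GradedBimodule (BS e)

  1ˢ : ∀ {I J} (st : Step I J) → GradedBimodule.Carrierᴹ (BSˢ st)
  1ˢ {I} {J} (up _)   = CommutativeRing.1# (R^ set I)
  1ˢ {I} {J} (down _) = CommutativeRing.1# (R^ set J)

  1⊗ : ∀ {I J} (e : Expr I J) → BS.Carrierᴹ e
  1⊗ {I} (nil _)  = CommutativeRing.1# (R^ set I)
  1⊗     (st ∷ e) = 1ˢ st Tensor.⊗ 1⊗ e

  -- The map BS(K•) → BS([[I ⊃ L]] ∘ K•), y ↦ 1 ⊗ ⋯ ⊗ 1 ⊗ y.
  prepend : ∀ {I L J} (D : Descent I L) (e : Expr L J) → BS.Carrierᴹ e → BS.Carrierᴹ (D ◦ e)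
  prepend []      e y = y
  prepend (d ∷ D) e y = 1ˢ (down d) Tensor.⊗ prepend D e y

  -- A morphism factoring through BS(M•), for some M• expressing some q ∈ C.
  record Factorization {I J} (C : Pred (Coset I J) u)
                       (M N : GradedBimodule (R^ᵣ set I) (R^ᵣ set J)) : Set (suc u) where
    field
      q         : Coset I J
      q∈C       : q ∈ C
      M•        : Expr I J
      expresses : Expresses M• q
      into      : Hom M (BS M•)
      out       : Hom (BS M•) N

    composite : GradedBimodule.Carrierᴹ M → GradedBimodule.Carrierᴹ N
    composite x = apply (BS M•) N out (apply M (BS M•) into x)

  -- The ideal Hom_C.
  Hom[_] : ∀ {I J} → Pred (Coset I J) u → ∀ M N → Pred (Hom M N) (suc u)
  Hom[ C ] M N f = Σ[ l ∈ List (Factorization C M N) ]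
    ∀ x → apply M N f x ≈ᴹ sumᴹ N (map (λ φ → Factorization.composite φ x) l)
    where open GradedBimodule N

  Hom<[_] : ∀ {I J} → Coset I J → ∀ M N → Pred (Hom M N) (suc u)
  Hom<[ p ] = Hom[ (λ q → q <ᶜ p) ]

  -- Identification, up to a shift, of BS([[I ⊃ L]] ∘ K•) with the restriction of
  -- BS(K•) to R^I, and the resulting action of R^L by transport of structure.
  module _ {I L J : Finitary} (D : Descent I L) (K• : Expr L J) where

    Restriction : ℤ → Set u
    Restriction n = IsGradedIsomorphism
      (restrictˡ (descent-⊆ D) (BS K•) ⟨ n ⟩) (BS (D ◦ K•)) (prepend D K•)

    module Action (n : ℤ) (iso : Restriction n) where
      open IsGradedIsomorphism iso using (Φ⁻¹)

      _▷_ : CommutativeRing.Carrier (R^ set L) → BS.Carrierᴹ (D ◦ K•) → BS.Carrierᴹ (D ◦ K•)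
      r ▷ y = prepend D K• (BS._*ₗ_ K• r (Φ⁻¹ y))

      -- The R^L-submodule generated by the one-tensor.
      R·1⊗ : Pred (BS.Carrierᴹ (D ◦ K•)) u
      R·1⊗ y = ∃[ r ] BS._≈ᴹ_ (D ◦ K•) y (r ▷ 1⊗ (D ◦ K•))

-- BS(M•) is supported on the graphs of the products y = w₀ ⋯ w_d with wᵢ ∈ W_{Mᵢ}, and all
-- of these satisfy y ≤ w_{M₀} * ⋯ * w_{M_d}.  If M• expresses q < p, the maximal element x
-- of p is therefore not among them, and every bimodule map from BS(M•) to R with the right
-- action twisted by x is zero.  As I'• is reduced, x is such a product for I'•, which gives
-- a bimodule map f₀ ⊗ f₁ ⊗ ⋯ ↦ w₀(f₀ w₁(f₁ ⋯)) from BS(I'•) to the twisted R.  It kills Im f,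
-- since f is a sum of maps factoring through such BS(M•), but it maps r · 1⊗ to v(r) for
-- some v ∈ W, and this vanishes only for r = 0.
--
-- The support statement holds because R is a domain on which W acts faithfully: for
-- x ∉ W_I there are Σ r ⊗ s ∈ R ⊗ R separating ε from finitely many other elements of W,
-- and traces over the finite groups W_I then replace Galois theory.

module Submission where

open import Defs
open import Algebra.Apartness.Bundles using (HeytingField)
open import Algebra.Bundles using (AbelianGroup; CommutativeMonoid; CommutativeRing; Group; Ring)
import Algebra.Definitions.RawMonoid as RawMonoidDefs
open import Algebra.Module.Bundles using (Bimodule; Module)
open import Algebra.Module.Bundles.Raw using (RawLeftModule)
open import Algebra.Module.Morphism.Structures using (IsBimoduleHomomorphism)
import Algebra.Morphism.Construct.Identity as Identity
open import Algebra.Morphism.Structures using (IsGroupHomomorphism)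
import Algebra.Properties.CommutativeMonoid.Sum as FiniteSum
import Algebra.Properties.CommutativeSemigroup as CommutativeSemigroupProperties
import Algebra.Properties.Group as GroupProperties
import Algebra.Properties.Ring as RingProperties
import Algebra.Solver.Ring.NaturalCoefficients.Default as Solver
open import Data.Bool.Base as Bool using (Bool; true; false; _xor_)
import Data.Bool.Properties as Bool
open import Data.Empty using (⊥-elim)
open import Data.Fin.Base as Fin using (Fin)
import Data.Fin.Properties as Fin
open import Data.Integer.Base as ℤ using (ℤ; 0ℤ; _⊖_)
import Data.Integer.Properties as ℤ
open import Data.List.Base
  using (List; []; _∷_; _++_; allFin; concat; deduplicate; filter; foldr; length; map; replicate; reverse)
open import Data.List.Extrema.Nat using (argmax-sel; f[xs]≤f[argmax])
open import Data.List.Membership.Propositional using (find) renaming (_∉_ to _∉ᵖ_)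
open import Data.List.Membership.Propositional.Properties using (∈-allFin; ∈-filter⁺; ∈-filter⁻)
import Data.List.Membership.Setoid as Membership
import Data.List.Membership.Setoid.Properties as MembershipProperties
import Data.List.Properties as List
import Data.List.Relation.Binary.Permutation.Setoid as Permutation
import Data.List.Relation.Binary.Permutation.Setoid.Properties as PermutationProperties
open import Data.List.Relation.Binary.Sublist.Propositional as Sublist using () renaming (_⊆_ to _⊑_)
open import Data.List.Relation.Unary.All using (All; []; _∷_)
import Data.List.Relation.Unary.All as All
import Data.List.Relation.Unary.All.Properties as All
open import Data.List.Relation.Unary.AllPairs using ([]; _∷_)
open import Data.List.Relation.Unary.Any using (here; there)
import Data.List.Relation.Unary.Any.Properties as Any
import Data.List.Relation.Unary.Unique.DecSetoid.Properties as UniqueDec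
open import Data.List.Relation.Unary.Unique.Propositional using () renaming (Unique to Uniqueᵖ)
import Data.List.Relation.Unary.Unique.Propositional.Properties as Uniqueᵖ
import Data.List.Relation.Unary.Unique.Setoid as UniqueSetoid
import Data.List.Relation.Unary.Unique.Setoid.Properties as UniqueProperties
open import Data.Maybe.Base using (just)
open import Data.Nat.Base as ℕ using (ℕ; zero; suc; _≤_; _<_; _<ᵇ_; s≤s)
import Data.Nat.Properties as ℕ
open import Data.Product.Base using (Σ-syntax; ∃-syntax; ∃₂; _×_; _,_; proj₁; proj₂)
open import Data.Sum.Base as Sum using (_⊎_; inj₁; inj₂; [_,_]′)
open import Function.Base using (id; _∘_)
open import Function.Bundles using (mk⇔; Equivalence)
open import Relation.Binary.Bundles using (Setoid; DecSetoid)
import Relation.Binary.Construct.Closure.Equivalence as EqClosure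
open import Relation.Binary.Construct.Closure.ReflexiveTransitive
  using (_◅_; _◅◅_) renaming (ε to idle)
import Relation.Binary.Construct.Closure.Symmetric as SymClosure
open import Relation.Binary.PropositionalEquality as ≡ using (_≡_; _≢_)
import Relation.Binary.Reasoning.Setoid as SetoidReasoning
open import Relation.Nullary using (¬_; Dec; yes; no; does)
open import Relation.Nullary.Decidable using (does-⇔; dec-true)
open import Relation.Unary using (Pred; _∈_; _∉_; _⊆_; _≐_; _∩_)

-- The induction behind the support statement peels a Bott-Samelson bimodule from the left. At a
-- decreasing step I ⊃ K, a map that is linear over R^I only has to be split into pieces that are
-- linear over the larger ring R^K, and these carry the left twists `w ∙ v` with v ∈ W_I. Hence
-- twists are allowed on both sides, and the statement is about `w ⁻¹ ∙ x`. The splitting belongs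
-- over the fraction field of R; denominators are avoided by multiplying with a nonzero invariant
-- and cancelling it at the end. No division by the order of W_I occurs: that traces do not all
-- vanish comes from the separating elements, as in Artin's independence of characters.
--
-- The maximal element of p is the right twist because w_{M₀} * ⋯ * w_{M_d} is the maximal element
-- of q. For q < p it lies below x, so a product equal to x would force the two maximal elements,
-- and then the cosets, to coincide. The required facts on Bruhat order come from the presentation
-- of W, through a parity count of reflections.

-- Coxeter groups: parity of reflections, strong exchange, Bruhat order and *-products.

module BruhatOrder {u} (em : Classical) (𝒲 : CoxeterSystem u) where

  open CoxeterSystem 𝒲
  open Coxeter em 𝒲
  open GroupProperties group using
    ( \\-leftDividesˡ; \\-leftDividesʳ; //-rightDividesˡ; //-rightDividesʳ; ∙-cancelˡ
    ; inverseˡ-unique; ⁻¹-anti-homo-∙; ⁻¹-involutive; ε⁻¹≈ε)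
  open SetoidReasoning setoid

  infixl 8 _^_
  _^_ : W → W → W
  t ^ x = x ⁻¹ ∙ (t ∙ x)

  ^-cong : ∀ {t t′ x x′} → t ≈ t′ → x ≈ x′ → t ^ x ≈ t′ ^ x′
  ^-cong e e′ = ∙-cong (⁻¹-cong e′) (∙-cong e e′)

  ^-identity : ∀ t → t ^ ε ≈ t
  ^-identity t = trans (∙-cong ε⁻¹≈ε (identityʳ t)) (identityˡ t)

  ^-∙ : ∀ t x y → t ^ (x ∙ y) ≈ t ^ x ^ y
  ^-∙ t x y = begin
    (x ∙ y) ⁻¹ ∙ (t ∙ (x ∙ y))       ≈⟨ ∙-cong (⁻¹-anti-homo-∙ x y) (sym (assoc t x y)) ⟩
    (y ⁻¹ ∙ x ⁻¹) ∙ ((t ∙ x) ∙ y)    ≈⟨ assoc _ _ _ ⟩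
    y ⁻¹ ∙ (x ⁻¹ ∙ ((t ∙ x) ∙ y))    ≈⟨ ∙-congˡ (assoc _ _ _) ⟨
    y ⁻¹ ∙ ((x ⁻¹ ∙ (t ∙ x)) ∙ y)    ∎

  ^-self : ∀ t → t ^ t ≈ t
  ^-self t = \\-leftDividesʳ t t

  conjugate-^ : ∀ t x → (x ∙ (t ^ x)) ∙ x ⁻¹ ≈ t
  conjugate-^ t x = trans (∙-congʳ (\\-leftDividesˡ x _)) (//-rightDividesʳ x t)

  ^-conjugate : ∀ t x → ((x ∙ t) ∙ x ⁻¹) ^ x ≈ t
  ^-conjugate t x = trans (∙-congˡ (//-rightDividesˡ x _)) (\\-leftDividesʳ x t)

  relator≈ε : ∀ {s t n} → m s t ≡ just n → ∏ (concat (replicate n (s ∷ t ∷ []))) ≈ ε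
  relator≈ε {s} {t} {n} e = sym (Equivalence.from (presented [] r)
    (≡.subst (EqClosure.EqClosure (Insertion m) []) (List.++-identityʳ r)
      (SymClosure.fwd (relator [] [] e) ◅ idle)))
    where r = concat (replicate n (s ∷ t ∷ []))

  ι∙ι : ∀ s → ι s ∙ ι s ≈ ε
  ι∙ι s = trans (∙-congˡ (sym (identityʳ (ι s)))) (relator≈ε (m-diag s))

  ι⁻¹ : ∀ s → ι s ⁻¹ ≈ ι s
  ι⁻¹ s = sym (inverseˡ-unique _ _ (ι∙ι s))

  ι-cancel : ∀ s x → ι s ∙ (ι s ∙ x) ≈ x
  ι-cancel s x = trans (sym (assoc _ _ _)) (trans (∙-congʳ (ι∙ι s)) (identityˡ x))

  ∏-++ : ∀ a b → ∏ (a ++ b) ≈ ∏ a ∙ ∏ b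
  ∏-++ []      b = sym (identityˡ _)
  ∏-++ (s ∷ a) b = trans (∙-congˡ (∏-++ a b)) (sym (assoc _ _ _))

  ∏-reverse : ∀ a → ∏ (reverse a) ≈ ∏ a ⁻¹
  ∏-reverse []      = sym ε⁻¹≈ε
  ∏-reverse (s ∷ a) = begin
    ∏ (reverse (s ∷ a))           ≡⟨ ≡.cong ∏ (List.unfold-reverse s a) ⟩
    ∏ (reverse a ++ s ∷ [])       ≈⟨ ∏-++ (reverse a) _ ⟩
    ∏ (reverse a) ∙ (ι s ∙ ε)     ≈⟨ ∙-cong (∏-reverse a) (trans (identityʳ _) (sym (ι⁻¹ s))) ⟩
    ∏ a ⁻¹ ∙ ι s ⁻¹               ≈⟨ ⁻¹-anti-homo-∙ _ _ ⟨
    (ι s ∙ ∏ a) ⁻¹                ∎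

  -- The parity of the number of i with t = s₁ ⋯ sᵢ ⋯ s₁, where a = s₁ ⋯ s_k.
  odd : Word → W → Bool
  odd []      t = false
  odd (s ∷ a) t = does (em {P = t ≈ ι s}) xor odd a (t ^ ι s)

  odd-cong : ∀ a {t t′} → t ≈ t′ → odd a t ≡ odd a t′
  odd-cong []      e = ≡.refl
  odd-cong (s ∷ a) e = ≡.cong₂ _xor_
    (does-⇔ (mk⇔ (trans (sym e)) (trans e)) em em) (odd-cong a (^-cong e refl))

  -- The cocycle rule: behind `a`, the reflections of `b` appear conjugated by `∏ a`, which is
  -- undone by moving `t` to `t ^ ∏ a`.
  odd-++ : ∀ a b t → odd (a ++ b) t ≡ odd a t xor odd b (t ^ ∏ a)
  odd-++ []      b t = odd-cong b (sym (^-identity t))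
  odd-++ (s ∷ a) b t = ≡.trans
    (≡.cong (does (em {P = t ≈ ι s}) xor_) (≡.trans (odd-++ a b _)
      (≡.cong (odd a _ xor_) (odd-cong b (sym (^-∙ t (ι s) (∏ a)))))))
    (≡.sym (Bool.xor-assoc (does (em {P = t ≈ ι s})) (odd a _) (odd b _)))

  pow : W → ℕ → W
  pow x zero    = ε
  pow x (suc n) = x ∙ pow x n

  pow-+ : ∀ x i j → pow x (i ℕ.+ j) ≈ pow x i ∙ pow x j
  pow-+ x zero    j = sym (identityˡ _)
  pow-+ x (suc i) j = trans (∙-congˡ (pow-+ x i j)) (sym (assoc _ _ _))

  pow-swap : ∀ x y i → pow (x ∙ y) (suc i) ≈ x ∙ (pow (y ∙ x) i ∙ y)
  pow-swap x y zero    = trans (identityʳ _) (∙-congˡ (sym (identityˡ y)))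
  pow-swap x y (suc i) = begin
    (x ∙ y) ∙ pow (x ∙ y) (suc i)          ≈⟨ ∙-congˡ (pow-swap x y i) ⟩
    (x ∙ y) ∙ (x ∙ (pow (y ∙ x) i ∙ y))    ≈⟨ assoc _ _ _ ⟩
    x ∙ (y ∙ (x ∙ (pow (y ∙ x) i ∙ y)))    ≈⟨ ∙-congˡ (assoc _ _ _) ⟨
    x ∙ ((y ∙ x) ∙ (pow (y ∙ x) i ∙ y))    ≈⟨ ∙-congˡ (assoc _ _ _) ⟨
    x ∙ (((y ∙ x) ∙ pow (y ∙ x) i) ∙ y)    ∎

  parity : ℕ → (ℕ → Bool) → Bool
  parity zero    f = false
  parity (suc k) f = f 0 xor parity k (f ∘ suc)

  parity-cong : ∀ k {f g} → (∀ i → f i ≡ g i) → parity k f ≡ parity k g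
  parity-cong zero    e = ≡.refl
  parity-cong (suc k) e = ≡.cong₂ _xor_ (e 0) (parity-cong k (e ∘ suc))

  parity-+ : ∀ j k f → parity (j ℕ.+ k) f ≡ parity j f xor parity k (f ∘ (j ℕ.+_))
  parity-+ zero    k f = ≡.refl
  parity-+ (suc j) k f = ≡.trans (≡.cong (f 0 xor_) (parity-+ j k (f ∘ suc)))
    (≡.sym (Bool.xor-assoc (f 0) _ _))

  alternating : S → S → ℕ → Word
  alternating s t zero    = []
  alternating s t (suc k) = s ∷ alternating t s k

  concat-replicate : ∀ s t n → concat (replicate n (s ∷ t ∷ [])) ≡ alternating s t (n ℕ.+ n)
  concat-replicate s t zero    = ≡.refl
  concat-replicate s t (suc n) rewrite ℕ.+-suc n n =
    ≡.cong (λ a → s ∷ t ∷ a) (concat-replicate s t n)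

  ∏-concat-replicate : ∀ s t n → ∏ (concat (replicate n (s ∷ t ∷ []))) ≈ pow (ι s ∙ ι t) n
  ∏-concat-replicate s t zero    = refl
  ∏-concat-replicate s t (suc n) =
    trans (sym (assoc _ _ _)) (∙-congˡ (∏-concat-replicate s t n))

  -- The prefixes of s t s ⋯ give the palindromes (s t)^i s; conjugating (t s)^i t by s yields the
  -- next one, (s t)^(i+1) s.
  odd-alternating : ∀ s t k x → odd (alternating s t k) x ≡
                    parity k (λ i → does (em {P = x ≈ pow (ι s ∙ ι t) i ∙ ι s}))
  odd-alternating s t zero    x = ≡.refl
  odd-alternating s t (suc k) x = ≡.cong₂ _xor_
    (does-⇔ (mk⇔ (λ e → trans e (sym (identityˡ _))) (λ e → trans e (identityˡ _))) em em)
    (≡.trans (odd-alternating t s k (x ^ ι s))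
      (parity-cong k λ i → does-⇔ (mk⇔ (to i) (from i)) em em))
    where
    shifted : ∀ i → (ι s ∙ (pow (ι t ∙ ι s) i ∙ ι t)) ∙ ι s ⁻¹ ≈ pow (ι s ∙ ι t) (suc i) ∙ ι s
    shifted i = ∙-cong (sym (pow-swap _ _ i)) (ι⁻¹ s)
    to : ∀ i → x ^ ι s ≈ pow (ι t ∙ ι s) i ∙ ι t → x ≈ pow (ι s ∙ ι t) (suc i) ∙ ι s
    to i e = trans (sym (conjugate-^ x (ι s))) (trans (∙-congʳ (∙-congˡ e)) (shifted i))
    from : ∀ i → x ≈ pow (ι s ∙ ι t) (suc i) ∙ ι s → x ^ ι s ≈ pow (ι t ∙ ι s) i ∙ ι t
    from i e = trans (^-cong (trans e (sym (shifted i))) refl) (^-conjugate _ (ι s))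

  -- The reflections counted for a relator (s t)ⁿ are (s t)ⁱ s for i < 2n, and
  -- (s t)ⁿ = 1 makes each of them occur twice.
  odd-relator : ∀ {s t n} → m s t ≡ just n → ∀ x →
                odd (concat (replicate n (s ∷ t ∷ []))) x ≡ false
  odd-relator {s} {t} {n} e x = ≡.trans
    (≡.trans (≡.cong (λ a → odd a x) (concat-replicate s t n)) (odd-alternating s t (n ℕ.+ n) x))
    (≡.trans (parity-+ n n f)
      (≡.trans (≡.cong (parity n f xor_) (parity-cong n periodic)) (Bool.xor-same (parity n f))))
    where
    ρ = ι s ∙ ι t
    f : ℕ → Bool
    f i = does (em {P = x ≈ pow ρ i ∙ ι s})
    pow-periodic : ∀ i → pow ρ (n ℕ.+ i) ≈ pow ρ i
    pow-periodic i = trans (pow-+ ρ n i) (trans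
      (∙-congʳ (trans (sym (∏-concat-replicate s t n)) (relator≈ε e))) (identityˡ _))
    periodic : ∀ i → f (n ℕ.+ i) ≡ f i
    periodic i = does-⇔ (mk⇔ (λ e′ → trans e′ (∙-congʳ (pow-periodic i)))
                             (λ e′ → trans e′ (∙-congʳ (sym (pow-periodic i))))) em em

  odd-insertion : ∀ {a b} → Insertion m a b → ∀ x → odd a x ≡ odd b x
  odd-insertion (relator a b {s} {t} {n} e) x = ≡.trans (odd-++ a b x)
    (≡.trans (≡.cong (odd a x xor_) (≡.sym tail)) (≡.sym (odd-++ a (r ++ b) x)))
    where
    r = concat (replicate n (s ∷ t ∷ []))
    tail : odd (r ++ b) (x ^ ∏ a) ≡ odd b (x ^ ∏ a)
    tail = ≡.trans (odd-++ r b _) (≡.cong₂ _xor_ (odd-relator e _)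
      (odd-cong b (trans (^-cong refl (relator≈ε e)) (^-identity _))))

  -- By `presented`, words with equal product are linked by insertions of relators. The parity
  -- therefore depends on the product alone; it marks the left inversions of an element of W.
  odd-resp : ∀ {a b} → ∏ a ≈ ∏ b → ∀ x → odd a x ≡ odd b x
  odd-resp {a} {b} e x = EqClosure.gfold ≡.isEquivalence (λ a → odd a x)
    (λ i → odd-insertion i x) (Equivalence.to (presented a b) e)

  Reflection : Pred W u
  Reflection t = ∃₂ λ w s → t ≈ (w ∙ ι s) ∙ w ⁻¹

  ι-reflection : ∀ s → Reflection (ι s)
  ι-reflection s = ε , s , sym (trans (∙-cong (identityˡ _) ε⁻¹≈ε) (identityʳ _))

  conjugate-reflection : ∀ {t} x → Reflection t → Reflection ((x ∙ t) ∙ x ⁻¹)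
  conjugate-reflection {t} x (w , s , e) = x ∙ w , s , (begin
    (x ∙ t) ∙ x ⁻¹                      ≈⟨ ∙-congʳ (∙-congˡ e) ⟩
    (x ∙ ((w ∙ ι s) ∙ w ⁻¹)) ∙ x ⁻¹     ≈⟨ ∙-congʳ (assoc _ _ _) ⟨
    ((x ∙ (w ∙ ι s)) ∙ w ⁻¹) ∙ x ⁻¹     ≈⟨ assoc _ _ _ ⟩
    (x ∙ (w ∙ ι s)) ∙ (w ⁻¹ ∙ x ⁻¹)     ≈⟨ ∙-cong (sym (assoc _ _ _)) (sym (⁻¹-anti-homo-∙ x w)) ⟩
    ((x ∙ w) ∙ ι s) ∙ (x ∙ w) ⁻¹        ∎)

  reflection-involutive : ∀ {t} → Reflection t → t ∙ t ≈ ε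
  reflection-involutive {t} (w , s , e) = begin
    t ∙ t                                         ≈⟨ ∙-cong e e ⟩
    ((w ∙ ι s) ∙ w ⁻¹) ∙ ((w ∙ ι s) ∙ w ⁻¹)       ≈⟨ assoc _ _ _ ⟩
    (w ∙ ι s) ∙ (w ⁻¹ ∙ ((w ∙ ι s) ∙ w ⁻¹))       ≈⟨ ∙-congˡ (∙-congˡ (assoc _ _ _)) ⟩
    (w ∙ ι s) ∙ (w ⁻¹ ∙ (w ∙ (ι s ∙ w ⁻¹)))       ≈⟨ ∙-congˡ (\\-leftDividesʳ w _) ⟩
    (w ∙ ι s) ∙ (ι s ∙ w ⁻¹)                      ≈⟨ assoc _ _ _ ⟩
    w ∙ (ι s ∙ (ι s ∙ w ⁻¹))                      ≈⟨ ∙-congˡ (ι-cancel s _) ⟩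
    w ∙ w ⁻¹                                      ≈⟨ inverseʳ w ⟩
    ε                                             ∎

  reflection-cancel : ∀ {t} → Reflection t → ∀ x → t ∙ (t ∙ x) ≈ x
  reflection-cancel r x =
    trans (sym (assoc _ _ _)) (trans (∙-congʳ (reflection-involutive r)) (identityˡ x))

  -- Write t as the palindrome b s b⁻¹. The middle letter counts once, and the outer parts have
  -- equal parity because `b ++ reverse b` has product ε and so counts evenly, like the empty word.
  odd-reflection : ∀ {t} → Reflection t → ∃[ a ] ∏ a ≈ t × odd a t ≡ true
  odd-reflection {t} (w , s , e) with generated w
  ... | b , ∏b≈w = b ++ s ∷ reverse b , product , ≡.trans (odd-++ b _ t) (≡.trans
      (≡.cong (odd b t xor_) (≡.cong₂ _xor_ (dec-true em t^b) (≡.trans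
        (odd-cong (reverse b) (trans (^-cong t^b refl) (trans (^-self (ι s)) (sym t^b)))) tail)))
      (lemma (odd b t)))
    where
    t^b : t ^ ∏ b ≈ ι s
    t^b = trans (^-cong e ∏b≈w) (^-conjugate (ι s) w)
    product : ∏ (b ++ s ∷ reverse b) ≈ t
    product = trans (∏-++ b _) (trans (sym (assoc _ _ _)) (trans
      (∙-cong (∙-congʳ ∏b≈w) (trans (∏-reverse b) (⁻¹-cong ∏b≈w))) (sym e)))
    tail : odd (reverse b) (t ^ ∏ b) ≡ odd b t
    tail with odd-++ b (reverse b) t | odd-resp {b ++ reverse b} {[]}
                (trans (∏-++ b _) (trans (∙-congˡ (∏-reverse b)) (inverseʳ _))) t
    ... | eq | eq′ with odd b t | odd (reverse b) (t ^ ∏ b)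
    ... | true  | true  = ≡.refl
    ... | false | false = ≡.refl
    ... | true  | false = ⊥-elim (case (≡.trans (≡.sym eq) eq′)) where case : true ≢ false ; case ()
    ... | false | true  = ⊥-elim (case (≡.trans (≡.sym eq) eq′)) where case : true ≢ false ; case ()
    lemma : ∀ c → c xor (true xor c) ≡ true
    lemma true  = ≡.refl
    lemma false = ≡.refl

  data Deletion : Word → Word → Set u where
    here  : ∀ {s a} → Deletion (s ∷ a) a
    there : ∀ {s a b} → Deletion a b → Deletion (s ∷ a) (s ∷ b)

  deletion-length : ∀ {a b} → Deletion a b → length b < length a
  deletion-length here      = ℕ.n<1+n _
  deletion-length (there d) = s≤s (deletion-length d)

  deletion-⊑ : ∀ {a b c} → Deletion a b → a ⊑ c → b ⊑ c
  deletion-⊑ d         (s Sublist.∷ʳ a⊑c)        = s Sublist.∷ʳ deletion-⊑ d a⊑c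
  deletion-⊑ here      (_ Sublist.∷ a⊑c)         = _ Sublist.∷ʳ a⊑c
  deletion-⊑ (there d) (e Sublist.∷ a⊑c)         = e Sublist.∷ deletion-⊑ d a⊑c

  -- An odd count is positive, so t = s₁ ⋯ sᵢ ⋯ s₁ for some i, and left multiplication by t then
  -- strikes out the letter sᵢ.
  odd⇒deletion : ∀ a t → odd a t ≡ true → ∃[ b ] Deletion a b × ∏ b ≈ t ∙ ∏ a
  odd⇒deletion (s ∷ a) t e with em {P = t ≈ ι s}
  ... | yes t≈s = a , here , sym (trans (∙-congʳ t≈s) (ι-cancel s _))
  ... | no  _   = let b , d , eq = odd⇒deletion a (t ^ ι s) e in s ∷ b , there d , (begin
      ι s ∙ ∏ b                             ≈⟨ ∙-congˡ eq ⟩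
      ι s ∙ ((ι s ⁻¹ ∙ (t ∙ ι s)) ∙ ∏ a)    ≈⟨ ∙-congˡ (assoc _ _ _) ⟩
      ι s ∙ (ι s ⁻¹ ∙ ((t ∙ ι s) ∙ ∏ a))    ≈⟨ \\-leftDividesˡ _ _ ⟩
      (t ∙ ι s) ∙ ∏ a                       ≈⟨ assoc _ _ _ ⟩
      t ∙ (ι s ∙ ∏ a)                       ∎)

  ∏-reduced : ∀ w → ∏ (reduced w) ≈ w
  ∏-reduced w = proj₁ (proj₂ (reducedWord w))

  ℓ-minimal : ∀ {w} a → ∏ a ≈ w → ℓ w ≤ length a
  ℓ-minimal {w} = proj₂ (proj₂ (reducedWord w))

  ℓ-≤ : ∀ {x y} → x ≈ y → ℓ x ≤ ℓ y
  ℓ-≤ {x} {y} e = ℓ-minimal (reduced y) (trans (∏-reduced y) (sym e))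

  ℓ-cong : ∀ {x y} → x ≈ y → ℓ x ≡ ℓ y
  ℓ-cong e = ℕ.≤-antisym (ℓ-≤ e) (ℓ-≤ (sym e))

  ℓ-ι∙ : ∀ s x → ℓ (ι s ∙ x) ≤ suc (ℓ x)
  ℓ-ι∙ s x = ℓ-minimal (s ∷ reduced x) (∙-congˡ (∏-reduced x))

  ℓ-⁻¹ : ∀ x → ℓ (x ⁻¹) ≡ ℓ x
  ℓ-⁻¹ x = ℕ.≤-antisym (bound x)
    (ℕ.≤-trans (ℕ.≤-reflexive (ℓ-cong (sym (⁻¹-involutive x)))) (bound (x ⁻¹)))
    where
    bound : ∀ x → ℓ (x ⁻¹) ≤ ℓ x
    bound x = ℕ.≤-trans
      (ℓ-minimal (reverse (reduced x)) (trans (∏-reverse (reduced x)) (⁻¹-cong (∏-reduced x))))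
      (ℕ.≤-reflexive (List.length-reverse (reduced x)))

  odd⇒shorter : ∀ {t} a → odd a t ≡ true → ∀ {w} → ∏ a ≈ w → ℓ (t ∙ w) < length a
  odd⇒shorter a o e = let b , d , eq = odd⇒deletion a _ o in
    ℕ.≤-<-trans (ℓ-minimal b (trans eq (∙-congˡ e))) (deletion-length d)

  -- Left multiplication by t flips the parity at t: a word for t contributes an odd count, and
  -- `t ^ t ≈ t` keeps the count of `a` at the same reflection.
  even⇒odd : ∀ {t} → Reflection t → ∀ a b → ∏ b ≈ t ∙ ∏ a → odd a t ≡ false → odd b t ≡ true
  even⇒odd {t} r a b e o = let c , ∏c≈t , o′ = odd-reflection r in ≡.trans
    (odd-resp {b} {c ++ a} (trans e (trans (∙-congʳ (sym ∏c≈t)) (sym (∏-++ c a)))) t)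
    (≡.trans (odd-++ c a t) (≡.cong₂ _xor_ o′
      (≡.trans (odd-cong a (trans (^-cong refl ∏c≈t) (^-self t))) o)))

  -- In the even case t is counted oddly for t w, so t (t w) = w is shorter than t w.
  odd-or-longer : ∀ {t} → Reflection t → ∀ a → odd a t ≡ true ⊎ ℓ (∏ a) < ℓ (t ∙ ∏ a)
  odd-or-longer {t} r a with odd a t in o
  ... | true  = inj₁ ≡.refl
  ... | false = inj₂ (ℕ.≤-<-trans (ℓ-≤ (sym (reflection-cancel r _)))
    (odd⇒shorter (reduced _) (even⇒odd r a (reduced _) (∏-reduced _) o) (∏-reduced _)))

  shorter-or-longer : ∀ {t} → Reflection t → ∀ w → ℓ (t ∙ w) < ℓ w ⊎ ℓ w < ℓ (t ∙ w)
  shorter-or-longer r w with odd-or-longer r (reduced w)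
  ... | inj₁ o = inj₁ (odd⇒shorter (reduced w) o (∏-reduced w))
  ... | inj₂ l = inj₂ (≡.subst₂ _<_ (ℓ-cong (∏-reduced w)) (ℓ-cong (∙-congˡ (∏-reduced w))) l)

  -- Strong exchange. `a` may be any word: `≤ᴮ⇒subword` strikes letters from subwords that need not
  -- be reduced.
  exchange : ∀ {t} → Reflection t → ∀ a → ℓ (t ∙ ∏ a) < ℓ (∏ a) →
             ∃[ b ] Deletion a b × ∏ b ≈ t ∙ ∏ a
  exchange r a l with odd-or-longer r a
  ... | inj₁ o  = odd⇒deletion a _ o
  ... | inj₂ l′ = ⊥-elim (ℕ.<-asym l l′)

  -- Bruhat order

  -- `_<·_` multiplies by a reflection on the right, the exchange condition on the left; conjugating
  -- by `x` passes from one to the other.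
  <·-intro : ∀ {t x y} → Reflection t → y ≈ t ∙ x → ℓ x < ℓ y → x <· y
  <·-intro {t} {x} (w , s , e) y≈tx l = x ⁻¹ ∙ w , s , (begin
    _                                                ≈⟨ y≈tx ⟩
    t ∙ x                                            ≈⟨ ∙-congʳ e ⟩
    ((w ∙ ι s) ∙ w ⁻¹) ∙ x                           ≈⟨ \\-leftDividesˡ x _ ⟨
    x ∙ (x ⁻¹ ∙ (((w ∙ ι s) ∙ w ⁻¹) ∙ x))            ≈⟨ ∙-congˡ shuffle ⟩
    x ∙ (((x ⁻¹ ∙ w) ∙ ι s) ∙ (x ⁻¹ ∙ w) ⁻¹)         ∎) , l
    where
    shuffle : x ⁻¹ ∙ (((w ∙ ι s) ∙ w ⁻¹) ∙ x) ≈ ((x ⁻¹ ∙ w) ∙ ι s) ∙ (x ⁻¹ ∙ w) ⁻¹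
    shuffle = begin
      x ⁻¹ ∙ (((w ∙ ι s) ∙ w ⁻¹) ∙ x)       ≈⟨ ∙-congˡ (assoc _ _ _) ⟩
      x ⁻¹ ∙ ((w ∙ ι s) ∙ (w ⁻¹ ∙ x))       ≈⟨ assoc _ _ _ ⟨
      (x ⁻¹ ∙ (w ∙ ι s)) ∙ (w ⁻¹ ∙ x)       ≈⟨ ∙-cong (sym (assoc _ _ _))
        (trans (∙-congˡ (sym (⁻¹-involutive x))) (sym (⁻¹-anti-homo-∙ _ _))) ⟩
      ((x ⁻¹ ∙ w) ∙ ι s) ∙ (x ⁻¹ ∙ w) ⁻¹    ∎

  <·-elim : ∀ {x y} → x <· y → Σ[ t ∈ W ] Reflection t × y ≈ t ∙ x × ℓ x < ℓ y
  <·-elim {x} (w , s , e , l) = (x ∙ r) ∙ x ⁻¹ , conjugate-reflection x (w , s , refl) ,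
    trans e (sym (//-rightDividesˡ x _)) , l
    where r = (w ∙ ι s) ∙ w ⁻¹

  ≤ᴮ-reflexive : ∀ {x y} → x ≈ y → x ≤ᴮ y
  ≤ᴮ-reflexive e = inj₁ e ◅ idle

  <·⇒≤ᴮ : ∀ {x y} → x <· y → x ≤ᴮ y
  <·⇒≤ᴮ l = inj₂ l ◅ idle

  ≤ᴮ⇒≈⊎< : ∀ {x y} → x ≤ᴮ y → x ≈ y ⊎ ℓ x < ℓ y
  ≤ᴮ⇒≈⊎< idle = inj₁ refl
  ≤ᴮ⇒≈⊎< (st ◅ l) with st | ≤ᴮ⇒≈⊎< l
  ... | inj₁ e               | inj₁ e′ = inj₁ (trans e e′)
  ... | inj₁ e               | inj₂ l′ = inj₂ (ℕ.≤-<-trans (ℓ-≤ e) l′)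
  ... | inj₂ (_ , _ , _ , l) | inj₁ e′ = inj₂ (ℕ.<-≤-trans l (ℓ-≤ e′))
  ... | inj₂ (_ , _ , _ , l) | inj₂ l′ = inj₂ (ℕ.<-trans l l′)

  ≤ᴮ⇒ℓ≤ : ∀ {x y} → x ≤ᴮ y → ℓ x ≤ ℓ y
  ≤ᴮ⇒ℓ≤ l with ≤ᴮ⇒≈⊎< l
  ... | inj₁ e  = ℓ-≤ e
  ... | inj₂ l′ = ℕ.<⇒≤ l′

  ≤ᴮ-antisym : ∀ {x y} → x ≤ᴮ y → y ≤ᴮ x → x ≈ y
  ≤ᴮ-antisym l l′ with ≤ᴮ⇒≈⊎< l
  ... | inj₁ e  = e
  ... | inj₂ l″ = ⊥-elim (ℕ.<⇒≱ l″ (≤ᴮ⇒ℓ≤ l′))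

  ≤ᴮ-⁻¹ : ∀ {x y} → x ≤ᴮ y → (x ⁻¹) ≤ᴮ (y ⁻¹)
  ≤ᴮ-⁻¹ idle = idle
  ≤ᴮ-⁻¹ (inj₁ e ◅ l) = inj₁ (⁻¹-cong e) ◅ ≤ᴮ-⁻¹ l
  ≤ᴮ-⁻¹ {x} (inj₂ (w , s , e , l) ◅ l′) = inj₂ (<·-intro {t = r} (w , s , refl)
    (trans (⁻¹-cong e) (trans (⁻¹-anti-homo-∙ x r) (∙-congʳ r⁻¹)))
    (≡.subst₂ _<_ (≡.sym (ℓ-⁻¹ x)) (≡.sym (ℓ-⁻¹ _)) l)) ◅ ≤ᴮ-⁻¹ l′
    where
    r = (w ∙ ι s) ∙ w ⁻¹
    r⁻¹ : r ⁻¹ ≈ r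
    r⁻¹ = sym (inverseˡ-unique r r (reflection-involutive (w , s , refl)))

  -- A failed length test leaves equal lengths open; `shorter-or-longer` rules them out.
  ⋆ˢ-cases : ∀ s w → (s ⋆ˢ w ≡ ι s ∙ w × ℓ w < ℓ (ι s ∙ w)) ⊎ (s ⋆ˢ w ≡ w × ℓ (ι s ∙ w) < ℓ w)
  ⋆ˢ-cases s w with ℓ w <ᵇ ℓ (ι s ∙ w) in eq
  ... | true  = inj₁ (≡.refl , ℕ.<ᵇ⇒< _ _ (≡.subst Bool.T (≡.sym eq) _))
  ... | false with shorter-or-longer (ι-reflection s) w
  ...   | inj₁ l = inj₂ (≡.refl , l)
  ...   | inj₂ l = ⊥-elim (≡.subst Bool.T eq (ℕ.<⇒<ᵇ l))

  descent-⋆ˢ : ∀ s w → ℓ (ι s ∙ w) ≤ ℓ w → s ⋆ˢ w ≡ w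
  descent-⋆ˢ s w l with ⋆ˢ-cases s w
  ... | inj₁ (_ , l′) = ⊥-elim (ℕ.<⇒≱ l′ l)
  ... | inj₂ (e , _)  = e

  ≤ᴮ-⋆ˢ : ∀ s w → w ≤ᴮ (s ⋆ˢ w)
  ≤ᴮ-⋆ˢ s w with s ⋆ˢ w | ⋆ˢ-cases s w
  ... | _ | inj₁ (≡.refl , l) = <·⇒≤ᴮ (<·-intro (ι-reflection s) refl l)
  ... | _ | inj₂ (≡.refl , _) = idle

  ι∙-conjugate : ∀ s {t x y} → y ≈ t ∙ x → ι s ∙ y ≈ ((ι s ∙ t) ∙ ι s ⁻¹) ∙ (ι s ∙ x)
  ι∙-conjugate s {t} {x} {y} e = begin
    ι s ∙ y                                  ≈⟨ ∙-congˡ e ⟩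
    ι s ∙ (t ∙ x)                            ≈⟨ assoc _ _ _ ⟨
    (ι s ∙ t) ∙ x                            ≈⟨ ∙-congˡ (\\-leftDividesʳ (ι s) x) ⟨
    (ι s ∙ t) ∙ (ι s ⁻¹ ∙ (ι s ∙ x))         ≈⟨ assoc _ _ _ ⟨
    ((ι s ∙ t) ∙ ι s ⁻¹) ∙ (ι s ∙ x)         ∎

  -- The lifting property, phrased with `_⋆ˢ_`. If sy > y, conjugation by s gives a reflection
  -- leading from sx up to sy. If sy < y, the target is y, reached through x when sx < x and through
  -- sy when sx < sy.
  <·-lift : ∀ s {x y} → x <· y → (ι s ∙ x) ≤ᴮ (s ⋆ˢ y)
  <·-lift s {x} {y} x<·y with s ⋆ˢ y | ⋆ˢ-cases s y | <·-elim x<·y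
  ... | _ | inj₁ (≡.refl , l) | t , r , e , x<y =
    <·⇒≤ᴮ (<·-intro (conjugate-reflection (ι s) r) (ι∙-conjugate s e)
      (ℕ.≤-<-trans (ℓ-ι∙ s x) (ℕ.≤-<-trans x<y l)))
  ... | _ | inj₂ (≡.refl , sy<y) | t , r , e , x<y with shorter-or-longer (ι-reflection s) x
  ...   | inj₁ sx<x = inj₂ (<·-intro (ι-reflection s) (sym (ι-cancel s x)) sx<x) ◅ <·⇒≤ᴮ x<·y
  ...   | inj₂ _ with shorter-or-longer (conjugate-reflection (ι s) r) (ι s ∙ x)
  ...     | inj₂ l = inj₂ (<·-intro (conjugate-reflection (ι s) r) (ι∙-conjugate s e)
                             (ℕ.<-≤-trans l (ℓ-≤ (sym (ι∙-conjugate s e)))))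
                     ◅ <·⇒≤ᴮ (<·-intro (ι-reflection s) (sym (ι-cancel s y)) sy<y)
  -- Now sy is shorter than sx. Striking the leading s from the word for sx gives x = sy, so sx = y;
  -- striking a later letter would make y shorter than x.
  ...     | inj₁ l with exchange (conjugate-reflection (ι s) r) (s ∷ reduced x)
                      (≡.subst₂ _<_ (ℓ-cong (∙-congˡ (∙-congˡ (sym (∏-reduced x)))))
                                    (ℓ-cong (∙-congˡ (sym (∏-reduced x)))) l)
  ...       | b , d , eq = ≤ᴮ-reflexive (from d (trans eq
                             (trans (∙-congˡ (∙-congˡ (∏-reduced x))) (sym (ι∙-conjugate s e)))))
    where
    from : ∀ {b} → Deletion (s ∷ reduced x) b → ∏ b ≈ ι s ∙ y → ι s ∙ x ≈ y
    from here          eq = trans (∙-congˡ (trans (sym (∏-reduced x)) eq)) (ι-cancel s y)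
    from (there {b = b} d) eq = ⊥-elim (ℕ.<-asym x<y
      (ℕ.≤-<-trans (ℓ-minimal b (∙-cancelˡ (ι s) _ _ eq)) (deletion-length d)))

  ≤ᴮ-lift : ∀ s {x y} → x ≤ᴮ y → (ι s ∙ x) ≤ᴮ (s ⋆ˢ y)
  ≤ᴮ-lift s {x} idle with s ⋆ˢ x | ⋆ˢ-cases s x
  ... | _ | inj₁ (≡.refl , _) = idle
  ... | _ | inj₂ (≡.refl , l) = <·⇒≤ᴮ (<·-intro (ι-reflection s) (sym (ι-cancel s x)) l)
  ≤ᴮ-lift s (inj₁ e ◅ l) = inj₁ (∙-congˡ e) ◅ ≤ᴮ-lift s l
  ≤ᴮ-lift s {x} {z} (_◅_ {j = y} (inj₂ l) l′) with s ⋆ˢ y | ⋆ˢ-cases s y | <·-lift s l | ≤ᴮ-lift s l′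
  ... | _ | inj₁ (≡.refl , _) | l₁ | l₂ = l₁ ◅◅ l₂
  ... | _ | inj₂ (≡.refl , _) | l₁ | _  = l₁ ◅◅ l′ ◅◅ ≤ᴮ-⋆ˢ s z

  ε≤ᴮ : ∀ w → ε ≤ᴮ w
  ε≤ᴮ w = go (reduced w) (∏-reduced w) ℕ.≤-refl
    where
    go : ∀ a {w} → ∏ a ≈ w → length a ≤ ℓ w → ε ≤ᴮ w
    go []      e l = ≤ᴮ-reflexive e
    go (s ∷ a) {w} e l = go a ∏a≈sw
      (ℕ.≤-pred (ℕ.≤-trans l (ℕ.≤-trans (ℓ-≤ (sym (ι-cancel s w))) (ℓ-ι∙ s (ι s ∙ w))))) ◅◅
      <·⇒≤ᴮ (<·-intro (ι-reflection s) (sym (ι-cancel s w))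
        (ℕ.≤-<-trans (ℓ-minimal a ∏a≈sw) l))
      where
      ∏a≈sw : ∏ a ≈ ι s ∙ w
      ∏a≈sw = trans (sym (ι-cancel s _)) (∙-congˡ e)

  -- Each strict step down the chain is a left multiplication by a reflection that lowers the
  -- length, so strong exchange strikes one more letter of `c`.
  ≤ᴮ⇒subword : ∀ {x y} → x ≤ᴮ y → ∀ c → ∏ c ≈ y → ∃[ b ] b ⊑ c × ∏ b ≈ x
  ≤ᴮ⇒subword idle         c e = c , Sublist.⊆-refl , e
  ≤ᴮ⇒subword (st ◅ l) c e with st | ≤ᴮ⇒subword l c e
  ... | inj₁ x≈y | b , b⊑c , e′ = b , b⊑c , trans e′ (sym x≈y)
  ... | inj₂ x<y | b , b⊑c , e′ =
    let t , r , y≈tx , x<y = <·-elim x<y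
        ty≈x = trans (∙-congˡ (trans e′ y≈tx)) (reflection-cancel r _)
        b′ , d , e″ = exchange r b (≡.subst₂ _<_ (ℓ-cong (sym ty≈x)) (ℓ-cong (sym e′)) x<y)
    in b′ , deletion-⊑ d b⊑c , trans e″ ty≈x

  ≤ᴮ-subword-⋆ : ∀ {b c x y} → b ⊑ c → x ≤ᴮ y → (∏ b ∙ x) ≤ᴮ foldr _⋆ˢ_ y c
  ≤ᴮ-subword-⋆ Sublist.[]               l = ≤ᴮ-reflexive (identityˡ _) ◅◅ l
  ≤ᴮ-subword-⋆ (s Sublist.∷ʳ b⊑c)       l = ≤ᴮ-subword-⋆ b⊑c l ◅◅ ≤ᴮ-⋆ˢ s _
  ≤ᴮ-subword-⋆ (≡.refl Sublist.∷ b⊑c)   l =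
    ≤ᴮ-reflexive (assoc _ _ _) ◅◅ ≤ᴮ-lift _ (≤ᴮ-subword-⋆ b⊑c l)

  -- Realize `a` by a subword of a reduced word of `w`. Letters that are kept are handled by the
  -- lifting property, skipped ones by `≤ᴮ-⋆ˢ`.
  ≤ᴮ-⋆ : ∀ {a w x y} → a ≤ᴮ w → x ≤ᴮ y → (a ∙ x) ≤ᴮ (w ⋆ y)
  ≤ᴮ-⋆ {w = w} l l′ = let b , b⊑c , e = ≤ᴮ⇒subword l (reduced w) (∏-reduced w) in
    ≤ᴮ-reflexive (∙-congʳ (sym e)) ◅◅ ≤ᴮ-subword-⋆ b⊑c l′

  -- Parabolic subgroups

  module _ {I : Pred S u} where

    parabolic-resp : ∀ {x y} → x ≈ y → x ∈ Parabolic I → y ∈ Parabolic I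
    parabolic-resp e (a , a⊆I , e′) = a , a⊆I , trans e′ e

    ε-parabolic : ε ∈ Parabolic I
    ε-parabolic = [] , [] , refl

    ι-parabolic : ∀ {s} → s ∈ I → ι s ∈ Parabolic I
    ι-parabolic i = _ ∷ [] , i ∷ [] , identityʳ _

    ∙-parabolic : ∀ {x y} → x ∈ Parabolic I → y ∈ Parabolic I → x ∙ y ∈ Parabolic I
    ∙-parabolic (a , a⊆I , e) (b , b⊆I , e′) =
      a ++ b , All.++⁺ a⊆I b⊆I , trans (∏-++ a b) (∙-cong e e′)

    ⁻¹-parabolic : ∀ {x} → x ∈ Parabolic I → x ⁻¹ ∈ Parabolic I
    ⁻¹-parabolic (a , a⊆I , e) =
      reverse a , All.tabulate (All.lookup a⊆I ∘ Any.reverse⁻) , trans (∏-reverse a) (⁻¹-cong e)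

    -- The hypothesis means s * y = y for s ∈ I, so lifting along a word in I never moves the upper
    -- bound.
    parabolic-stable : ∀ {y} → (∀ {s} → s ∈ I → ℓ (ι s ∙ y) ≤ ℓ y) →
                       ∀ {a x} → a ∈ Parabolic I → x ≤ᴮ y → (a ∙ x) ≤ᴮ y
    parabolic-stable {y} stable {x = x} (a , a⊆I , e) l =
      ≤ᴮ-reflexive (∙-congʳ (sym e)) ◅◅ go a a⊆I
      where
      go : ∀ a → All (_∈ I) a → (∏ a ∙ x) ≤ᴮ y
      go []      []        = ≤ᴮ-reflexive (identityˡ x) ◅◅ l
      go (s ∷ a) (i ∷ a⊆I) = ≤ᴮ-reflexive (assoc _ _ _) ◅◅
        ≡.subst ((ι s ∙ (∏ a ∙ x)) ≤ᴮ_) (descent-⋆ˢ s y (stable i)) (≤ᴮ-lift s (go a a⊆I))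

  module _ (I : Finitary) where

    open Finitary I using (finite)

    private
      elements : List W
      elements = filter (λ w → em {P = w ∈ Parabolic (set I)}) (proj₁ finite)

    w₀-parabolic : w₀ I ∈ Parabolic (set I)
    w₀-parabolic with argmax-sel ℓ ε elements
    ... | inj₁ e = ≡.subst (_∈ Parabolic (set I)) (≡.sym e) ε-parabolic
    ... | inj₂ i = proj₂ (∈-filter⁻ (λ w → em {P = w ∈ Parabolic (set I)}) {xs = proj₁ finite} i)

    w₀-longest : ∀ {a} → a ∈ Parabolic (set I) → ℓ a ≤ ℓ (w₀ I)
    w₀-longest {a} i = let v , v∈ , a≈v = find (proj₂ finite a i) in
      ℕ.≤-trans (ℓ-≤ a≈v) (All.lookup (f[xs]≤f[argmax] {f = ℓ} ε elements)
        (∈-filter⁺ _ v∈ (parabolic-resp a≈v i)))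

    -- `w₀ I` is given merely as an element of greatest length in W_I. No s ∈ I lengthens it, so
    -- from ε ≤ w₀ all of W_I stays below it.
    parabolic-≤ᴮ-w₀ : ∀ {a} → a ∈ Parabolic (set I) → a ≤ᴮ w₀ I
    parabolic-≤ᴮ-w₀ {a} i = ≤ᴮ-reflexive (sym (identityʳ a)) ◅◅
      parabolic-stable (λ s∈I → w₀-longest (∙-parabolic (ι-parabolic s∈I) w₀-parabolic))
        i (ε≤ᴮ (w₀ I))

  -- The products w₀ ⋯ w_d with wᵢ ∈ W_{Iᵢ}.
  Reachable : ∀ {I J} → Expr I J → Pred W u
  Reachable {I} (nil _) x = x ∈ Parabolic (set I)
  Reachable {I} (_ ∷ e) x = ∃₂ λ a y → a ∈ Parabolic (set I) × y ∈ Reachable e × x ≈ a ∙ y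

  reachable-resp : ∀ {I J} (e : Expr I J) {x y} → x ≈ y → x ∈ Reachable e → y ∈ Reachable e
  reachable-resp (nil _) x≈y i                    = parabolic-resp x≈y i
  reachable-resp (_ ∷ e) x≈y (a , z , i , j , eq) = a , z , i , j , trans (sym x≈y) eq

  reachable-∷ : ∀ {I K J} (st : Step I K) (e : Expr K J) → Reachable e ⊆ Reachable (st ∷ e)
  reachable-∷ st e i = ε , _ , ε-parabolic , i , sym (identityˡ _)

  reachable⇒≤ᴮ : ∀ {I J} (e : Expr I J) {x} → x ∈ Reachable e → x ≤ᴮ ⋆-product e
  reachable⇒≤ᴮ {I} (nil _) i = parabolic-≤ᴮ-w₀ I i
  reachable⇒≤ᴮ {I} (_ ∷ e) (a , y , i , j , eq) =
    ≤ᴮ-reflexive eq ◅◅ ≤ᴮ-⋆ (parabolic-≤ᴮ-w₀ I i) (reachable⇒≤ᴮ e j)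

  mutual
    climb-reachable : ∀ {I J} (e : Expr I J) → foldr _∙_ ε (factors (climb e)) ∈ Reachable e
    climb-reachable {I} (nil _) = parabolic-resp (sym (identityʳ _)) (w₀-parabolic I)
    climb-reachable (up d ∷ e)  = reachable-∷ (up d) e (climb-reachable e)
    climb-reachable {I} (down d ∷ e) =
      let a , y , i , j , eq = descend-reachable I (⋖⇒⊆ d) e in a , y , i , j , eq

    -- The factor w_K w_L⁻¹ becomes known only at the next local minimum L, when `K` has been
    -- passed. The element `a` carries it back to the position of `K`, where it is allowed since W_L
    -- ⊂ W_K.
    descend-reachable : ∀ K {I J} → set I ⊆ set K → (e : Expr I J) →
      ∃₂ λ a y → a ∈ Parabolic (set K) × y ∈ Reachable e ×
                 foldr _∙_ ε (factors (descend K e)) ≈ a ∙ y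
    descend-reachable K I⊆K (nil _) = _ , _ , w₀-parabolic K , ε-parabolic , refl
    descend-reachable K {I} I⊆K (up d ∷ e) =
      _ , _ , ∙-parabolic (w₀-parabolic K)
                (⁻¹-parabolic (parabolic-mono I⊆K (w₀-parabolic I))) ,
      reachable-∷ (up d) e (climb-reachable e) , refl
    descend-reachable K I⊆K (down d ∷ e) =
      let a , y , i , j , eq = descend-reachable K (λ k → I⊆K (⋖⇒⊆ d k)) e
      in a , y , i , reachable-∷ (down d) e j , eq

  reduced⇒reachable : ∀ {I J} (e : Expr I J) → IsReduced e → ⋆-product e ∈ Reachable e
  reduced⇒reachable e (eq , _) = reachable-resp e (sym eq) (climb-reachable e)

  -- Maximal elements of double cosets.

  module _ {I J : Finitary} where

    ∈ᶜ-translate : ∀ {p : Coset I J} {x y} → x ∈ᶜ p → y ∈ᶜ p →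
      ∃₂ λ a b → a ∈ Parabolic (set I) × b ∈ Parabolic (set J) × y ≈ (a ∙ x) ∙ b
    ∈ᶜ-translate {p} {x} {y} (a , b , i , j , e) (a′ , b′ , i′ , j′ , e′) =
      a′ ∙ a ⁻¹ , b ⁻¹ ∙ b′ , ∙-parabolic i′ (⁻¹-parabolic i) , ∙-parabolic (⁻¹-parabolic j) j′ ,
      (begin
        y                                           ≈⟨ e′ ⟩
        (a′ ∙ r) ∙ b′                               ≈⟨ ∙-congʳ (∙-congˡ r≈) ⟩
        (a′ ∙ (a ⁻¹ ∙ (x ∙ b ⁻¹))) ∙ b′             ≈⟨ ∙-congʳ (assoc _ _ _) ⟨
        ((a′ ∙ a ⁻¹) ∙ (x ∙ b ⁻¹)) ∙ b′             ≈⟨ ∙-congʳ (assoc _ _ _) ⟨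
        (((a′ ∙ a ⁻¹) ∙ x) ∙ b ⁻¹) ∙ b′             ≈⟨ assoc _ _ _ ⟩
        ((a′ ∙ a ⁻¹) ∙ x) ∙ (b ⁻¹ ∙ b′)             ∎)
      where
      r = Coset.representative p
      r≈ : r ≈ a ⁻¹ ∙ (x ∙ b ⁻¹)
      r≈ = begin
        r                               ≈⟨ \\-leftDividesʳ a r ⟨
        a ⁻¹ ∙ (a ∙ r)                  ≈⟨ ∙-congˡ (//-rightDividesʳ b _) ⟨
        a ⁻¹ ∙ (((a ∙ r) ∙ b) ∙ b ⁻¹)   ≈⟨ ∙-congˡ (∙-congʳ e) ⟨
        a ⁻¹ ∙ (x ∙ b ⁻¹)               ∎

    -- Every element of I is a left descent of `x` and every element of J a right descent.
    -- `parabolic-stable` settles the left side and, after inversion, the right one.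
    maximal-absorbs : ∀ {p : Coset I J} {x a b y} → IsMaximal p x →
      a ∈ Parabolic (set I) → b ∈ Parabolic (set J) → y ≤ᴮ x → ((a ∙ y) ∙ b) ≤ᴮ x
    maximal-absorbs {p} {x} {a} {b} {y} ((c , d , i , j , e) , max) a∈ b∈ l =
      ≤ᴮ-reflexive (sym (⁻¹-involutive _)) ◅◅
      ≤ᴮ-⁻¹ (≤ᴮ-reflexive (⁻¹-anti-homo-∙ _ _) ◅◅
        parabolic-stable right (⁻¹-parabolic b∈) (≤ᴮ-⁻¹ (parabolic-stable left a∈ l))) ◅◅
      ≤ᴮ-reflexive (⁻¹-involutive _)
      where
      left : ∀ {s} → s ∈ set I → ℓ (ι s ∙ x) ≤ ℓ x
      left {s} s∈I = ≤ᴮ⇒ℓ≤ (max (ι s ∙ x) (ι s ∙ c , d , ∙-parabolic (ι-parabolic s∈I) i , j ,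
        trans (∙-congˡ e) (trans (sym (assoc _ _ _)) (∙-congʳ (sym (assoc _ _ _))))))
      right : ∀ {s} → s ∈ set J → ℓ (ι s ∙ x ⁻¹) ≤ ℓ (x ⁻¹)
      right {s} s∈J = ℕ.≤-trans (ℓ-≤ (trans (∙-congʳ (sym (ι⁻¹ s))) (sym (⁻¹-anti-homo-∙ x (ι s)))))
        (ℕ.≤-trans (ℕ.≤-reflexive (ℓ-⁻¹ _)) (ℕ.≤-trans
          (≤ᴮ⇒ℓ≤ (max (x ∙ ι s) (c , d ∙ ι s , i , ∙-parabolic j (ι-parabolic s∈J) ,
            trans (∙-congʳ e) (assoc _ _ _))))
          (ℕ.≤-reflexive (≡.sym (ℓ-⁻¹ x)))))

    -- Let v and w be the minimal elements of q and p. The maximal element of q lies in W_I v W_J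
    -- with v ≤ w ≤ x, so it is at most x by absorption. A reachable x would be at most it, hence
    -- equal to it, forcing q = p.
    <ᶜ⇒unreachable : ∀ {p q : Coset I J} (e : Expr I J) {x} → Expresses e q → q <ᶜ p →
                     IsMaximal p x → x ∉ Reachable e
    <ᶜ⇒unreachable {p} {q} e {x} max-q ((v , w , (v∈q , _) , (w∈p , _) , v≤w) , q≉p) max-p i =
      q≉p (let a , b , a∈ , b∈ , eq = r∈p in a , b , a∈ , b∈ , eq)
      where
      y = ⋆-product e
      r = Coset.representative q
      y≤x : y ≤ᴮ x
      y≤x = let a , b , a∈ , b∈ , eq = ∈ᶜ-translate {p = q} v∈q (proj₁ max-q) in
        ≤ᴮ-reflexive eq ◅◅ maximal-absorbs {p = p} max-p a∈ b∈ (v≤w ◅◅ proj₂ max-p w w∈p)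
      r∈p : r ∈ᶜ p
      r∈p =
        let a , b , a∈ , b∈ , eq = ∈ᶜ-translate {p = q} (proj₁ max-q)
              (ε , ε , ε-parabolic , ε-parabolic ,
               sym (trans (identityʳ _) (identityˡ r)))
            c , d , c∈ , d∈ , eq′ = proj₁ max-p
        in a ∙ c , d ∙ b , ∙-parabolic a∈ c∈ , ∙-parabolic d∈ b∈ ,
           trans eq (trans (∙-congʳ (∙-congˡ (trans (≤ᴮ-antisym y≤x (reachable⇒≤ᴮ e i)) eq′)))
             (trans (∙-congʳ (trans (sym (assoc _ _ _)) (∙-congʳ (sym (assoc _ _ _)))))
               (assoc _ _ _)))

-- Symmetric algebras: functoriality, evaluation, divided differences, adjoining a variable.

module SymmetricAlgebra {u} {K : CommutativeRing u u}
                        (M : RawLeftModule (CommutativeRing.Carrier K) u u) where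

  private
    module K = CommutativeRing K
    module M = RawLeftModule M

  open Linear.Sym {K = K} M hiding (+-homo; *-homo; neg-homo)
  open CommutativeRing algebra using (zeroˡ; zeroʳ; +-identityʳ; ring; commutativeSemiring)
  open RingProperties ring using (-‿distribˡ-*; -‿+-comm)
  open CommutativeSemigroupProperties (CommutativeRing.*-commutativeSemigroup algebra) using (x∙yz≈y∙xz)
  open Solver commutativeSemiring hiding (con)

  record IsLinear (θ : M.Carrierᴹ → M.Carrierᴹ) : Set u where
    field
      cong : ∀ {m n} → m M.≈ᴹ n → θ m M.≈ᴹ θ n
      +-homo : ∀ m n → θ (m M.+ᴹ n) M.≈ᴹ (θ m M.+ᴹ θ n)
      *-homo : ∀ a m → θ (a M.*ₗ m) M.≈ᴹ (a M.*ₗ θ m)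

  record IsFunctional (λ′ : M.Carrierᴹ → K.Carrier) : Set u where
    field
      cong : ∀ {m n} → m M.≈ᴹ n → λ′ m K.≈ λ′ n
      +-homo : ∀ m n → λ′ (m M.+ᴹ n) K.≈ λ′ m K.+ λ′ n
      *-homo : ∀ a m → λ′ (a M.*ₗ m) K.≈ a K.* λ′ m

  module _ {θ : M.Carrierᴹ → M.Carrierᴹ} (θ-linear : IsLinear θ) where

    private module θ = IsLinear θ-linear

    mapˢ-cong : ∀ {f g} → f ≈ˢ g → mapˢ θ f ≈ˢ mapˢ θ g
    mapˢ-cong reflˢ            = reflˢ
    mapˢ-cong (symˢ e)         = symˢ (mapˢ-cong e)
    mapˢ-cong (transˢ e e′)    = transˢ (mapˢ-cong e) (mapˢ-cong e′)
    mapˢ-cong (+-congˢ e e′)   = +-congˢ (mapˢ-cong e) (mapˢ-cong e′)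
    mapˢ-cong (*-congˢ e e′)   = *-congˢ (mapˢ-cong e) (mapˢ-cong e′)
    mapˢ-cong (neg-congˢ e)    = neg-congˢ (mapˢ-cong e)
    mapˢ-cong (+-assocˢ f g h) = +-assocˢ _ _ _
    mapˢ-cong (+-commˢ f g)    = +-commˢ _ _
    mapˢ-cong (+-identˢ f)     = +-identˢ _
    mapˢ-cong (+-inverseˢ f)   = +-inverseˢ _
    mapˢ-cong (*-assocˢ f g h) = *-assocˢ _ _ _
    mapˢ-cong (*-commˢ f g)    = *-commˢ _ _
    mapˢ-cong (*-identˢ f)     = *-identˢ _
    mapˢ-cong (distribˢ f g h) = distribˢ _ _ _
    mapˢ-cong (con-cong e)     = con-cong e
    mapˢ-cong (con-+ a b)      = con-+ a b
    mapˢ-cong (con-* a b)      = con-* a b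
    mapˢ-cong (var-cong e)     = var-cong (θ.cong e)
    mapˢ-cong (var-+ m n)      = transˢ (var-cong (θ.+-homo m n)) (var-+ _ _)
    mapˢ-cong (var-* a m)      = transˢ (var-cong (θ.*-homo a m)) (var-* _ _)

  eval : (M.Carrierᴹ → K.Carrier) → Element → K.Carrier
  eval p (con a)  = a
  eval p (var m)  = p m
  eval p (f +ˢ g) = eval p f K.+ eval p g
  eval p (f *ˢ g) = eval p f K.* eval p g
  eval p (-ˢ f)   = K.- eval p f

  eval-cong : ∀ {p} → IsFunctional p → ∀ {f g} → f ≈ˢ g → eval p f K.≈ eval p g
  eval-cong {p} p-linear = go
    where
    module p = IsFunctional p-linear
    go : ∀ {f g} → f ≈ˢ g → eval p f K.≈ eval p g
    go reflˢ            = K.refl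
    go (symˢ e)         = K.sym (go e)
    go (transˢ e e′)    = K.trans (go e) (go e′)
    go (+-congˢ e e′)   = K.+-cong (go e) (go e′)
    go (*-congˢ e e′)   = K.*-cong (go e) (go e′)
    go (neg-congˢ e)    = K.-‿cong (go e)
    go (+-assocˢ f g h) = K.+-assoc _ _ _
    go (+-commˢ f g)    = K.+-comm _ _
    go (+-identˢ f)     = K.+-identityˡ _
    go (+-inverseˢ f)   = K.-‿inverseˡ _
    go (*-assocˢ f g h) = K.*-assoc _ _ _
    go (*-commˢ f g)    = K.*-comm _ _
    go (*-identˢ f)     = K.*-identityˡ _
    go (distribˢ f g h) = K.distribˡ _ _ _
    go (con-cong e)     = e
    go (con-+ a b)      = K.refl
    go (con-* a b)      = K.refl
    go (var-cong e)     = p.cong e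
    go (var-+ m n)      = p.+-homo m n
    go (var-* a m)      = p.*-homo a m

  -- The divided difference (f − θ f) / ξ, for θ m = m − λ(m) ξ.
  module Quotient {θ : M.Carrierᴹ → M.Carrierᴹ} {λ′ : M.Carrierᴹ → K.Carrier} {ξ : M.Carrierᴹ}
                  (θ-linear : IsLinear θ) (λ-linear : IsFunctional λ′)
                  (split : ∀ m → m M.≈ᴹ (θ m M.+ᴹ (λ′ m M.*ₗ ξ))) where

    private
      module θ = IsLinear θ-linear
      module λ′ = IsFunctional λ-linear
      σ : Element → Element
      σ = mapˢ θ

    Δ : Element → Element
    Δ (con a)  = con K.0#
    Δ (var m)  = con (λ′ m)
    Δ (f +ˢ g) = Δ f +ˢ Δ g
    Δ (f *ˢ g) = Δ f *ˢ g +ˢ σ f *ˢ Δ g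
    Δ (-ˢ f)   = -ˢ Δ f

    decompose : ∀ f → f ≈ˢ σ f +ˢ var ξ *ˢ Δ f
    decompose (con a)  = symˢ (transˢ (+-congˢ reflˢ (zeroʳ _)) (+-identityʳ _))
    decompose (var m)  = transˢ (var-cong (split m))
      (transˢ (var-+ _ _) (+-congˢ reflˢ (transˢ (var-* _ _) (*-commˢ _ _))))
    decompose (f +ˢ g) = transˢ (+-congˢ (decompose f) (decompose g))
      (solve 5 (λ a b c d x → (a :+ x :* c) :+ (b :+ x :* d) := (a :+ b) :+ x :* (c :+ d)) reflˢ
        (σ f) (σ g) (Δ f) (Δ g) (var ξ))
    decompose (f *ˢ g) = transˢ (*-congˢ (decompose f) reflˢ)
      (transˢ (solve 4 (λ a c g x → (a :+ x :* c) :* g := a :* g :+ x :* (c :* g)) reflˢ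
        (σ f) (Δ f) g (var ξ))
      (transˢ (+-congˢ (*-congˢ reflˢ (decompose g)) reflˢ)
      (solve 6 (λ a b c d g x → a :* (b :+ x :* d) :+ x :* (c :* g)
                              := a :* b :+ x :* (c :* g :+ a :* d)) reflˢ
        (σ f) (σ g) (Δ f) (Δ g) g (var ξ))))
    decompose (-ˢ f) = transˢ (neg-congˢ (decompose f))
      (transˢ (symˢ (-‿+-comm _ _)) (+-congˢ reflˢ
        (transˢ (neg-congˢ (*-commˢ _ _)) (transˢ (-‿distribˡ-* _ _) (*-commˢ _ _)))))

    Δ-cong : ∀ {f g} → f ≈ˢ g → Δ f ≈ˢ Δ g
    Δ-cong reflˢ            = reflˢ
    Δ-cong (symˢ e)         = symˢ (Δ-cong e)
    Δ-cong (transˢ e e′)    = transˢ (Δ-cong e) (Δ-cong e′)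
    Δ-cong (+-congˢ e e′)   = +-congˢ (Δ-cong e) (Δ-cong e′)
    Δ-cong (*-congˢ e e′)   =
      +-congˢ (*-congˢ (Δ-cong e) e′) (*-congˢ (mapˢ-cong θ-linear e) (Δ-cong e′))
    Δ-cong (neg-congˢ e)    = neg-congˢ (Δ-cong e)
    Δ-cong (+-assocˢ f g h) = +-assocˢ _ _ _
    Δ-cong (+-commˢ f g)    = +-commˢ _ _
    Δ-cong (+-identˢ f)     = +-identˢ _
    Δ-cong (+-inverseˢ f)   = +-inverseˢ _
    Δ-cong (*-assocˢ f g h) =
      solve 7 (λ a b c d e f′ g′ → (a :* g′ :+ b :* c) :* e :+ (b :* d) :* f′
                               := a :* (g′ :* e) :+ b :* (c :* e :+ d :* f′)) reflˢ
        (Δ f) (σ f) (Δ g) (σ g) h (Δ h) g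
    -- The twisted Leibniz rule is not symmetric in its two factors; expanding `g` and `f` by
    -- `decompose` makes both sides agree.
    Δ-cong (*-commˢ f g)    = transˢ (+-congˢ (*-congˢ reflˢ (decompose g)) reflˢ)
      (transˢ (solve 5 (λ a a′ b b′ x → a′ :* (b :+ x :* b′) :+ a :* b′
                                    := b′ :* (a :+ x :* a′) :+ b :* a′) reflˢ
        (σ f) (Δ f) (σ g) (Δ g) (var ξ))
      (+-congˢ (*-congˢ reflˢ (symˢ (decompose f))) reflˢ))
    Δ-cong (*-identˢ f)     = transˢ (+-congˢ (zeroˡ _) (*-identˢ _)) (+-identˢ _)
    Δ-cong (distribˢ f g h) =
      solve 6 (λ a b c d e f′ → a :* (c :+ e) :+ b :* (d :+ f′)
                            := (a :* c :+ b :* d) :+ (a :* e :+ b :* f′)) reflˢ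
        (Δ f) (σ f) g (Δ g) h (Δ h)
    Δ-cong (con-cong e)     = reflˢ
    Δ-cong (con-+ a b)      = symˢ (+-identˢ _)
    Δ-cong (con-* a b)      = symˢ (transˢ (+-congˢ (zeroˡ _) (zeroʳ _)) (+-identˢ _))
    Δ-cong (var-cong e)     = con-cong (λ′.cong e)
    Δ-cong (var-+ m n)      = transˢ (con-cong (λ′.+-homo m n)) (con-+ _ _)
    Δ-cong (var-* a m)      = transˢ (con-cong (λ′.*-homo a m))
      (transˢ (con-* _ _) (symˢ (transˢ (+-congˢ (zeroˡ _) reflˢ) (+-identˢ _))))

    -- Apply `Δ` to ξ f = 0: as Δ(ξ f) = λ(ξ) f + θ(ξ) Δ(f), the result is f itself. So a variable
    -- can be cancelled without normal forms for elements of the symmetric algebra.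
    var-cancel : λ′ ξ K.≈ K.1# → var (θ ξ) ≈ˢ con K.0# → ∀ f →
                 var ξ *ˢ f ≈ˢ con K.0# → f ≈ˢ con K.0#
    var-cancel λξ θξ f e = transˢ (symˢ (transˢ
      (+-congˢ (transˢ (*-congˢ (con-cong λξ) reflˢ) (*-identˢ f))
               (transˢ (*-congˢ θξ reflˢ) (zeroˡ _)))
      (+-identityʳ f))) (Δ-cong e)

  record IsSubalgebra (A : Pred Element u) : Set u where
    field
      resp : ∀ {f g} → f ≈ˢ g → f ∈ A → g ∈ A
      con∈ : ∀ a → con a ∈ A
      +∈   : ∀ {f g} → f ∈ A → g ∈ A → f +ˢ g ∈ A
      *∈   : ∀ {f g} → f ∈ A → g ∈ A → f *ˢ g ∈ A
      neg∈ : ∀ {f} → f ∈ A → -ˢ f ∈ A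

  -- Polynomials in `x` over `A` in Horner form. Uniqueness is not built in; the substitution x = 0
  -- recovers the constant term where it is needed.
  data Adjoin (A : Pred Element u) (x : Element) : Pred Element u where
    zero : ∀ {f} → f ≈ˢ con K.0# → Adjoin A x f
    step : ∀ {a f g} → a ∈ A → f ∈ Adjoin A x → g ≈ˢ a +ˢ x *ˢ f → Adjoin A x g

  module _ {A : Pred Element u} {x : Element} (isSubalgebra : IsSubalgebra A) where

    private module A = IsSubalgebra isSubalgebra

    adjoin-resp : ∀ {f g} → f ≈ˢ g → f ∈ Adjoin A x → g ∈ Adjoin A x
    adjoin-resp e (zero e′)     = zero (transˢ (symˢ e) e′)
    adjoin-resp e (step i j e′) = step i j (transˢ (symˢ e) e′)

    adjoin-⊇ : A ⊆ Adjoin A x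
    adjoin-⊇ i = step i (zero reflˢ) (symˢ (transˢ (+-congˢ reflˢ (zeroʳ x)) (+-identityʳ _)))

    adjoin-+ : ∀ {f g} → f ∈ Adjoin A x → g ∈ Adjoin A x → f +ˢ g ∈ Adjoin A x
    adjoin-+ (zero e) j = adjoin-resp (symˢ (transˢ (+-congˢ e reflˢ) (+-identˢ _))) j
    adjoin-+ i@(step _ _ _) (zero e) =
      adjoin-resp (symˢ (transˢ (+-congˢ reflˢ e) (+-identityʳ _))) i
    adjoin-+ (step {a} {f} i j e) (step {b} {g} i′ j′ e′) =
      step (A.+∈ i i′) (adjoin-+ j j′) (transˢ (+-congˢ e e′)
        (solve 5 (λ a b f g x → (a :+ x :* f) :+ (b :+ x :* g) := (a :+ b) :+ x :* (f :+ g)) reflˢ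
          a b f g x))

    adjoin-scale : ∀ {a f} → a ∈ A → f ∈ Adjoin A x → a *ˢ f ∈ Adjoin A x
    adjoin-scale i (zero e) = zero (transˢ (*-congˢ reflˢ e) (zeroʳ _))
    adjoin-scale {a} i (step {b} {g} i′ j e) = step (A.*∈ i i′) (adjoin-scale i j)
      (transˢ (*-congˢ reflˢ e)
        (solve 4 (λ a b g x → a :* (b :+ x :* g) := a :* b :+ x :* (a :* g)) reflˢ a b g x))

    adjoin-shift : ∀ {f} → f ∈ Adjoin A x → x *ˢ f ∈ Adjoin A x
    adjoin-shift i = step (A.con∈ K.0#) i (symˢ (+-identˢ _))

    adjoin-* : ∀ {f g} → f ∈ Adjoin A x → g ∈ Adjoin A x → f *ˢ g ∈ Adjoin A x
    adjoin-* (zero e) j = zero (transˢ (*-congˢ e reflˢ) (zeroˡ _))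
    adjoin-* {g = g} (step {a} {f} i i′ e) j = adjoin-resp
      (symˢ (transˢ (*-congˢ e reflˢ)
        (solve 4 (λ a f g x → (a :+ x :* f) :* g := a :* g :+ x :* (f :* g)) reflˢ a f g x)))
      (adjoin-+ (adjoin-scale i j) (adjoin-shift (adjoin-* i′ j)))

    adjoin-isSubalgebra : IsSubalgebra (Adjoin A x)
    adjoin-isSubalgebra = record
      { resp = adjoin-resp
      ; con∈ = λ a → adjoin-⊇ (A.con∈ a)
      ; +∈   = adjoin-+
      ; *∈   = adjoin-*
      ; neg∈ = λ {f} i → adjoin-resp
          (transˢ (symˢ (-‿distribˡ-* _ f)) (neg-congˢ (*-identˢ f)))
          (adjoin-scale (A.neg∈ (A.con∈ K.1#)) i)
      }

    adjoin-generator : x ∈ Adjoin A x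
    adjoin-generator = adjoin-resp (transˢ (*-commˢ x _) (*-identˢ x))
      (adjoin-shift (adjoin-⊇ (A.con∈ K.1#)))

  NoZeroDivisors : Pred Element u → Set u
  NoZeroDivisors A = ∀ {f g} → f ∈ A → g ∈ A → f *ˢ g ≈ˢ con K.0# → f ≈ˢ con K.0# ⊎ g ≈ˢ con K.0#

  -- Setting x = 0 shows that the constant term of f or of g vanishes, and then
  -- a factor x can be cancelled.
  adjoin-noZeroDivisors : ∀ {A x θ} → IsLinear θ → (∀ {a} → a ∈ A → mapˢ θ a ≈ˢ a) →
    mapˢ θ x ≈ˢ con K.0# → (∀ f → x *ˢ f ≈ˢ con K.0# → f ≈ˢ con K.0#) →
    NoZeroDivisors A → NoZeroDivisors (Adjoin A x)
  adjoin-noZeroDivisors {A} {x} {θ} θ-linear fixes kills cancel domain = go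
    where
    constant : ∀ {a f g} → a ∈ A → g ≈ˢ a +ˢ x *ˢ f → mapˢ θ g ≈ˢ a
    constant i e = transˢ (mapˢ-cong θ-linear e) (transˢ
      (+-congˢ (fixes i) (transˢ (*-congˢ kills reflˢ) (zeroˡ _))) (+-identityʳ _))
    factor : ∀ {a f g} → g ≈ˢ a +ˢ x *ˢ f → a ≈ˢ con K.0# → g ≈ˢ x *ˢ f
    factor e a≈0 = transˢ e (transˢ (+-congˢ a≈0 reflˢ) (+-identˢ _))
    vanish : ∀ {f g} → g ≈ˢ x *ˢ f → f ≈ˢ con K.0# → g ≈ˢ con K.0#
    vanish e f≈0 = transˢ e (transˢ (*-congˢ reflˢ f≈0) (zeroʳ x))
    go : NoZeroDivisors (Adjoin A x)
    go (zero e)       j              _ = inj₁ e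
    go (step _ _ _)   (zero e)       _ = inj₂ e
    go i@(step {f = f′} a∈ f′∈ f≈) j@(step {f = g′} b∈ g′∈ g≈) fg≈0 =
      [ (λ a≈0 → Sum.map₁ (vanish (factor f≈ a≈0)) (go f′∈ j (cancel _
          (transˢ (symˢ (*-assocˢ _ _ _)) (transˢ (*-congˢ (symˢ (factor f≈ a≈0)) reflˢ) fg≈0)))))
      , (λ b≈0 → Sum.map₂ (vanish (factor g≈ b≈0)) (go i g′∈ (cancel _
          (transˢ (x∙yz≈y∙xz _ _ _) (transˢ (*-congˢ reflˢ (symˢ (factor g≈ b≈0))) fg≈0)))))
      ]′ (domain a∈ b∈ (transˢ (symˢ (*-congˢ (constant a∈ f≈) (constant b∈ g≈)))
                               (mapˢ-cong θ-linear fg≈0)))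

-- The ring R: a domain on which W acts faithfully.

module RealizationTheory {u} (em : Classical) {𝒲 : CoxeterSystem u} {𝕜 : HeytingField u u u}
                         (𝔥 : Realization 𝒲 𝕜) where

  open CoxeterSystem 𝒲 using (∏; generated)
  private module 𝒲 = CoxeterSystem 𝒲
  open Realization 𝔥
  private
    module K = CommutativeRing scalars
    module V = Module V
    module 𝕜 = HeytingField 𝕜
  open Linear.Dual V
  open LinearForm using (⟦_⟧)
  open R using (Element; con; var; _+ˢ_; _*ˢ_; -ˢ_; _-ˢ_; _≈ˢ_; mapˢ; reflˢ; symˢ; transˢ;
                +-congˢ; *-congˢ; neg-congˢ; con-cong; var-cong; var-*)
  open SymmetricAlgebra {K = scalars} dual
  open Linear.FiniteBasis finiteᵛ
  open RawMonoidDefs V.+ᴹ-rawMonoid using (sum)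
  open RingProperties K.ring using (-1*x≈-x; -‿+-comm; -‿distribʳ-*)
    renaming (x∙y⁻¹≈ε⇒x≈y to x-y≈0⇒x≈y)
  private
    module SumV = FiniteSum V.+ᴹ-commutativeMonoid
    module KSolver = Solver K.commutativeSemiring

  combination : (Fin dimension → K.Carrier) → V.Carrierᴹ
  combination c = sum (λ i → c i V.*ₗ basis i)

  combination-+ : ∀ c d → combination (λ i → c i K.+ d i) V.≈ᴹ (combination c V.+ᴹ combination d)
  combination-+ c d = V.≈ᴹ-trans (SumV.sum-cong-≋ {dimension} (λ i → V.*ₗ-distribʳ (basis i) (c i) (d i)))
    (SumV.∑-distrib-+ (λ i → c i V.*ₗ basis i) (λ i → d i V.*ₗ basis i))

  sum-*ₗ : ∀ {n} a (v : Fin n → V.Carrierᴹ) → sum (λ i → a V.*ₗ v i) V.≈ᴹ (a V.*ₗ sum v)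
  sum-*ₗ {zero}  a v = V.≈ᴹ-sym (V.*ₗ-zeroʳ a)
  sum-*ₗ {suc n} a v =
    V.≈ᴹ-trans (V.+ᴹ-congˡ (sum-*ₗ a (v ∘ Fin.suc))) (V.≈ᴹ-sym (V.*ₗ-distribˡ _ _ _))

  combination-* : ∀ a c → combination (λ i → a K.* c i) V.≈ᴹ (a V.*ₗ combination c)
  combination-* a c =
    V.≈ᴹ-trans (SumV.sum-cong-≋ {dimension} (λ i → V.*ₗ-assoc a (c i) (basis i)))
    (sum-*ₗ a (λ i → c i V.*ₗ basis i))

  combination-injective : ∀ {c d} → combination c V.≈ᴹ combination d → ∀ i → c i K.≈ d i
  combination-injective {c} {d} e i = x-y≈0⇒x≈y _ _ (K.trans (K.+-congˡ (K.sym (-1*x≈-x _)))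
    (independent (λ i → c i K.+ K.- K.1# K.* d i) (V.≈ᴹ-trans (combination-+ _ _)
      (V.≈ᴹ-trans (V.+ᴹ-cong (V.≈ᴹ-trans e (V.≈ᴹ-sym (V.*ₗ-identityˡ _))) (combination-* _ d))
      (V.≈ᴹ-trans (V.≈ᴹ-sym (V.*ₗ-distribʳ _ _ _))
      (V.≈ᴹ-trans (V.*ₗ-congʳ (K.-‿inverseʳ _)) (V.*ₗ-zeroˡ _))))) i))

  coordinates : V.Carrierᴹ → Fin dimension → K.Carrier
  coordinates v = proj₁ (spanning v)

  coordinates-unique : ∀ {v c} → v V.≈ᴹ combination c → ∀ i → coordinates v i K.≈ c i
  coordinates-unique {v} e =
    combination-injective (V.≈ᴹ-trans (V.≈ᴹ-sym (proj₂ (spanning v))) e)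

  ξ : Fin dimension → LinearForm
  ξ i = form′ (λ v → coordinates v i)
    (λ e → coordinates-unique (V.≈ᴹ-trans e (proj₂ (spanning _))) i)
    (λ x y → coordinates-unique (V.≈ᴹ-trans (V.+ᴹ-cong (proj₂ (spanning x)) (proj₂ (spanning y)))
      (V.≈ᴹ-sym (combination-+ _ _))) i)
    (λ c x → coordinates-unique (V.≈ᴹ-trans (V.*ₗ-congˡ (proj₂ (spanning x)))
      (V.≈ᴹ-sym (combination-* _ _))) i)

  δ : ∀ {n} → Fin n → Fin n → K.Carrier
  δ Fin.zero    Fin.zero    = K.1#
  δ Fin.zero    (Fin.suc i) = K.0#
  δ (Fin.suc j) Fin.zero    = K.0#
  δ (Fin.suc j) (Fin.suc i) = δ j i

  δ-diagonal : ∀ {n} (i : Fin n) → δ i i ≡ K.1#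
  δ-diagonal Fin.zero    = ≡.refl
  δ-diagonal (Fin.suc i) = δ-diagonal i

  δ-off : ∀ {n} {i j : Fin n} → i ≢ j → δ j i ≡ K.0#
  δ-off {i = Fin.zero}  {Fin.zero}  i≢j = ⊥-elim (i≢j ≡.refl)
  δ-off {i = Fin.zero}  {Fin.suc j} i≢j = ≡.refl
  δ-off {i = Fin.suc i} {Fin.zero}  i≢j = ≡.refl
  δ-off {i = Fin.suc i} {Fin.suc j} i≢j = δ-off (i≢j ∘ ≡.cong Fin.suc)

  sum-0 : ∀ {n} (v : Fin n → V.Carrierᴹ) → sum (λ i → K.0# V.*ₗ v i) V.≈ᴹ V.0ᴹ
  sum-0 v = V.≈ᴹ-trans (sum-*ₗ K.0# v) (V.*ₗ-zeroˡ _)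

  sum-δ : ∀ {n} (v : Fin n → V.Carrierᴹ) j → sum (λ i → δ j i V.*ₗ v i) V.≈ᴹ v j
  sum-δ v Fin.zero    = V.≈ᴹ-trans (V.+ᴹ-cong (V.*ₗ-identityˡ _) (sum-0 (v ∘ Fin.suc))) (V.+ᴹ-identityʳ _)
  sum-δ v (Fin.suc j) = V.≈ᴹ-trans (V.+ᴹ-cong (V.*ₗ-zeroˡ _) (sum-δ (v ∘ Fin.suc) j)) (V.+ᴹ-identityˡ _)

  ξ-basis : ∀ i j → ⟦ ξ i ⟧ (basis j) K.≈ δ j i
  ξ-basis i j = coordinates-unique (V.≈ᴹ-sym (sum-δ basis j)) i

  form-sum : ∀ φ {n} (c : Fin n → K.Carrier) (v : Fin n → V.Carrierᴹ) →
             (∀ i → ⟦ φ ⟧ (v i) K.≈ K.0#) → ⟦ φ ⟧ (sum (λ i → c i V.*ₗ v i)) K.≈ K.0#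
  form-sum φ {zero}  c v e = LinearForm.0ᴹ-homo φ
  form-sum φ {suc n} c v e = K.trans (LinearForm.+ᴹ-homo φ _ _) (K.trans
    (K.+-cong (K.trans (LinearForm.*ₗ-homo φ _ _) (K.trans (K.*-congˡ (e _)) (K.zeroʳ _)))
              (form-sum φ (c ∘ Fin.suc) (v ∘ Fin.suc) (e ∘ Fin.suc)))
    (K.+-identityʳ _))

  form-zero : ∀ φ → (∀ i → ⟦ φ ⟧ (basis i) K.≈ K.0#) → ∀ v → ⟦ φ ⟧ v K.≈ K.0#
  form-zero φ e v = K.trans (LinearForm.⟦⟧-cong φ (proj₂ (spanning v))) (form-sum φ (coordinates v) basis e)

  var-0 : ∀ {φ} → (∀ v → ⟦ φ ⟧ v K.≈ K.0#) → var φ ≈ˢ con K.0#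
  var-0 {φ} e = transˢ (var-cong {n = K.0# ·* φ} (λ v → K.trans (e v) (K.sym (K.zeroˡ (⟦ φ ⟧ v)))))
    (transˢ (var-* K.0# φ) (CommutativeRing.zeroˡ R (var φ)))

  -- Subtracts the ξᵢ-component of a form; on R it is the substitution ξᵢ = 0.
  θ : Fin dimension → LinearForm → LinearForm
  θ i φ = φ +* ((K.- ⟦ φ ⟧ (basis i)) ·* ξ i)

  θ-linear : ∀ i → IsLinear (θ i)
  θ-linear i = record
    { cong = λ e v → K.+-cong (e v) (K.*-congʳ (K.-‿cong (e (basis i))))
    ; +-homo = λ φ ψ v → K.trans (K.+-congˡ (K.*-congʳ (K.sym (-‿+-comm _ _))))
        (solve 5 (λ p q a b x → (p :+ q) :+ (a :+ b) :* x := (p :+ a :* x) :+ (q :+ b :* x)) K.refl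
          _ _ _ _ _)
    ; *-homo = λ c φ v → K.trans (K.+-congˡ (K.*-congʳ (-‿distribʳ-* c _)))
        (solve 4 (λ c p a x → c :* p :+ (c :* a) :* x := c :* (p :+ a :* x)) K.refl _ _ _ _)
    }
    where open KSolver

  basis-functional : ∀ v → IsFunctional (λ φ → ⟦ φ ⟧ v)
  basis-functional v = record
    { cong = λ e → e v ; +-homo = λ _ _ → K.refl ; *-homo = λ _ _ → K.refl }

  θ-split : ∀ i φ v → ⟦ φ ⟧ v K.≈ ⟦ θ i φ +* (⟦ φ ⟧ (basis i) ·* ξ i) ⟧ v
  θ-split i φ v = K.sym (K.trans (K.+-assoc _ _ _) (K.trans (K.+-congˡ
    (K.trans (K.sym (K.distribʳ _ _ _)) (K.trans (K.*-congʳ (K.-‿inverseˡ _)) (K.zeroˡ _))))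
    (K.+-identityʳ _)))

  θ-basis : ∀ i φ → ⟦ θ i φ ⟧ (basis i) K.≈ K.0#
  θ-basis i φ = K.trans (K.+-congˡ (K.trans
    (K.*-congˡ (K.trans (ξ-basis i i) (K.reflexive (δ-diagonal i)))) (K.*-identityʳ _)))
    (K.-‿inverseʳ _)

  θ-basis-off : ∀ {i j} φ → j ≢ i → ⟦ φ ⟧ (basis j) K.≈ K.0# → ⟦ θ i φ ⟧ (basis j) K.≈ K.0#
  θ-basis-off {i} {j} φ j≢i e = K.trans (K.+-cong e (K.trans
    (K.*-congˡ (K.trans (ξ-basis i j) (K.reflexive (δ-off (j≢i ∘ ≡.sym))))) (K.zeroʳ _)))
    (K.+-identityʳ _)

  θ-ξ-off : ∀ {i j} → i ≢ j → var (θ i (ξ j)) ≈ˢ var (ξ j)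
  θ-ξ-off {i} {j} i≢j = var-cong λ v → K.trans (K.+-congˡ (K.trans
    (K.*-congʳ (K.trans (K.-‿cong (K.trans (ξ-basis j i) (K.reflexive (δ-off (i≢j ∘ ≡.sym)))))
                        -0#≈0#)) (K.zeroˡ _)))
    (K.+-identityʳ _)
    where open RingProperties K.ring using (-0#≈0#)

  θ-ξ : ∀ i → var (θ i (ξ i)) ≈ˢ con K.0#
  θ-ξ i = var-0 {θ i (ξ i)} (form-zero (θ i (ξ i)) kills)
    where
    kills : ∀ j → ⟦ θ i (ξ i) ⟧ (basis j) K.≈ K.0#
    kills j with j Fin.≟ i
    ... | yes ≡.refl = θ-basis i (ξ i)
    ... | no  j≢i    = θ-basis-off (ξ i) j≢i
                         (K.trans (ξ-basis i j) (K.reflexive (δ-off (j≢i ∘ ≡.sym))))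

  -- The subalgebra generated by the listed ξᵢ, as an iterated `Adjoin`, so that absence of zero
  -- divisors passes up one variable at a time.
  K[_] : List (Fin dimension) → Pred Element u
  K[ []     ] f = ∃[ a ] f ≈ˢ con a
  K[ i ∷ is ]   = Adjoin K[ is ] (var (ξ i))

  K[]-isSubalgebra : ∀ is → IsSubalgebra K[ is ]
  K[]-isSubalgebra [] = record
    { resp = λ { e (a , e′) → a , transˢ (symˢ e) e′ }
    ; con∈ = λ a → a , reflˢ
    ; +∈   = λ { (a , e) (b , e′) → _ , transˢ (+-congˢ e e′) (symˢ (R.con-+ a b)) }
    ; *∈   = λ { (a , e) (b , e′) → _ , transˢ (*-congˢ e e′) (symˢ (R.con-* a b)) }
    ; neg∈ = λ { (a , e) → K.- a , transˢ (neg-congˢ e) (symˢ (inverseˡ-unique _ _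
        (transˢ (symˢ (R.con-+ _ _)) (con-cong (K.-‿inverseˡ a))))) }
    }
    where open RingProperties (CommutativeRing.ring R) renaming (+-inverseˡ-unique to inverseˡ-unique)
  K[]-isSubalgebra (i ∷ is) = adjoin-isSubalgebra (K[]-isSubalgebra is)

  K[]-fixed : ∀ {i} is → All (i ≢_) is → ∀ {f} → f ∈ K[ is ] → mapˢ (θ i) f ≈ˢ f
  K[]-fixed {i} [] [] (a , e) = transˢ (mapˢ-cong (θ-linear i) e) (symˢ e)
  K[]-fixed {i} (j ∷ is) (i≢j ∷ i∉is) = go
    where
    go : ∀ {f} → f ∈ K[ j ∷ is ] → mapˢ (θ i) f ≈ˢ f
    go (zero e)       = transˢ (mapˢ-cong (θ-linear i) e) (symˢ e)
    go (step a∈ f∈ e) = transˢ (mapˢ-cong (θ-linear i) e) (transˢ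
      (+-congˢ (K[]-fixed is i∉is a∈) (*-congˢ (θ-ξ-off i≢j) (go f∈))) (symˢ e))

  -- Under excluded middle, tightness turns `a ≉ 0` into `a # 0`; the apartness axiom then inverts a
  -- - 0, not literally a.
  invertible : ∀ {a} → ¬ a K.≈ K.0# → ∃[ b ] b K.* a K.≈ K.1#
  invertible {a} a≉0 with em {P = a 𝕜.# K.0#}
  ... | no ¬a#0 = ⊥-elim (a≉0 (proj₁ (𝕜.tight _ _) ¬a#0))
  ... | yes a#0 = let b , e , _ = 𝕜.#⇒invertible a#0 in
    b , K.trans (K.*-congˡ (K.sym (K.trans (K.+-congˡ -0#≈0#) (K.+-identityʳ a)))) e
    where open RingProperties K.ring using (-0#≈0#)

  scalars-noZeroDivisors : ∀ {a b} → a K.* b K.≈ K.0# → a K.≈ K.0# ⊎ b K.≈ K.0#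
  scalars-noZeroDivisors {a} {b} e with em {P = a K.≈ K.0#}
  ... | yes a≈0 = inj₁ a≈0
  ... | no  a≉0 = let c , ca≈1 = invertible a≉0 in inj₂ (K.trans (K.sym (K.*-identityˡ b))
    (K.trans (K.*-congʳ (K.sym ca≈1)) (K.trans (K.*-assoc _ _ _) (K.trans (K.*-congˡ e) (K.zeroʳ c)))))

  eval-at : V.Carrierᴹ → Element → K.Carrier
  eval-at v = eval (λ φ → ⟦ φ ⟧ v)

  eval-at-cong : ∀ v {f g} → f ≈ˢ g → eval-at v f K.≈ eval-at v g
  eval-at-cong v = eval-cong (basis-functional v)

  K[]-noZeroDivisors : ∀ is → Uniqueᵖ is → NoZeroDivisors K[ is ]
  -- Evaluation at a vector fixes constants, so a relation between constants in R already holds in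
  -- the field.
  K[]-noZeroDivisors [] [] (a , e) (b , e′) eq with scalars-noZeroDivisors
    (eval-at-cong V.0ᴹ (transˢ (symˢ (*-congˢ e e′)) eq))
  ... | inj₁ a≈0 = inj₁ (transˢ e (con-cong a≈0))
  ... | inj₂ b≈0 = inj₂ (transˢ e′ (con-cong b≈0))
  K[]-noZeroDivisors (i ∷ is) (i∉is ∷ unique) = adjoin-noZeroDivisors (θ-linear i)
    (K[]-fixed is i∉is) (θ-ξ i) (var-cancel ξᵢ-basis (θ-ξ i)) (K[]-noZeroDivisors is unique)
    where
    open Quotient {θ = θ i} {ξ = ξ i} (θ-linear i) (basis-functional (basis i)) (θ-split i)
    ξᵢ-basis : ⟦ ξ i ⟧ (basis i) K.≈ K.1#
    ξᵢ-basis = K.trans (ξ-basis i i) (K.reflexive (δ-diagonal i))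

  -- Peeling off φ(bᵢ) ξᵢ leaves `θ i φ`, which also vanishes at bᵢ; once the list is empty, the
  -- form vanishes on the whole basis.
  var∈K[] : ∀ is φ → (∀ j → j ∉ᵖ is → ⟦ φ ⟧ (basis j) K.≈ K.0#) → var φ ∈ K[ is ]
  var∈K[] [] φ e = K.0# , var-0 {φ} (form-zero φ (λ j → e j (λ ())))
  var∈K[] (i ∷ is) φ e = resp (symˢ (transˢ (var-cong (θ-split i φ)) (transˢ (R.var-+ _ _)
    (+-congˢ reflˢ (var-* _ _)))))
    (+∈ (adjoin-⊇ (K[]-isSubalgebra is) (var∈K[] is (θ i φ) kills))
        (*∈ (con∈ _) (adjoin-generator (K[]-isSubalgebra is))))
    where
    open IsSubalgebra (K[]-isSubalgebra (i ∷ is))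
    kills : ∀ j → j ∉ᵖ is → ⟦ θ i φ ⟧ (basis j) K.≈ K.0#
    kills j j∉is with j Fin.≟ i
    ... | yes ≡.refl = θ-basis i φ
    ... | no  j≢i    = θ-basis-off φ j≢i (e j λ { (here j≡i) → j≢i j≡i ; (there j∈is) → j∉is j∈is })

  ∈K[allFin] : ∀ f → f ∈ K[ allFin dimension ]
  ∈K[allFin] = go
    where
    open IsSubalgebra (K[]-isSubalgebra (allFin dimension))
    go : ∀ f → f ∈ K[ allFin dimension ]
    go (con a)  = con∈ a
    go (var φ)  = var∈K[] (allFin dimension) φ (λ j j∉ → ⊥-elim (j∉ (∈-allFin j)))
    go (f +ˢ g) = +∈ (go f) (go g)
    go (f *ˢ g) = *∈ (go f) (go g)
    go (-ˢ f)   = neg∈ (go f)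

  noZeroDivisors : ∀ {f g} → f *ˢ g ≈ˢ con K.0# → f ≈ˢ con K.0# ⊎ g ≈ˢ con K.0#
  noZeroDivisors = K[]-noZeroDivisors _ (Uniqueᵖ.allFin⁺ dimension) (∈K[allFin] _) (∈K[allFin] _)

  1≉0 : ¬ con K.1# ≈ˢ con K.0#
  -- If 1 = 0, then 0 - 0 would be invertible, hence 0 # 0.
  1≉0 e = 𝕜.#-irrefl K.refl (𝕜.invertible⇒# {K.0#} {K.0#} (K.0# ,
    K.trans (K.zeroˡ _) (K.sym 1≈0) , K.trans (K.zeroʳ _) (K.sym 1≈0)))
    where
    1≈0 : K.1# K.≈ K.0#
    1≈0 = eval-at-cong V.0ᴹ e

  -- The action of W on R

  act*-linear : ∀ w → IsLinear (act* w)
  act*-linear w = record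
    { cong = λ e v → e (act (w 𝒲.⁻¹) v) ; +-homo = λ _ _ _ → K.refl ; *-homo = λ _ _ _ → K.refl }

  •-cong : ∀ w {f g} → f ≈ˢ g → w • f ≈ˢ w • g
  •-cong w = mapˢ-cong (act*-linear w)

  act-word : ∀ w a → w 𝒲.≈ ∏ a → ∀ v → act w v V.≈ᴹ actᵃ a v
  act-word w a e = representation (proj₁ (generated w)) a (𝒲.trans (proj₂ (generated w)) e)

  actᵃ-++ : ∀ a b v → actᵃ (a ++ b) v ≡ actᵃ a (actᵃ b v)
  actᵃ-++ []      b v = ≡.refl
  actᵃ-++ (s ∷ a) b v = ≡.cong (reflect s) (actᵃ-++ a b v)

  act-cong : ∀ {x y} → x 𝒲.≈ y → ∀ v → act x v V.≈ᴹ act y v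
  act-cong {x} {y} e = act-word x (proj₁ (generated y)) (𝒲.trans e (𝒲.sym (proj₂ (generated y))))

  act-∙ : ∀ x y v → act (x 𝒲.∙ y) v V.≈ᴹ act x (act y v)
  act-∙ x y v = V.≈ᴹ-trans (act-word (x 𝒲.∙ y) (a ++ b) (𝒲.sym (𝒲.trans (∏-++ a b)
      (𝒲.∙-cong (proj₂ (generated x)) (proj₂ (generated y)))))  v)
    (V.≈ᴹ-reflexive (actᵃ-++ a b v))
    where
    open BruhatOrder em 𝒲 using (∏-++)
    a = proj₁ (generated x)
    b = proj₁ (generated y)

  •-resp : ∀ {x y} → x 𝒲.≈ y → ∀ f → x • f ≈ˢ y • f
  •-resp e (con a)  = reflˢ
  •-resp e (var φ)  = var-cong λ v → LinearForm.⟦⟧-cong φ (act-cong (𝒲.⁻¹-cong e) v)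
  •-resp e (f +ˢ g) = +-congˢ (•-resp e f) (•-resp e g)
  •-resp e (f *ˢ g) = *-congˢ (•-resp e f) (•-resp e g)
  •-resp e (-ˢ f)   = neg-congˢ (•-resp e f)

  •-∙ : ∀ x y f → (x 𝒲.∙ y) • f ≈ˢ x • (y • f)
  •-∙ x y (con a)  = reflˢ
  •-∙ x y (var φ)  = var-cong λ v → LinearForm.⟦⟧-cong φ
    (V.≈ᴹ-trans (act-cong (⁻¹-anti-homo-∙ x y) v) (act-∙ (y 𝒲.⁻¹) (x 𝒲.⁻¹) v))
    where open GroupProperties 𝒲.group using (⁻¹-anti-homo-∙)
  •-∙ x y (f +ˢ g) = +-congˢ (•-∙ x y f) (•-∙ x y g)
  •-∙ x y (f *ˢ g) = *-congˢ (•-∙ x y f) (•-∙ x y g)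
  •-∙ x y (-ˢ f)   = neg-congˢ (•-∙ x y f)

  •-ε : ∀ f → 𝒲.ε • f ≈ˢ f
  •-ε (con a)  = reflˢ
  •-ε (var φ)  = var-cong λ v → LinearForm.⟦⟧-cong φ (act-word (𝒲.ε 𝒲.⁻¹) [] ε⁻¹≈ε v)
    where open GroupProperties 𝒲.group using (ε⁻¹≈ε)
  •-ε (f +ˢ g) = +-congˢ (•-ε f) (•-ε g)
  •-ε (f *ˢ g) = *-congˢ (•-ε f) (•-ε g)
  •-ε (-ˢ f)   = neg-congˢ (•-ε f)

  coordinates-injective : ∀ {v v′} → (∀ i → ⟦ ξ i ⟧ v K.≈ ⟦ ξ i ⟧ v′) → v V.≈ᴹ v′
  coordinates-injective {v} {v′} e = V.≈ᴹ-trans (proj₂ (spanning v)) (V.≈ᴹ-trans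
    (SumV.sum-cong-≋ {dimension} (λ i → V.*ₗ-congʳ (e i))) (V.≈ᴹ-sym (proj₂ (spanning v′))))

  -- If `w` fixed every element of R, it would fix the coordinate forms ξᵢ, and then `w ⁻¹` would
  -- act trivially on V; the inverse stems from the contragredient action.
  •-faithful : ReflectionFaithful → ∀ {w} → ¬ w 𝒲.≈ 𝒲.ε → ∃[ f ] ¬ w • f ≈ˢ f
  •-faithful (faithful , _) {w} w≉ε with em {P = ∃[ f ] ¬ w • f ≈ˢ f}
  ... | yes moved = moved
  ... | no  fixed = ⊥-elim (w≉ε (𝒲.trans (𝒲.sym (⁻¹-involutive w)) (𝒲.trans
      (𝒲.⁻¹-cong (faithful (w 𝒲.⁻¹) λ v → coordinates-injective λ i →
        eval-at-cong v (fixes (var (ξ i))))) ε⁻¹≈ε)))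
    where
    open GroupProperties 𝒲.group using (⁻¹-involutive; ε⁻¹≈ε)
    fixes : ∀ f → w • f ≈ˢ f
    fixes f with em {P = w • f ≈ˢ f}
    ... | yes e = e
    ... | no ¬e = ⊥-elim (fixed (f , ¬e))

-- Lists without repetition and finite sums.

module UniqueLists {a ℓ} (A : Setoid a ℓ) where

  open Setoid A
  open Membership A using () renaming (_∈_ to _∈ˡ_)
  open UniqueSetoid A using (Unique)
  open Permutation A using (_↭_; prep; ↭-refl; ↭-trans; ↭-sym; ↭-prep; ↭-reflexive-≋)
  open PermutationProperties A using (∈-resp-↭; Unique-resp-↭; ↭-shift)

  ∈⇒↭∷ : ∀ {x xs} → x ∈ˡ xs → ∃[ ys ] xs ↭ x ∷ ys
  ∈⇒↭∷ {x} i = let ys , zs , w , x≈w , xs≋ = MembershipProperties.∈-∃++ A i in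
    ys ++ zs , ↭-trans (↭-reflexive-≋ xs≋)
      (↭-trans (↭-shift ys zs) (prep (sym x≈w) ↭-refl))

  private
    drop : ∀ {x xs ys} → Unique (x ∷ xs) → (∀ {z} → z ∈ˡ (x ∷ xs) → z ∈ˡ (x ∷ ys)) →
           ∀ {z} → z ∈ˡ xs → z ∈ˡ ys
    drop (x∉xs ∷ _) f i with f (there i)
    ... | there j  = j
    ... | here z≈x = ⊥-elim (All.lookupWith (λ ¬e e → ¬e (trans (sym z≈x) e)) x∉xs i)

  unique-↭ : ∀ {xs ys} → Unique xs → Unique ys →
             (∀ {z} → z ∈ˡ xs → z ∈ˡ ys) → (∀ {z} → z ∈ˡ ys → z ∈ˡ xs) → xs ↭ ys
  unique-↭ {[]}     {[]}    _ _ _ _ = ↭-refl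
  unique-↭ {[]}     {y ∷ _} _ _ _ g with g (here refl)
  ... | ()
  unique-↭ {x ∷ xs} {ys} u@(_ ∷ u′) v f g with ∈⇒↭∷ (f (here refl))
  ... | zs , ys↭ with Unique-resp-↭ ys↭ v
  ...   | w@(_ ∷ w′) = ↭-trans
    (↭-prep x (unique-↭ u′ w′ (drop u (∈-resp-↭ ys↭ ∘ f)) (drop w (g ∘ ∈-resp-↭ (↭-sym ys↭)))))
    (↭-sym ys↭)

module FiniteSums {u} (R : CommutativeRing u u) where

  open CommutativeRing R
  open CommutativeSemigroupProperties +-commutativeSemigroup using (interchange)

  ∑ : ∀ {a} {A : Set a} → List A → (A → Carrier) → Carrier
  ∑ l F = foldr _+_ 0# (map F l)

  module _ {a} {A : Set a} where

    ∑-cong : ∀ (l : List A) {F G} → (∀ x → F x ≈ G x) → ∑ l F ≈ ∑ l G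
    ∑-cong []      e = refl
    ∑-cong (x ∷ l) e = +-cong (e x) (∑-cong l e)

    ∑-zero : ∀ {l : List A} {F} → All (λ x → F x ≈ 0#) l → ∑ l F ≈ 0#
    ∑-zero []       = refl
    ∑-zero (e ∷ es) = trans (+-cong e (∑-zero es)) (+-identityʳ 0#)

    ∑-+ : ∀ (l : List A) F G → ∑ l (λ x → F x + G x) ≈ ∑ l F + ∑ l G
    ∑-+ []      F G = sym (+-identityʳ 0#)
    ∑-+ (x ∷ l) F G = trans (+-congˡ (∑-+ l F G)) (interchange _ _ _ _)

    ∑-*ˡ : ∀ (l : List A) c F → c * ∑ l F ≈ ∑ l (λ x → c * F x)
    ∑-*ˡ []      c F = zeroʳ c
    ∑-*ˡ (x ∷ l) c F = trans (distribˡ _ _ _) (+-congˡ (∑-*ˡ l c F))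

    ∑-*ʳ : ∀ (l : List A) c F → ∑ l F * c ≈ ∑ l (λ x → F x * c)
    ∑-*ʳ l c F = trans (*-comm _ _) (trans (∑-*ˡ l c F) (∑-cong l (λ x → *-comm _ _)))

  ∑-swap : ∀ {a b} {A : Set a} {B : Set b} (l : List A) (l′ : List B) (F : A → B → Carrier) →
           ∑ l (λ x → ∑ l′ (F x)) ≈ ∑ l′ (λ y → ∑ l (λ x → F x y))
  ∑-swap []      l′ F = sym (∑-zero (All.universal (λ _ → refl) l′))
  ∑-swap (x ∷ l) l′ F = trans (+-congˡ (∑-swap l l′ F)) (sym (∑-+ l′ (F x) _))

  ∑-homo : ∀ {a} {A : Set a} {h : Carrier → Carrier} → (∀ x y → h (x + y) ≈ h x + h y) →
           h 0# ≈ 0# → ∀ (l : List A) F → h (∑ l F) ≈ ∑ l (h ∘ F)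
  ∑-homo h-+ h-0 []      F = h-0
  ∑-homo h-+ h-0 (x ∷ l) F = trans (h-+ _ _) (+-congˡ (∑-homo h-+ h-0 l F))

-- Separating elements, traces and norms for finite parabolic subgroups.

module InvariantTheory {u} (em : Classical) {𝒲 : CoxeterSystem u} {𝕜 : HeytingField u u u}
                       (𝔥 : Realization 𝒲 𝕜) (faithful : Realization.ReflectionFaithful 𝔥) where

  open CoxeterSystem 𝒲 using (W; S; _∙_; ε; _⁻¹; Parabolic; parabolic-mono; Finitary; set)
  open BruhatOrder em 𝒲 using (parabolic-resp; ε-parabolic; ∙-parabolic; ⁻¹-parabolic)
  private module 𝒲 = CoxeterSystem 𝒲
  open GroupProperties 𝒲.group using (\\-leftDividesˡ; ∙-cancelˡ; inverseˡ-unique)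
  open Realization 𝔥
    using (R; _•_; Invariant; R^_; R^ᵣ_; include; include-isRingHomomorphism; module R)
  open RealizationTheory em 𝔥
    using (noZeroDivisors; 1≉0; •-cong; •-resp; •-∙; •-ε; •-faithful)
  open CommutativeRing R
  open CommutativeSemigroupProperties *-commutativeSemigroup using (x∙yz≈y∙xz)
  open RingProperties ring using (-‿distribˡ-*; x[y-z]≈xy-xz; x+x≈x⇒x≈0)
    renaming (x∙y⁻¹≈ε⇒x≈y to x-y≈0⇒x≈y; x≈y⇒x∙y⁻¹≈ε to x≈y⇒x-y≈0)
  open FiniteSums R
  open SetoidReasoning setoid

  *-cancel-0 : ∀ {f g} → ¬ f ≈ 0# → f * g ≈ 0# → g ≈ 0#
  *-cancel-0 f≉0 e = [ (λ f≈0 → ⊥-elim (f≉0 f≈0)) , id ]′ (noZeroDivisors e)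

  *-cancel : ∀ {f g h} → ¬ f ≈ 0# → f * g ≈ f * h → g ≈ h
  *-cancel f≉0 e = x-y≈0⇒x≈y _ _ (*-cancel-0 f≉0 (trans (x[y-z]≈xy-xz _ _ _) (x≈y⇒x-y≈0 e)))

  •-inverse : ∀ w f → (w ⁻¹) • (w • f) ≈ f
  •-inverse w f = trans (sym (•-∙ _ w f)) (trans (•-resp (𝒲.inverseˡ w) f) (•-ε f))

  •-≉0 : ∀ w {f} → ¬ f ≈ 0# → ¬ w • f ≈ 0#
  •-≉0 w f≉0 e = f≉0 (trans (sym (•-inverse w _)) (•-cong (w ⁻¹) e))

  •-∑ : ∀ {a} {A : Set a} w (l : List A) F → w • ∑ l F ≈ ∑ l (λ x → w • F x)
  •-∑ w = ∑-homo {h = w •_} (λ _ _ → refl) refl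

  -- A list of pairs (r , s) stands for Σ r ⊗ s.
  ⟪_⟫ : List (Carrier × Carrier) → W → Carrier
  ⟪ Θ ⟫ v = ∑ Θ (λ (r , s) → r * (v • s))

  ⟪⟫-resp : ∀ Θ {v w} → v 𝒲.≈ w → ⟪ Θ ⟫ v ≈ ⟪ Θ ⟫ w
  ⟪⟫-resp Θ e = ∑-cong Θ (λ (r , s) → *-congˡ (•-resp e s))

  -- Multiplication by c ⊗ 1 − 1 ⊗ z.
  multiply : Carrier → Carrier → List (Carrier × Carrier) → List (Carrier × Carrier)
  multiply c z []            = []
  multiply c z ((r , s) ∷ Θ) = (c * r , s) ∷ (- r , z * s) ∷ multiply c z Θ

  ⟪multiply⟫ : ∀ c z Θ v → ⟪ multiply c z Θ ⟫ v ≈ (c - v • z) * ⟪ Θ ⟫ v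
  ⟪multiply⟫ c z []            v = sym (zeroʳ _)
  ⟪multiply⟫ c z ((r , s) ∷ Θ) v = begin
    (c * r) * (v • s) + ((- r) * (v • z * v • s) + ⟪ multiply c z Θ ⟫ v)
      ≈⟨ +-assoc _ _ _ ⟨
    ((c * r) * (v • s) + (- r) * (v • z * v • s)) + ⟪ multiply c z Θ ⟫ v
      ≈⟨ +-cong (+-cong (*-assoc c r _) rearrange) (⟪multiply⟫ c z Θ v) ⟩
    (c * (r * v • s) + (- (v • z)) * (r * v • s)) + (c - v • z) * ⟪ Θ ⟫ v
      ≈⟨ +-congʳ (distribʳ _ _ _) ⟨
    (c - v • z) * (r * v • s) + (c - v • z) * ⟪ Θ ⟫ v
      ≈⟨ distribˡ _ _ _ ⟨
    (c - v • z) * (r * v • s + ⟪ Θ ⟫ v) ∎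
    where
    rearrange : (- r) * (v • z * v • s) ≈ (- (v • z)) * (r * v • s)
    rearrange = trans (sym (-‿distribˡ-* _ _)) (trans (-‿cong (x∙yz≈y∙xz _ _ _)) (-‿distribˡ-* _ _))

  -- Take the product over v ∈ L of v(z) ⊗ 1 - 1 ⊗ z, where z is moved by v. Each factor vanishes at
  -- its own v and equals v(z) - z ≠ 0 at ε, and R is a domain.
  separate : ∀ (L : List W) → All (λ v → ¬ v 𝒲.≈ ε) L →
             Σ[ Θ ∈ List (Carrier × Carrier) ] All (λ v → ⟪ Θ ⟫ v ≈ 0#) L × ¬ ⟪ Θ ⟫ ε ≈ 0#
  separate []      []         = (1# , 1#) ∷ [] , [] , λ e → 1≉0
    (trans (sym (trans (+-identityʳ _) (*-identityˡ 1#))) e)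
  separate (v ∷ L) (v≉ε ∷ L≉ε) = let
      Θ , zeros , δ≉0 = separate L L≉ε
      z , vz≉z = •-faithful faithful v≉ε
    in multiply (v • z) z Θ ,
       trans (⟪multiply⟫ _ z Θ v) (trans (*-congʳ (-‿inverseʳ _)) (zeroˡ _)) ∷
       All.map (λ {w} e → trans (⟪multiply⟫ _ z Θ w) (trans (*-congˡ e) (zeroʳ _))) zeros ,
       λ e → δ≉0 (*-cancel-0 (λ e′ → vz≉z (trans (x-y≈0⇒x≈y _ _ e′) (•-ε z)))
         (trans (sym (⟪multiply⟫ _ z Θ ε)) e))

  private
    _≟_ : ∀ x y → Dec (x 𝒲.≈ y)
    x ≟ y = em

    decSetoid : DecSetoid u u
    decSetoid = record
      { isDecEquivalence = record { isEquivalence = 𝒲.isEquivalence ; _≟_ = _≟_ } }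

  open Membership 𝒲.setoid using () renaming (_∈_ to _∈ˡ_)
  open UniqueSetoid 𝒲.setoid using (Unique)
  open UniqueLists 𝒲.setoid
  open Permutation 𝒲.setoid using (_↭_; ↭-sym)
  open PermutationProperties 𝒲.setoid using (∈-resp-↭; Unique-resp-↭; map⁺)
  open PermutationProperties setoid using (foldr-commMonoid)

  ∑-↭ : ∀ {l l′} (F : W → Carrier) → (∀ {x y} → x 𝒲.≈ y → F x ≈ F y) → l ↭ l′ → ∑ l F ≈ ∑ l′ F
  ∑-↭ F F-cong p = foldr-commMonoid +-isCommutativeMonoid (map⁺ setoid F-cong p)

  ∑-single : ∀ {l v} (F : W → Carrier) → (∀ {x y} → x 𝒲.≈ y → F x ≈ F y) → Unique l → v ∈ˡ l →
             (∀ {x} → x ∈ˡ l → ¬ x 𝒲.≈ v → F x ≈ 0#) → ∑ l F ≈ F v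
  ∑-single {l} {v} F F-cong unique v∈l zeros with ∈⇒↭∷ v∈l
  ... | l′ , l↭ with Unique-resp-↭ l↭ unique
  ...   | v∉l′ ∷ _ = trans (∑-↭ F F-cong l↭) (trans
          (+-congˡ (∑-zero (All.tabulateₛ 𝒲.setoid λ x∈l′ → zeros
            (∈-resp-↭ (↭-sym l↭) (there x∈l′))
            (λ x≈v → All.lookupWith (λ v≉y x≈y → v≉y (𝒲.trans (𝒲.sym x≈v) x≈y)) v∉l′ x∈l′))))
          (+-identityʳ _))

  module _ (I : Finitary) where

    private
      member? : ∀ w → Dec (w ∈ Parabolic (set I))
      member? w = em

    elements : List W
    elements = deduplicate _≟_ (filter member? (proj₁ (Finitary.finite I)))

    elements-unique : Unique elements
    elements-unique = UniqueDec.deduplicate-! decSetoid _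

    elements-complete : ∀ {v} → v ∈ Parabolic (set I) → v ∈ˡ elements
    elements-complete {v} i = MembershipProperties.∈-deduplicate⁺ 𝒲.setoid _≟_
      (λ z≈y x≈y → 𝒲.trans x≈y (𝒲.sym z≈y))
      (MembershipProperties.∈-filter⁺ 𝒲.setoid member? parabolic-resp
        (proj₂ (Finitary.finite I) v i) i)

    elements-sound : ∀ {v} → v ∈ˡ elements → v ∈ Parabolic (set I)
    elements-sound i = proj₂ (MembershipProperties.∈-filter⁻ 𝒲.setoid member? parabolic-resp
      {xs = proj₁ (Finitary.finite I)} (MembershipProperties.∈-deduplicate⁻ 𝒲.setoid _≟_ _ i))

    translate-↭ : ∀ {w} → w ∈ Parabolic (set I) → map (w ∙_) elements ↭ elements
    translate-↭ {w} w∈ = unique-↭ (UniqueProperties.map⁺ 𝒲.setoid 𝒲.setoid (∙-cancelˡ w _ _) elements-unique)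
      elements-unique
      (λ i → let v , v∈ , e = MembershipProperties.∈-map⁻ 𝒲.setoid 𝒲.setoid i in
        elements-complete (parabolic-resp (𝒲.sym e) (∙-parabolic w∈ (elements-sound v∈))))
      (λ {z} i → MembershipProperties.∈-resp-≈ 𝒲.setoid (\\-leftDividesˡ w z)
        (MembershipProperties.∈-map⁺ 𝒲.setoid 𝒲.setoid 𝒲.∙-congˡ
          (elements-complete (∙-parabolic (⁻¹-parabolic w∈) (elements-sound i)))))

    trace : Carrier → Carrier
    trace f = ∑ elements (_• f)

    norm : Carrier → Carrier
    norm f = foldr _*_ 1# (map (_• f) elements)

    private
      translate : ∀ {_∙′_ : Carrier → Carrier → Carrier} {e w} f (l : List W) →
        (∀ {x x′ y y′} → x ≈ x′ → y ≈ y′ → (x ∙′ y) ≈ (x′ ∙′ y′)) →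
        (∀ x y → w • (x ∙′ y) ≈ (w • x) ∙′ (w • y)) → w • e ≈ e →
        w • foldr _∙′_ e (map (_• f) l) ≈ foldr _∙′_ e (map (_• f) (map (w ∙_) l))
      translate f []      ∙-cong homo fix = fix
      translate f (v ∷ l) ∙-cong homo fix =
        trans (homo _ _) (∙-cong (sym (•-∙ _ v f)) (translate f l ∙-cong homo fix))

    trace-invariant : ∀ f → Invariant (set I) (trace f)
    trace-invariant f w w∈ = trans (translate f elements +-cong (λ _ _ → refl) refl)
      (foldr-commMonoid +-isCommutativeMonoid (map⁺ setoid (λ e → •-resp e f) (translate-↭ w∈)))

    norm-invariant : ∀ f → Invariant (set I) (norm f)
    norm-invariant f w w∈ = trans (translate f elements *-cong (λ _ _ → refl) refl)
      (foldr-commMonoid *-isCommutativeMonoid (map⁺ setoid (λ e → •-resp e f) (translate-↭ w∈)))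

    trace-cong : ∀ {f g} → f ≈ g → trace f ≈ trace g
    trace-cong e = ∑-cong elements (λ v → •-cong v e)

    trace-+ : ∀ f g → trace (f + g) ≈ trace f + trace g
    trace-+ f g = ∑-+ elements _ _

    trace-* : ∀ {c} f → Invariant (set I) c → trace (c * f) ≈ c * trace f
    trace-* {c} f c-inv = sym (trans (∑-*ˡ elements c _)
      (go elements (All.tabulateₛ 𝒲.setoid elements-sound)))
      where
      go : ∀ l → All (_∈ Parabolic (set I)) l → ∑ l (λ v → c * (v • f)) ≈ ∑ l (_• (c * f))
      go []      []        = refl
      go (v ∷ l) (v∈ ∷ l∈) = +-cong (*-congʳ (sym (c-inv v v∈))) (go l l∈)

    norm-≉0 : ∀ {f} → ¬ f ≈ 0# → ¬ norm f ≈ 0#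
    norm-≉0 {f} f≉0 = go elements
      where
      go : ∀ l → ¬ foldr _*_ 1# (map (_• f) l) ≈ 0#
      go []      e = 1≉0 e
      go (v ∷ l) e = go l (*-cancel-0 (•-≉0 v f≉0) e)

    norm-factor : ∀ f → ∃[ g ] norm f ≈ f * g
    norm-factor f with ∈⇒↭∷ (elements-complete ε-parabolic)
    ... | l , p = foldr _*_ 1# (map (_• f) l) , trans
      (foldr-commMonoid *-isCommutativeMonoid (map⁺ setoid (λ e → •-resp e f) p))
      (*-congʳ (•-ε f))

    -- A substitute for dual bases of R over R^I: by `trace-expansion`, Θ recovers f up to the
    -- factor `⟪ Θ ⟫ ε`. This factor is required to be invariant so that it passes through maps that
    -- are linear over R^I only.
    record Separator : Set u where
      field
        Θ           : List (Carrier × Carrier)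
        ⟪Θ⟫≈0       : ∀ {v} → v ∈ Parabolic (set I) → ¬ v 𝒲.≈ ε → ⟪ Θ ⟫ v ≈ 0#
        invariant   : Invariant (set I) (⟪ Θ ⟫ ε)
        nonzero     : ¬ ⟪ Θ ⟫ ε ≈ 0#

    -- Multiplying the first tensor factors by the cofactor of δ in its norm replaces the value δ at
    -- ε by `norm δ`, which is invariant and still nonzero, and keeps the zeros.
    separator : Separator
    separator = record
      { Θ         = map (λ (r , s) → δ′ * r , s) Θ₀
      ; ⟪Θ⟫≈0     = λ {v} v∈ v≉ε → trans (scale Θ₀ v) (trans (*-congˡ (zeros v∈ v≉ε)) (zeroʳ δ′))
      ; invariant = λ w w∈ → trans (•-cong w δ≈norm) (trans (norm-invariant δ w w∈) (sym δ≈norm))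
      ; nonzero   = λ e → norm-≉0 δ≉0 (trans (sym δ≈norm) e)
      }
      where
      nontrivial? : ∀ v → Dec (¬ v 𝒲.≈ ε)
      nontrivial? v = em
      L = filter nontrivial? elements
      separation = separate L (All.all-filter nontrivial? elements)
      Θ₀ = proj₁ separation
      δ = ⟪ Θ₀ ⟫ ε
      δ≉0 = proj₂ (proj₂ separation)
      δ′ = proj₁ (norm-factor δ)
      zeros : ∀ {v} → v ∈ Parabolic (set I) → ¬ v 𝒲.≈ ε → ⟪ Θ₀ ⟫ v ≈ 0#
      zeros v∈ v≉ε = All.lookupWith (λ {x} e v≈x → trans (⟪⟫-resp Θ₀ v≈x) e) (proj₁ (proj₂ separation))
        (MembershipProperties.∈-filter⁺ 𝒲.setoid nontrivial? (λ e ¬e e′ → ¬e (𝒲.trans e e′))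
          (elements-complete v∈) v≉ε)
      scale : ∀ Θ v → ⟪ map (λ (r , s) → δ′ * r , s) Θ ⟫ v ≈ δ′ * ⟪ Θ ⟫ v
      scale []            v = sym (zeroʳ δ′)
      scale ((r , s) ∷ Θ) v =
        trans (+-cong (*-assoc _ _ _) (scale Θ v)) (sym (distribˡ _ _ _))
      δ≈norm : ⟪ map (λ (r , s) → δ′ * r , s) Θ₀ ⟫ ε ≈ norm δ
      δ≈norm = trans (scale Θ₀ ε) (trans (*-comm _ _) (sym (proj₂ (norm-factor δ))))

    module _ (sep : Separator) where

      open Separator sep

      -- Exchanging the sums over Θ and over W_I leaves Σ_v `⟪ Θ ⟫ v` · v(f), in which only v = ε
      -- survives.
      trace-expansion : ∀ f → ⟪ Θ ⟫ ε * f ≈ ∑ Θ (λ (r , s) → r * trace (s * f))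
      trace-expansion f = sym (begin
        ∑ Θ (λ (r , s) → r * trace (s * f))
          ≈⟨ ∑-cong Θ (λ (r , s) → trans (∑-*ˡ elements r _)
               (∑-cong elements (λ v → sym (*-assoc _ _ _)))) ⟩
        ∑ Θ (λ (r , s) → ∑ elements (λ v → (r * v • s) * v • f))
          ≈⟨ ∑-swap Θ elements _ ⟩
        ∑ elements (λ v → ∑ Θ (λ (r , s) → (r * v • s) * v • f))
          ≈⟨ ∑-cong elements (λ v → sym (∑-*ʳ Θ (v • f) _)) ⟩
        ∑ elements (λ v → ⟪ Θ ⟫ v * v • f)
          ≈⟨ vanishing ⟩
        ⟪ Θ ⟫ ε * ε • f
          ≈⟨ *-congˡ (•-ε f) ⟩
        ⟪ Θ ⟫ ε * f ∎)
        where
        vanishing : ∑ elements (λ v → ⟪ Θ ⟫ v * v • f) ≈ ⟪ Θ ⟫ ε * ε • f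
        vanishing = ∑-single _ (λ e → *-cong (⟪⟫-resp Θ e) (•-resp e f)) elements-unique
          (elements-complete ε-parabolic)
          (λ v∈ v≉ε → trans (*-congʳ (⟪Θ⟫≈0 (elements-sound v∈) v≉ε)) (zeroˡ _))

    ∑-trace : ∀ Θ (g : W → W) → ∑ Θ (λ (r , s) → r * ∑ elements (λ v → g v • s)) ≈
                                ∑ elements (λ v → ⟪ Θ ⟫ (g v))
    ∑-trace Θ g = trans (∑-cong Θ (λ (r , s) → ∑-*ˡ elements r (λ v → g v • s)))
      (∑-swap Θ elements (λ (r , s) v → r * (g v • s)))

    -- If y ∉ W_I, some Σ r ⊗ s separates ε from W_I ∖ {ε} and from y W_I, so that
    -- Σ r tr(s) ≠ 0 = Σ r y(tr(s)).
    fixes-invariants⇒parabolic : ∀ {y} → (∀ {c} → Invariant (set I) c → y • c ≈ c) →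
                                 y ∈ Parabolic (set I)
    fixes-invariants⇒parabolic {y} fixes with em {P = y ∈ Parabolic (set I)}
    ... | yes y∈ = y∈
    ... | no  y∉ = ⊥-elim (nonzero (trans (sym single) (trans traces vanishing)))
      where
      nontrivial? : ∀ v → Dec (¬ v 𝒲.≈ ε)
      nontrivial? v = em
      L = filter nontrivial? elements
      avoids : All (λ v → ¬ v 𝒲.≈ ε) (map (y ∙_) elements)
      avoids = All.map⁺ (All.tabulateₛ 𝒲.setoid λ {v} v∈ yv≈ε → y∉ (parabolic-resp
        (𝒲.sym (inverseˡ-unique y v yv≈ε)) (⁻¹-parabolic (elements-sound v∈))))
      separation = separate (L ++ map (y ∙_) elements)
        (All.++⁺ (All.all-filter nontrivial? elements) avoids)
      Θ = proj₁ separation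
      zeros = All.++⁻ L (proj₁ (proj₂ separation))
      nonzero = proj₂ (proj₂ separation)
      single : ∑ elements ⟪ Θ ⟫ ≈ ⟪ Θ ⟫ ε
      single = ∑-single ⟪ Θ ⟫ (⟪⟫-resp Θ) elements-unique (elements-complete ε-parabolic)
        λ v∈ v≉ε → All.lookupWith (λ e v≈x → trans (⟪⟫-resp Θ v≈x) e) (proj₁ zeros)
          (MembershipProperties.∈-filter⁺ 𝒲.setoid nontrivial? (λ e ¬e e′ → ¬e (𝒲.trans e e′))
            v∈ v≉ε)
      vanishing : ∑ elements (λ v → ⟪ Θ ⟫ (y ∙ v)) ≈ 0#
      vanishing = ∑-zero (All.map⁻ (proj₂ zeros))
      traces : ∑ elements ⟪ Θ ⟫ ≈ ∑ elements (λ v → ⟪ Θ ⟫ (y ∙ v))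
      traces = trans (sym (∑-trace Θ id)) (trans
        (∑-cong Θ (λ (r , s) → *-congˡ (trans (sym (fixes (trace-invariant s)))
          (trans (•-∑ y elements (_• s)) (∑-cong elements (λ v → sym (•-∙ y v s)))))))
        (∑-trace Θ (y ∙_)))

  -- Twisted maps and their decomposition along R^I ⊂ R^L.

  -- A bimodule map from N to R, where R carries the left action twisted by `w` and the right action
  -- twisted by `x`. No degree is prescribed: `Decomposition` multiplies such maps by elements of R.
  record Twisted {I J : Pred S u} (w x : W) (N : Bimodule (R^ᵣ I) (R^ᵣ J) u u) : Set u where
    open Bimodule N
    field
      ⟦_⟧     : Carrierᴹ → Carrier
      cong    : ∀ {m n} → m ≈ᴹ n → ⟦ m ⟧ ≈ ⟦ n ⟧
      +-homo  : ∀ m n → ⟦ m +ᴹ n ⟧ ≈ ⟦ m ⟧ + ⟦ n ⟧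
      *ₗ-homo : ∀ c m → ⟦ c *ₗ m ⟧ ≈ w • proj₁ c * ⟦ m ⟧
      *ᵣ-homo : ∀ m c → ⟦ m *ᵣ c ⟧ ≈ x • proj₁ c * ⟦ m ⟧

    0-homo : ⟦ 0ᴹ ⟧ ≈ 0#
    0-homo = x+x≈x⇒x≈0 _ (trans (sym (+-homo _ _)) (cong (+ᴹ-identityˡ 0ᴹ)))

  restrictᴮ : ∀ {I L J : Pred S u} → L ⊆ I → Bimodule (R^ᵣ L) (R^ᵣ J) u u → Bimodule (R^ᵣ I) (R^ᵣ J) u u
  restrictᴮ {J = J} L⊆I = restrict (include-isRingHomomorphism L⊆I)
    (Identity.isRingHomomorphism (Ring.rawRing (R^ᵣ J)) (λ {c} → Ring.refl (R^ᵣ J) {c}))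

  -- Over the fraction field of R, a map that is w-twisted over R^I only is a sum of maps
  -- that are (w v)-twisted over R^L, for v ∈ W_I.  Traces make this explicit without
  -- denominators.
  module Decomposition {I L : Finitary} {J : Pred S u} {w x : W} (L⊆I : set L ⊆ set I)
    (N : Bimodule (R^ᵣ set L) (R^ᵣ J) u u) (T : Twisted w x (restrictᴮ L⊆I N)) where

    private module N = Bimodule N
    open Twisted T renaming (⟦_⟧ to G)

    trace′ : Carrier → CommutativeRing.Carrier (R^ set L)
    trace′ f = trace L f , trace-invariant L f

    -- N is a module over R^L only, while the components r of Θ are arbitrary elements of R. The
    -- trace to R^L lets them act on m all the same.
    H : N.Carrierᴹ → Carrier → Carrier
    H m f = G (trace′ f N.*ₗ m)

    H-cong : ∀ m {f g} → f ≈ g → H m f ≈ H m g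
    H-cong m e = cong (N.*ₗ-congʳ (trace-cong L e))

    H-+ : ∀ m f g → H m (f + g) ≈ H m f + H m g
    H-+ m f g = trans (cong (N.≈ᴹ-trans (N.*ₗ-congʳ (trace-+ L f g)) (N.*ₗ-distribʳ m _ _)))
      (+-homo _ _)

    H-0 : ∀ m → H m 0# ≈ 0#
    H-0 m = x+x≈x⇒x≈0 _ (trans (sym (H-+ m 0# 0#)) (H-cong m (+-identityʳ 0#)))

    H-*ₗ : ∀ {c} m f (c-inv : Invariant (set L) c) → H m (c * f) ≈ H ((c , c-inv) N.*ₗ m) f
    H-*ₗ m f c-inv = cong (N.≈ᴹ-trans
      (N.*ₗ-congʳ (trans (trace-* L f c-inv) (*-comm _ _))) (N.*ₗ-assoc _ _ m))

    H-* : ∀ {c} m f → Invariant (set I) c → H m (c * f) ≈ w • c * H m f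
    H-* m f c-inv = trans
      (cong (N.≈ᴹ-trans (N.*ₗ-congʳ (trace-* L f (proj₂ c′)))
        (N.*ₗ-assoc c′ (trace′ f) m)))
      (*ₗ-homo (_ , c-inv) _)
      where c′ = include L⊆I (_ , c-inv)

    sep = separator I
    open Separator sep

    δ : Carrier
    δ = ⟪ Θ ⟫ ε

    -- By `H-expansion`, this is w(δ) times the coefficient of the automorphism `w ∙ v` in the map f
    -- ↦ `H m f`.
    E : W → N.Carrierᴹ → Carrier
    E v m = ∑ Θ (λ (r , s) → (w ∙ v) • s * H m r)

    E-resp : ∀ {v v′} m → v 𝒲.≈ v′ → E v m ≈ E v′ m
    E-resp m e = ∑-cong Θ (λ (r , s) → *-congʳ (•-resp (𝒲.∙-congˡ e) s))

    -- As δ is W_I-invariant, it enters `H` as w(δ). Expand δ f by traces; the traces to R^I are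
    -- invariant too and leave `H` as sums of (w v)(s f) over v ∈ W_I.
    H-expansion : ∀ m f → w • δ * H m f ≈ ∑ (elements I) (λ v → (w ∙ v) • f * E v m)
    H-expansion m f = begin
      w • δ * H m f
        ≈⟨ H-* m f invariant ⟨
      H m (δ * f)
        ≈⟨ H-cong m (trace-expansion I sep f) ⟩
      H m (∑ Θ (λ (r , s) → r * trace I (s * f)))
        ≈⟨ ∑-homo {h = H m} (H-+ m) (H-0 m) Θ _ ⟩
      ∑ Θ (λ (r , s) → H m (r * trace I (s * f)))
        ≈⟨ ∑-cong Θ (λ (r , s) → trans (H-cong m (*-comm _ _)) (trans
             (H-* m r (trace-invariant I (s * f)))
             (trans (*-congʳ (trans (•-∑ w (elements I) _)
                      (∑-cong (elements I) (λ v → sym (•-∙ w v _)))))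
                    (∑-*ʳ (elements I) (H m r) _)))) ⟩
      ∑ Θ (λ (r , s) → ∑ (elements I) (λ v → (w ∙ v) • (s * f) * H m r))
        ≈⟨ ∑-swap Θ (elements I) (λ (r , s) v → (w ∙ v) • (s * f) * H m r) ⟩
      ∑ (elements I) (λ v → ∑ Θ (λ (r , s) → (w ∙ v) • (s * f) * H m r))
        ≈⟨ ∑-cong (elements I) (λ v → trans
             (∑-cong Θ (λ (r , s) → trans (*-assoc _ _ _) (x∙yz≈y∙xz _ _ _)))
             (sym (∑-*ˡ Θ ((w ∙ v) • f) _))) ⟩
      ∑ (elements I) (λ v → (w ∙ v) • f * E v m) ∎

    -- For v and v′ in W_I this is an orthogonality relation: the right side vanishes unless v′ = v,
    -- by the choice of Θ.
    orthogonal : ∀ v v′ → ∑ Θ (λ (r , s) → (w ∙ v) • s * (w ∙ v′) • r) ≈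
                          (w ∙ v′) • ⟪ Θ ⟫ (v′ ⁻¹ ∙ v)
    orthogonal v v′ = sym (trans (•-∑ (w ∙ v′) Θ _) (∑-cong Θ (λ (r , s) →
      trans (*-comm _ _) (*-congʳ (trans (sym (•-∙ _ _ s)) (•-resp
        (𝒲.trans (𝒲.assoc _ _ _) (𝒲.∙-congˡ (\\-leftDividesˡ v′ v))) s))))))

    wδ≉0 : ¬ w • δ ≈ 0#
    wδ≉0 = •-≉0 w nonzero

    -- After multiplication by w(δ), insert `H-expansion`: `orthogonal` kills every v′ ≠ v and
    -- leaves (w v)(δ) = w(δ) at v, δ being invariant. Then w(δ) cancels because R is a domain.
    E-* : ∀ {v} m q → v ∈ Parabolic (set I) →
          ∑ Θ (λ (r , s) → (w ∙ v) • s * H m (q * r)) ≈ (w ∙ v) • q * E v m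
    E-* {v} m q v∈ = *-cancel wδ≉0 (begin
      w • δ * ∑ Θ (λ (r , s) → (w ∙ v) • s * H m (q * r))
        ≈⟨ ∑-*ˡ Θ (w • δ) _ ⟩
      ∑ Θ (λ (r , s) → w • δ * ((w ∙ v) • s * H m (q * r)))
        ≈⟨ ∑-cong Θ (λ (r , s) → trans (x∙yz≈y∙xz _ _ _) (trans
             (*-congˡ (H-expansion m (q * r))) (∑-*ˡ (elements I) _ _))) ⟩
      ∑ Θ (λ (r , s) → ∑ (elements I) (λ v′ → (w ∙ v) • s * ((w ∙ v′) • (q * r) * E v′ m)))
        ≈⟨ ∑-swap Θ (elements I) (λ (r , s) v′ → (w ∙ v) • s * ((w ∙ v′) • (q * r) * E v′ m)) ⟩
      ∑ (elements I) (λ v′ → ∑ Θ (λ (r , s) → (w ∙ v) • s * ((w ∙ v′) • (q * r) * E v′ m)))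
        ≈⟨ ∑-cong (elements I) (λ v′ → trans (∑-cong Θ (λ (r , s) → rearrange v′ r s))
             (trans (sym (∑-*ʳ Θ _ _)) (*-congʳ (orthogonal v v′)))) ⟩
      ∑ (elements I) F
        ≈⟨ ∑-single F F-resp (elements-unique I) (elements-complete I v∈) F-zero ⟩
      F v
        ≈⟨ *-congʳ (trans (•-cong (w ∙ v) (⟪⟫-resp Θ (𝒲.inverseˡ v)))
             (trans (•-∙ w v δ) (•-cong w (invariant v v∈)))) ⟩
      w • δ * ((w ∙ v) • q * E v m) ∎)
      where
      F : W → Carrier
      F v′ = (w ∙ v′) • ⟪ Θ ⟫ (v′ ⁻¹ ∙ v) * ((w ∙ v′) • q * E v′ m)
      F-resp : ∀ {x y} → x 𝒲.≈ y → F x ≈ F y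
      F-resp e = *-cong (trans (•-resp (𝒲.∙-congˡ e) _)
                               (•-cong _ (⟪⟫-resp Θ (𝒲.∙-congʳ (𝒲.⁻¹-cong e)))))
        (*-cong (•-resp (𝒲.∙-congˡ e) q) (E-resp m e))
      F-zero : ∀ {x} → x ∈ˡ elements I → ¬ x 𝒲.≈ v → F x ≈ 0#
      F-zero {v′} v′∈ v′≉v = trans (*-congʳ (•-cong (w ∙ v′) (⟪Θ⟫≈0
          (∙-parabolic (⁻¹-parabolic (elements-sound I v′∈)) v∈)
          (λ e → v′≉v (𝒲.trans (𝒲.sym (𝒲.identityʳ v′)) (𝒲.trans (𝒲.∙-congˡ (𝒲.sym e))
            (\\-leftDividesˡ v′ v)))))))
        (zeroˡ _)
      rearrange : ∀ v′ r s → (w ∙ v) • s * ((w ∙ v′) • (q * r) * E v′ m) ≈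
                  ((w ∙ v) • s * (w ∙ v′) • r) * ((w ∙ v′) • q * E v′ m)
      rearrange v′ r s = trans (*-congˡ (trans (*-congʳ (*-comm _ _)) (*-assoc _ _ _)))
        (sym (*-assoc _ _ _))

    component : ∀ {v} → v ∈ Parabolic (set I) → Twisted (w ∙ v) x N
    component {v} v∈ = record
      { ⟦_⟧     = E v
      ; cong    = λ e → ∑-cong Θ (λ (r , s) → *-congˡ (cong (N.*ₗ-congˡ e)))
      ; +-homo  = λ m n → trans (∑-cong Θ (λ (r , s) → trans
          (*-congˡ (trans (cong (N.*ₗ-distribˡ _ m n)) (+-homo _ _))) (distribˡ _ _ _)))
          (∑-+ Θ _ _)
      ; *ₗ-homo = λ (c , c-inv) m → trans
          (∑-cong Θ (λ (r , s) → *-congˡ (sym (H-*ₗ m r c-inv)))) (E-* m c v∈)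
      ; *ᵣ-homo = λ m c → trans (∑-cong Θ (λ (r , s) → trans
          (*-congˡ (trans (cong (N.≈ᴹ-sym (N.*ₗ-*ᵣ-assoc _ m c))) (*ᵣ-homo _ c)))
          (x∙yz≈y∙xz _ _ _))) (sym (∑-*ˡ Θ _ _))
      }

    -- Vanishing components give G(t m) = 0 for every trace t to R^L. To remove t, pick t ≠ 0 and
    -- multiply by its cofactor t′ in R^L: the product is the norm of t in R^I, which leaves `G` as
    -- a nonzero scalar.
    components≈0⇒≈0 : (∀ {v} → v ∈ Parabolic (set I) → ∀ (T′ : Twisted (w ∙ v) x N) m →
                         Twisted.⟦ T′ ⟧ m ≈ 0#) → ∀ m → G m ≈ 0#
    components≈0⇒≈0 components≈0 m = *-cancel-0 (•-≉0 w (norm-≉0 I t≉0)) (begin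
      w • norm I t * G m                                        ≈⟨ *ₗ-homo (_ , norm-invariant I t) m ⟨
      G (include L⊆I (norm I t , norm-invariant I t) N.*ₗ m)    ≈⟨ cong (N.*ₗ-congʳ (proj₂ factor)) ⟩
      G (((t , t-invariant) 𝐋.* (t′ , t′-invariant)) N.*ₗ m)    ≈⟨ cong (N.*ₗ-assoc _ _ m) ⟩
      H ((t′ , t′-invariant) N.*ₗ m) f                          ≈⟨ H≈0 _ f ⟩
      0#                                                        ∎)
      where
      module 𝐋 = CommutativeRing (R^ set L)
      H≈0 : ∀ m f → H m f ≈ 0#
      H≈0 m f = *-cancel-0 wδ≉0 (trans (H-expansion m f) (∑-zero (All.tabulateₛ 𝒲.setoid
        λ v∈ → let v∈I = elements-sound I v∈ in
          trans (*-congˡ (components≈0 v∈I (component v∈I) m)) (zeroʳ _))))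
      nonzero-trace : ∃[ f ] ¬ trace L f ≈ 0#
      nonzero-trace with em {P = ∃[ f ] ¬ trace L f ≈ 0#}
      ... | yes found = found
      -- If all traces vanished, `trace-expansion` at f = 1 would make the nonzero value of the
      -- separator at ε vanish.
      ... | no  none  = ⊥-elim (SL.nonzero (trans (sym (*-identityʳ _)) (trans
          (trace-expansion L (separator L) 1#) (∑-zero (All.universal
            (λ (r , s) → trans (*-congˡ (vanish (s * 1#))) (zeroʳ r)) SL.Θ)))))
        where
        module SL = Separator (separator L)
        vanish : ∀ f → trace L f ≈ 0#
        vanish f with em {P = trace L f ≈ 0#}
        ... | yes e = e
        ... | no ¬e = ⊥-elim (none (f , ¬e))
      f = proj₁ nonzero-trace
      t = trace L f
      t≉0 = proj₂ nonzero-trace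
      t-invariant = trace-invariant L f
      factor = norm-factor I t
      t′ = proj₁ factor
      t′-invariant : Invariant (set L) t′
      t′-invariant v v∈ = *-cancel t≉0 (begin
        t * v • t′          ≈⟨ *-congʳ (t-invariant v v∈) ⟨
        v • (t * t′)        ≈⟨ •-cong v (proj₂ factor) ⟨
        v • norm I t        ≈⟨ norm-invariant I t v (parabolic-mono L⊆I v∈) ⟩
        norm I t            ≈⟨ proj₂ factor ⟩
        t * t′              ∎)

-- Additive maps and formal sums of bimodule maps.

additive⇒isGroupHomomorphism : ∀ {a ℓ₁ b ℓ₂} (G : Group a ℓ₁) (H : Group b ℓ₂)
  (let module G = Group G) (let module H = Group H) {f : G.Carrier → H.Carrier} →
  (∀ {x y} → x G.≈ y → f x H.≈ f y) → (∀ x y → f (x G.∙ y) H.≈ (f x H.∙ f y)) →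
  IsGroupHomomorphism G.rawGroup H.rawGroup f
additive⇒isGroupHomomorphism G H {f} f-cong f-homo = record
  { isMonoidHomomorphism = record
    { isMagmaHomomorphism = record
      { isRelHomomorphism = record { cong = f-cong } ; homo = f-homo }
    ; ε-homo = f-ε
    }
  ; ⁻¹-homo = λ x → inverseˡ-unique _ _ (H.trans (H.sym (f-homo _ _))
      (H.trans (f-cong (G.inverseˡ x)) f-ε))
  }
  where
  module G = Group G
  module H = Group H
  open GroupProperties H using (inverseˡ-unique; identityˡ-unique)
  f-ε : f G.ε H.≈ H.ε
  f-ε = identityˡ-unique _ _ (H.trans (H.sym (f-homo _ _)) (f-cong (G.identityˡ G.ε)))

module _ {u} {A B : Ring u u} (M N : GradedBimodule A B) where

  private
    module M = GradedBimodule M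
    module N = GradedBimodule N

  apply-cong : ∀ (f : Hom M N) {x y} → x M.≈ᴹ y → apply M N f x N.≈ᴹ apply M N f y
  apply-cong []            e = N.≈ᴹ-refl
  apply-cong ((_ , g) ∷ f) e = N.+ᴹ-cong (g.⟦⟧-cong e) (apply-cong f e)
    where module g = IsBimoduleHomomorphism (Hom⁰.isBimoduleHomomorphism g)

  apply-+ : ∀ (f : Hom M N) x y → apply M N f (x M.+ᴹ y) N.≈ᴹ (apply M N f x N.+ᴹ apply M N f y)
  apply-+ []            x y = N.≈ᴹ-sym (N.+ᴹ-identityˡ _)
  apply-+ ((_ , g) ∷ f) x y =
    N.≈ᴹ-trans (N.+ᴹ-cong (g.+ᴹ-homo x y) (apply-+ f x y)) (interchange _ _ _ _)
    where
    module g = IsBimoduleHomomorphism (Hom⁰.isBimoduleHomomorphism g)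
    open CommutativeSemigroupProperties
      (CommutativeMonoid.commutativeSemigroup N.+ᴹ-commutativeMonoid) using (interchange)

  apply-*ₗ : ∀ (f : Hom M N) a x → apply M N f (a M.*ₗ x) N.≈ᴹ (a N.*ₗ apply M N f x)
  apply-*ₗ []            a x = N.≈ᴹ-sym (N.*ₗ-zeroʳ a)
  apply-*ₗ ((_ , g) ∷ f) a x =
    N.≈ᴹ-trans (N.+ᴹ-cong (g.*ₗ-homo a x) (apply-*ₗ f a x)) (N.≈ᴹ-sym (N.*ₗ-distribˡ a _ _))
    where module g = IsBimoduleHomomorphism (Hom⁰.isBimoduleHomomorphism g)

  apply-*ᵣ : ∀ (f : Hom M N) x b → apply M N f (x M.*ᵣ b) N.≈ᴹ (apply M N f x N.*ᵣ b)
  apply-*ᵣ []            x b = N.≈ᴹ-sym (N.*ᵣ-zeroˡ b)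
  apply-*ᵣ ((_ , g) ∷ f) x b =
    N.≈ᴹ-trans (N.+ᴹ-cong (g.*ᵣ-homo b x) (apply-*ᵣ f x b)) (N.≈ᴹ-sym (N.*ᵣ-distribʳ b _ _))
    where module g = IsBimoduleHomomorphism (Hom⁰.isBimoduleHomomorphism g)

-- Evaluation at reachable elements and vanishing at unreachable ones.

module Vanishing {u} (em : Classical) {𝒲 : CoxeterSystem u} {𝕜 : HeytingField u u u}
                 (𝔥 : Realization 𝒲 𝕜) (faithful : Realization.ReflectionFaithful 𝔥) where

  open CoxeterSystem 𝒲 using
    (W; S; _∙_; ε; _⁻¹; Parabolic; parabolic-mono; Finitary; set; ⋖⇒⊆; Step; up; down;
     Expr; nil; Descent; []; _∷_; _◦_)
  open Coxeter em 𝒲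
  open BruhatOrder em 𝒲 hiding (here; there)
  private module 𝒲 = CoxeterSystem 𝒲
  open GroupProperties 𝒲.group using (\\-leftDividesˡ; ⁻¹-anti-homo-∙)
  open Realization 𝔥 using (R; _•_; Invariant; R^_; R^ᵣ_; include)
  open RealizationTheory em 𝔥 using (•-cong; •-resp; •-∙; •-ε)
  open InvariantTheory em 𝔥 faithful
  open BottSamelson em 𝔥
  open CommutativeRing R
  open CommutativeSemigroupProperties *-commutativeSemigroup using (x∙yz≈y∙xz)
  open RingProperties ring using (-‿distribʳ-*)

  module _ {I J : Pred S u} {w x : W} {M N : GradedBimodule (R^ᵣ I) (R^ᵣ J)}
           (T : Twisted w x (GradedBimodule.bimodule N)) (f : Hom M N) where

    open Twisted T

    twisted-∘ : Twisted w x (GradedBimodule.bimodule M)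
    twisted-∘ = record
      { ⟦_⟧     = λ m → ⟦ apply M N f m ⟧
      ; cong    = λ e → cong (apply-cong M N f e)
      ; +-homo  = λ m n → trans (cong (apply-+ M N f m n)) (+-homo _ _)
      ; *ₗ-homo = λ c m → trans (cong (apply-*ₗ M N f c m)) (*ₗ-homo c _)
      ; *ᵣ-homo = λ m c → trans (cong (apply-*ᵣ M N f m c)) (*ᵣ-homo _ c)
      }

  -- Increasing and decreasing steps alike give a ring of invariants inside R on which both actions
  -- are multiplication. Recording only this lets one evaluation serve both.
  record Inclusion {I K : Pred S u} (M : GradedBimodule (R^ᵣ I) (R^ᵣ K)) : Set u where
    open GradedBimodule M
    field
      κ     : Carrierᴹ → Carrier
      cong  : ∀ {a b} → a ≈ᴹ b → κ a ≈ κ b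
      +-homo  : ∀ a b → κ (a +ᴹ b) ≈ κ a + κ b
      *ₗ-homo : ∀ c a → κ (c *ₗ a) ≈ proj₁ c * κ a
      *ᵣ-homo : ∀ a c → κ (a *ᵣ c) ≈ κ a * proj₁ c

  inclusion : ∀ {I K} (st : Step I K) → Inclusion (BSˢ st)
  inclusion (up _) = record
    { κ = proj₁ ; cong = id ; +-homo = λ _ _ → refl ; *ₗ-homo = λ _ _ → refl ; *ᵣ-homo = λ _ _ → refl }
  inclusion (down _) = record
    { κ = proj₁ ; cong = id ; +-homo = λ _ _ → refl ; *ₗ-homo = λ _ _ → refl ; *ᵣ-homo = λ _ _ → refl }

  module BSˢ {I K : Finitary} (st : Step I K) = GradedBimodule (BSˢ st)

  inclusion-1ˢ : ∀ {I K} (st : Step I K) → Inclusion.κ (inclusion st) (1ˢ st) ≈ 1#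
  inclusion-1ˢ (up _)   = refl
  inclusion-1ˢ (down _) = refl

  module _ {I K J : Pred S u} (M : GradedBimodule (R^ᵣ I) (R^ᵣ K))
           (N : GradedBimodule (R^ᵣ K) (R^ᵣ J)) where

    private
      module M = GradedBimodule M
      module N = GradedBimodule N

      T⊗ : Bimodule (R^ᵣ I) (R^ᵣ J) u u
      T⊗ = Tensor.bimodule M.bimodule N.bimodule

    open Tensor M.bimodule N.bimodule hiding (bimodule)

    pure-zero⇒zero : ∀ {w x} (T : Twisted w x T⊗) →
                     (∀ a n → Twisted.⟦ T ⟧ (a ⊗ n) ≈ 0#) → ∀ t → Twisted.⟦ T ⟧ t ≈ 0#
    pure-zero⇒zero T pure = go
      where
      open Twisted T
      go : ∀ t → ⟦ t ⟧ ≈ 0#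
      go (m ⊗ n)   = pure m n
      go (t +ᵗ t′) = trans (+-homo t t′) (trans (+-cong (go t) (go t′)) (+-identityʳ 0#))
      go 0ᵗ        = 0-homo
      go (-ᵗ t)    = trans (sym (+-identityʳ _)) (trans (+-congˡ (sym (go t)))
        (trans (sym (+-homo _ _)) (trans (cong (+-inverseᵗ t)) 0-homo)))

    module _ {w x : W} (T : Twisted w x T⊗) (a : M.Carrierᴹ) where

      open Twisted T

      slice-cong : ∀ {m n} → m N.≈ᴹ n → ⟦ a ⊗ m ⟧ ≈ ⟦ a ⊗ n ⟧
      slice-cong eq = cong (⊗-cong M.≈ᴹ-refl eq)

      slice-+ : ∀ m n → ⟦ a ⊗ (m N.+ᴹ n) ⟧ ≈ ⟦ a ⊗ m ⟧ + ⟦ a ⊗ n ⟧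
      slice-+ m n = trans (cong (⊗-distribˡ a m n)) (+-homo _ _)

      slice-*ₗ : ∀ c d → a M.*ᵣ c M.≈ᴹ d M.*ₗ a → ∀ n →
                 ⟦ a ⊗ (c N.*ₗ n) ⟧ ≈ w • proj₁ d * ⟦ a ⊗ n ⟧
      slice-*ₗ c d eq n =
        trans (cong (transᵗ (symᵗ (⊗-balanced a c n)) (⊗-cong eq N.≈ᴹ-refl))) (*ₗ-homo d (a ⊗ n))

      slice-balanced : ∀ c {b} → b M.≈ᴹ a M.*ᵣ c → ∀ n → ⟦ b ⊗ n ⟧ ≈ ⟦ a ⊗ (c N.*ₗ n) ⟧
      slice-balanced c eq n = cong (transᵗ (⊗-cong eq N.≈ᴹ-refl) (⊗-balanced a c n))

      slice : (I⊆K : I ⊆ K) → (∀ c → a M.*ᵣ c M.≈ᴹ include I⊆K c M.*ₗ a) → Twisted w x N.bimodule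
      slice I⊆K central = record
        { ⟦_⟧     = λ n → ⟦ a ⊗ n ⟧
        ; cong    = slice-cong
        ; +-homo  = slice-+
        ; *ₗ-homo = λ c → slice-*ₗ c (include I⊆K c) (central c)
        ; *ᵣ-homo = λ n → *ᵣ-homo (a ⊗ n)
        }

    -- The map is m ⊗ n ↦ v(m · T(n)). It is balanced because `T` is untwisted on the left; v ∈ W_I
    -- fixes R^I, so the result is again untwisted there, while the right twist becomes `v ∙ y`.
    evaluate-⊗ : ∀ {y v} → Inclusion M → v ∈ Parabolic I → Twisted ε y N.bimodule →
                 Twisted ε (v ∙ y) T⊗
    evaluate-⊗ {y} {v} inc v∈I T = record
      { ⟦_⟧     = value
      ; cong    = value-cong
      ; +-homo  = λ _ _ → refl
      ; *ₗ-homo = value-*ₗ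
      ; *ᵣ-homo = value-*ᵣ
      }
      where
      open Twisted T
      module inc = Inclusion inc
      value : Element → Carrier
      value (m ⊗ n)   = v • (inc.κ m * ⟦ n ⟧)
      value (t +ᵗ t′) = value t + value t′
      value 0ᵗ        = 0#
      value (-ᵗ t)    = - value t
      value-cong : ∀ {t t′} → t ≈ᵗ t′ → value t ≈ value t′
      value-cong reflᵗ                = refl
      value-cong (symᵗ e)             = sym (value-cong e)
      value-cong (transᵗ e e′)        = trans (value-cong e) (value-cong e′)
      value-cong (+-congᵗ e e′)       = +-cong (value-cong e) (value-cong e′)
      value-cong (neg-congᵗ e)        = -‿cong (value-cong e)
      value-cong (+-assocᵗ _ _ _)     = +-assoc _ _ _
      value-cong (+-commᵗ _ _)        = +-comm _ _
      value-cong (+-identᵗ _)         = +-identityˡ _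
      value-cong (+-inverseᵗ _)       = -‿inverseˡ _
      value-cong (⊗-cong e e′)        = •-cong v (*-cong (inc.cong e) (cong e′))
      value-cong (⊗-distribʳ _ _ _)   =
        •-cong v (trans (*-congʳ (inc.+-homo _ _)) (distribʳ _ _ _))
      value-cong (⊗-distribˡ _ _ _)   = •-cong v (trans (*-congˡ (+-homo _ _)) (distribˡ _ _ _))
      value-cong (⊗-balanced m b n)   = •-cong v (trans (*-congʳ (inc.*ᵣ-homo m b))
        (trans (*-assoc _ _ _) (*-congˡ (trans (*-congʳ (sym (•-ε _))) (sym (*ₗ-homo b n))))))
      value-*ₗ : ∀ c t → value (c ·ˡ t) ≈ ε • proj₁ c * value t
      value-*ₗ c (m ⊗ n)   = trans
        (•-cong v (trans (*-congʳ (inc.*ₗ-homo c m)) (*-assoc _ _ _)))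
        (*-congʳ (trans (proj₂ c v v∈I) (sym (•-ε _))))
      value-*ₗ c (t +ᵗ t′) = trans (+-cong (value-*ₗ c t) (value-*ₗ c t′)) (sym (distribˡ _ _ _))
      value-*ₗ c 0ᵗ        = sym (zeroʳ _)
      value-*ₗ c (-ᵗ t)    = trans (-‿cong (value-*ₗ c t)) (-‿distribʳ-* _ _)
      value-*ᵣ : ∀ t c → value (t ·ʳ c) ≈ (v ∙ y) • proj₁ c * value t
      value-*ᵣ (m ⊗ n)   c = trans (•-cong v (trans (*-congˡ (*ᵣ-homo n c)) (x∙yz≈y∙xz _ _ _)))
        (*-congʳ (sym (•-∙ v y (proj₁ c))))
      value-*ᵣ (t +ᵗ t′) c = trans (+-cong (value-*ᵣ t c) (value-*ᵣ t′ c)) (sym (distribˡ _ _ _))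
      value-*ᵣ 0ᵗ        c = sym (zeroʳ _)
      value-*ᵣ (-ᵗ t)    c = trans (-‿cong (value-*ᵣ t c)) (-‿distribʳ-* _ _)

  twisted-resp : ∀ {I J : Pred S u} {w x y} {N : Bimodule (R^ᵣ I) (R^ᵣ J) u u} → x 𝒲.≈ y →
                 Twisted w x N → Twisted w y N
  twisted-resp e T = record
    { ⟦_⟧ = ⟦_⟧ ; cong = cong ; +-homo = +-homo ; *ₗ-homo = *ₗ-homo
    ; *ᵣ-homo = λ m c → trans (*ᵣ-homo m c) (*-congʳ (•-resp e (proj₁ c)))
    }
    where open Twisted T

  evaluate : ∀ {I J} (e : Expr I J) {x} → x ∈ Reachable e → Twisted ε x (BS.bimodule e)
  evaluate (nil (I⊆J , J⊆I)) x∈ = record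
    { ⟦_⟧ = proj₁
    ; cong = id
    ; +-homo = λ _ _ → refl
    ; *ₗ-homo = λ c m → *-congʳ (sym (•-ε _))
    ; *ᵣ-homo = λ m c → trans (*-comm _ _)
        (*-congʳ (sym (proj₂ c _ (parabolic-mono I⊆J x∈))))
    }
  evaluate (st ∷ e) (v , y , v∈ , y∈ , x≈vy) = twisted-resp {N = BS.bimodule (st ∷ e)}
    (𝒲.sym x≈vy) (evaluate-⊗ (BSˢ st) (BS e) (inclusion st) v∈ (evaluate e y∈))

  evaluate-1ˢ : ∀ {I K J} (st : Step I K) (e : Expr K J) {x} (x∈ : x ∈ Reachable (st ∷ e)) →
    ∃₂ λ v y → Σ[ y∈ ∈ y ∈ Reachable e ]
      (∀ n → Twisted.⟦ evaluate (st ∷ e) x∈ ⟧ (1ˢ st Tensor.⊗ n) ≈ v • Twisted.⟦ evaluate e y∈ ⟧ n)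
  evaluate-1ˢ st e (v , y , _ , y∈ , _) = v , y , y∈ , λ n →
    •-cong v (trans (*-congʳ (inclusion-1ˢ st)) (*-identityˡ (Twisted.⟦ evaluate e y∈ ⟧ n)))

  evaluate-1⊗ : ∀ {I J} (e : Expr I J) {x} (x∈ : x ∈ Reachable e) →
                Twisted.⟦ evaluate e x∈ ⟧ (1⊗ e) ≈ 1#
  evaluate-1⊗ (nil _)  x∈ = refl
  evaluate-1⊗ (st ∷ e) x∈ = let v , _ , y∈ , eq = evaluate-1ˢ st e x∈ in
    trans (eq (1⊗ e)) (•-cong v (evaluate-1⊗ e y∈))

  -- The element v is the product of the group elements that `x∈` assigns to the steps of `D`; each
  -- entry 1 contributes nothing else.
  evaluate-prepend : ∀ {I L J} (D : Descent I L) (e : Expr L J) {x} (x∈ : x ∈ Reachable (D ◦ e)) →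
    ∃₂ λ v y → Σ[ y∈ ∈ y ∈ Reachable e ]
      (∀ m → Twisted.⟦ evaluate (D ◦ e) x∈ ⟧ (prepend D e m) ≈ v • Twisted.⟦ evaluate e y∈ ⟧ m)
  evaluate-prepend []      e x∈ = ε , _ , x∈ , λ m → sym (•-ε _)
  evaluate-prepend (d ∷ D) e x∈ =
    let v , _ , x′∈ , eq  = evaluate-1ˢ (down d) (D ◦ e) x∈
        v′ , y , y∈ , eq′ = evaluate-prepend D e x′∈
    in v ∙ v′ , y , y∈ , λ m → trans (eq (prepend D e m))
      (trans (•-cong v (eq′ m)) (sym (•-∙ v v′ (Twisted.⟦ evaluate e y∈ ⟧ m))))

  -- A scalar of R^K passes through the first factor and acts on the left as an element of R^I.
  -- Every slice n ↦ T(a ⊗ n) thus keeps the left twist `w`.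
  increasing-zero : ∀ {I K J} (st : Step I K) (e : Expr K J) {w x} (I⊆K : set I ⊆ set K) →
    (∀ a c → BSˢ._≈ᴹ_ st (BSˢ._*ᵣ_ st a c) (BSˢ._*ₗ_ st (include I⊆K c) a)) →
    (∀ (T : Twisted w x (BS.bimodule e)) n → Twisted.⟦ T ⟧ n ≈ 0#) →
    ∀ (T : Twisted w x (BS.bimodule (st ∷ e))) t → Twisted.⟦ T ⟧ t ≈ 0#
  increasing-zero st e I⊆K central vanishes T = pure-zero⇒zero (BSˢ st) (BS e) T
    (λ a → vanishes (slice (BSˢ st) (BS e) T a I⊆K (central a)))

  -- The first factor is generated by 1 over R^K, so the slice n ↦ T(1 ⊗ n) determines `T`. It is
  -- `w`-twisted over R^I only, and the decomposition reduces it to the twists `w ∙ v` over R^K.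
  decreasing-zero : ∀ {I K J} (st : Step I K) (e : Expr K J) {w x} (K⊆I : set K ⊆ set I) →
    (∀ c → BSˢ._≈ᴹ_ st (BSˢ._*ᵣ_ st (1ˢ st) (include K⊆I c)) (BSˢ._*ₗ_ st c (1ˢ st))) →
    (∀ a → ∃[ c ] BSˢ._≈ᴹ_ st a (BSˢ._*ᵣ_ st (1ˢ st) c)) →
    (∀ {v} → v ∈ Parabolic (set I) → ∀ (T : Twisted (w ∙ v) x (BS.bimodule e)) n →
      Twisted.⟦ T ⟧ n ≈ 0#) →
    ∀ (T : Twisted w x (BS.bimodule (st ∷ e))) t → Twisted.⟦ T ⟧ t ≈ 0#
  decreasing-zero {I} {K} st e {w} {x} K⊆I central generates vanishes T =
    pure-zero⇒zero (BSˢ st) (BS e) T λ a n → let c , a≈ = generates a in trans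
      (slice-balanced (BSˢ st) (BS e) T (1ˢ st) c a≈ n)
      (Decomposition.components≈0⇒≈0 {I} {K} K⊆I (BS.bimodule e) one-slice vanishes
        (BS._*ₗ_ e c n))
    where
    one-slice : Twisted w x (restrictᴮ K⊆I (BS.bimodule e))
    one-slice = record
      { ⟦_⟧     = λ n → Twisted.⟦ T ⟧ (1ˢ st Tensor.⊗ n)
      ; cong    = slice-cong (BSˢ st) (BS e) T (1ˢ st)
      ; +-homo  = slice-+ (BSˢ st) (BS e) T (1ˢ st)
      ; *ₗ-homo = λ c → slice-*ₗ (BSˢ st) (BS e) T (1ˢ st) (include K⊆I c) c (central c)
      ; *ᵣ-homo = λ n → Twisted.*ᵣ-homo T (1ˢ st Tensor.⊗ n)
      }

  -- BS(e) is supported on the graphs of the elements of Reachable e.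
  unreachable⇒zero : ∀ {I J} (e : Expr I J) {w x} (T : Twisted w x (BS.bimodule e)) →
                     w ⁻¹ ∙ x ∉ Reachable e → ∀ m → Twisted.⟦ T ⟧ m ≈ 0#
  unreachable⇒zero {I} (nil (I⊆J , J⊆I)) {w} {x} T ∉ c = trans (c≈ c) (trans (*-congˡ g≈0) (zeroʳ _))
    where
    open Twisted T
    𝟏 = CommutativeRing.1# (R^ set I)
    g = ⟦ 𝟏 ⟧
    c≈ : ∀ c → ⟦ c ⟧ ≈ w • proj₁ c * g
    c≈ c = trans (cong (sym (*-identityʳ _))) (*ₗ-homo c 𝟏)
    -- On 1, an invariant c acts as x(c) from the right and as w(c) from the left, with the same
    -- result in R^I. If the value g is nonzero it cancels, so w⁻¹ x fixes R^I.
    fixes : ¬ g ≈ 0# → ∀ {c} → Invariant (set I) c → (w ⁻¹ ∙ x) • c ≈ c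
    fixes g≉0 {c} c-inv = trans (•-∙ (w ⁻¹) x c) (trans (•-cong (w ⁻¹) (*-cancel g≉0
      (trans (*-comm _ _) (trans (sym (*ᵣ-homo 𝟏 (include J⊆I (c , c-inv))))
        (trans (cong (*-identityˡ _)) (trans (c≈ (c , c-inv)) (*-comm _ _)))))))
      (•-inverse w c))
    g≈0 : g ≈ 0#
    g≈0 with em {P = g ≈ 0#}
    ... | yes e   = e
    ... | no  g≉0 = ⊥-elim (∉ (fixes-invariants⇒parabolic I (fixes g≉0)))
  unreachable⇒zero (up d ∷ e) T ∉ =
    increasing-zero (up d) e (⋖⇒⊆ d) (λ a c → *-comm (proj₁ a) (proj₁ c))
      (λ T′ → unreachable⇒zero e T′ (∉ ∘ reachable-∷ (up d) e)) T
  unreachable⇒zero (down d ∷ e) {w} T ∉ =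
    decreasing-zero (down d) e (⋖⇒⊆ d) (λ c → *-comm 1# (proj₁ c))
      (λ a → a , sym (*-identityˡ (proj₁ a)))
      -- If (w v)⁻¹ x were reachable for `e`, prefixing v ∈ W_I would make v (w v)⁻¹ x = w⁻¹ x
      -- reachable.
      (λ {v} v∈ T′ → unreachable⇒zero e T′ λ y∈ → ∉ (v , _ , v∈ , y∈ ,
        𝒲.trans (𝒲.sym (\\-leftDividesˡ v _)) (𝒲.∙-congˡ (𝒲.trans (𝒲.sym (𝒲.assoc _ _ _))
          (𝒲.∙-congʳ (𝒲.sym (⁻¹-anti-homo-∙ w v)))))))
      T

-- Gradings and restriction of scalars along a descent.

open GradedTensor using (_⊗ᵍ_)

module Gradings {u} (em : Classical) {𝒲 : CoxeterSystem u} {𝕜 : HeytingField u u u}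
                (𝔥 : Realization 𝒲 𝕜) where

  open CoxeterSystem 𝒲
    using (S; set; _⋖_; ⋖⇒⊆; Step; up; down; Expr; nil; Descent; []; _∷_; _◦_)
  open Coxeter em 𝒲 using (ℓ; w₀)
  open Realization 𝔥 using (R; R^_; R^ᵣ_; include; module R)
  open BottSamelson em 𝔥
  open CommutativeSemigroupProperties ℤ.+-commutativeSemigroup using (x∙yz≈y∙xz)

  -- `GradedBimodule` imposes no closure laws on its homogeneous parts; these are the ones under
  -- which `contract` respects degrees.
  record IsGraded {I : Pred S u} {B : Ring u u} (M : GradedBimodule (R^ᵣ I) B) : Set u where
    open GradedBimodule M
    field
      resp : ∀ {i x y} → x ≈ᴹ y → Homogeneous i x → Homogeneous i y
      +∈   : ∀ {i x y} → Homogeneous i x → Homogeneous i y → Homogeneous i (x +ᴹ y)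
      0∈   : ∀ i → Homogeneous i 0ᴹ
      neg∈ : ∀ {i x} → Homogeneous i x → Homogeneous i (-ᴹ x)
      *∈   : ∀ {i j c x} → R.Homogeneous i (proj₁ c) → Homogeneous j x →
             Homogeneous (i ℤ.+ j) (c *ₗ x)

  invariants-isGraded : ∀ {I J} L (L⊆I : L ⊆ I) (L⊆J : L ⊆ J) → IsGraded (invariants L L⊆I L⊆J)
  invariants-isGraded L L⊆I L⊆J = record
    { resp = R.≈-homo ; +∈ = R.+-homo ; 0∈ = R.0-homo ; neg∈ = R.neg-homo ; *∈ = R.*-homo }

  shift-isGraded : ∀ {I B} {M : GradedBimodule (R^ᵣ I) B} s → IsGraded M → IsGraded (M ⟨ s ⟩)
  shift-isGraded {M = M} s gr = record
    { resp = resp ; +∈ = +∈ ; 0∈ = λ i → 0∈ (s ℤ.+ i) ; neg∈ = neg∈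
    ; *∈ = λ {i} {j} h k → ≡.subst (λ l → GradedBimodule.Homogeneous M l _)
        (x∙yz≈y∙xz i s j) (*∈ h k)
    }
    where open IsGraded gr

  ⊗-isGraded : ∀ {I K} {C : Ring u u} {M : GradedBimodule (R^ᵣ I) (R^ᵣ K)}
               {N : GradedBimodule (R^ᵣ K) C} → IsGraded M → IsGraded (M ⊗ᵍ N)
  ⊗-isGraded {M = M} {N} gr = record
    { resp = ≈-homo ; +∈ = +-homo ; 0∈ = 0-homo ; neg∈ = neg-homo ; *∈ = *∈ᵗ }
    where
    open GradedTensor M N hiding (_⊗ᵍ_)
    open IsGraded gr using (*∈)
    *∈ᵗ : ∀ {i j c x} → R.Homogeneous i (proj₁ c) → Homogeneousᵗ j x →
          Homogeneousᵗ (i ℤ.+ j) (GradedBimodule._*ₗ_ (M ⊗ᵍ N) c x)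
    *∈ᵗ {i} h (⊗-homo {i = j} {j = k} a b) =
      ≡.subst (λ l → Homogeneousᵗ l _) (ℤ.+-assoc i j k) (⊗-homo (*∈ h a) b)
    *∈ᵗ h (+-homo a b)   = +-homo (*∈ᵗ h a) (*∈ᵗ h b)
    *∈ᵗ h (0-homo j)     = 0-homo _
    *∈ᵗ h (neg-homo a)   = neg-homo (*∈ᵗ h a)
    *∈ᵗ {c = c} h (≈-homo e a) = ≈-homo (GradedBimodule.*ₗ-congˡ (M ⊗ᵍ N) e) (*∈ᵗ h a)

  BSˢ-isGraded : ∀ {I K} (st : Step I K) → IsGraded (BSˢ st)
  BSˢ-isGraded {I} (up d) = invariants-isGraded (set I) id (⋖⇒⊆ d)
  BSˢ-isGraded {I} {K} (down d) = shift-isGraded {M = invariants (set K) (⋖⇒⊆ d) id}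
    (ℓ (w₀ I) ⊖ ℓ (w₀ K)) (invariants-isGraded (set K) (⋖⇒⊆ d) id)

  BS-isGraded : ∀ {I J} (e : Expr I J) → IsGraded (BS e)
  BS-isGraded {I} (nil (I⊆J , _)) = invariants-isGraded (set I) id I⊆J
  BS-isGraded (st ∷ e) = ⊗-isGraded {M = BSˢ st} {N = BS e} (BSˢ-isGraded st)

  -- M is R^K(s), generated by 𝟏 in degree −s.
  record IsFree {I K : Pred S u} (K⊆I : K ⊆ I) (s : ℤ) (M : GradedBimodule (R^ᵣ I) (R^ᵣ K)) : Set u where
    open GradedBimodule M
    private module 𝐊 = CommutativeRing (R^ K)
    field
      𝟏         : Carrierᴹ
      central   : ∀ c → (𝟏 *ᵣ include K⊆I c) ≈ᴹ (c *ₗ 𝟏)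
      degree    : Homogeneous (ℤ.- s) 𝟏
      κ         : Carrierᴹ → 𝐊.Carrier
      κ-cong    : ∀ {a b} → a ≈ᴹ b → κ a 𝐊.≈ κ b
      κ-+       : ∀ a b → κ (a +ᴹ b) 𝐊.≈ κ a 𝐊.+ κ b
      κ-*       : ∀ a c → κ (a *ᵣ c) 𝐊.≈ κ a 𝐊.* c
      κ-1       : κ 𝟏 𝐊.≈ 𝐊.1#
      generates : ∀ a → a ≈ᴹ (𝟏 *ᵣ κ a)
      κ-degree  : ∀ {i a} → Homogeneous i a → R.Homogeneous (s ℤ.+ i) (proj₁ (κ a))

  BSˢ-isFree : ∀ {I K} (d : K ⋖ I) → IsFree {set I} {set K} (⋖⇒⊆ d) (ℓ (w₀ I) ⊖ ℓ (w₀ K)) (BSˢ (down d))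
  BSˢ-isFree {I} {K} d = record
    { 𝟏 = 𝐊.1#
    ; central = λ c → 𝐑.*-comm 𝐑.1# (proj₁ c)
    ; degree = ≡.subst (λ i → R.Homogeneous i 𝐑.1#)
        (≡.sym (ℤ.+-inverseʳ (ℓ (w₀ I) ⊖ ℓ (w₀ K)))) (R.con-homo _)
    ; κ = id
    ; κ-cong = id
    ; κ-+ = λ _ _ → 𝐑.refl
    ; κ-* = λ _ _ → 𝐑.refl
    ; κ-1 = 𝐑.refl
    ; generates = λ a → 𝐑.sym (𝐑.*-identityˡ (proj₁ a))
    ; κ-degree = id
    }
    where
    module 𝐊 = CommutativeRing (R^ set K)
    module 𝐑 = CommutativeRing R

  module _ {I K J : Pred S u} {K⊆I : K ⊆ I} {s : ℤ} {M : GradedBimodule (R^ᵣ I) (R^ᵣ K)}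
           (free : IsFree K⊆I s M) (N : GradedBimodule (R^ᵣ K) (R^ᵣ J)) where

    private
      module M = GradedBimodule M
      module N = GradedBimodule N

    open IsFree free
    open GradedTensor M N hiding (_⊗ᵍ_)
    open Tensor M.bimodule N.bimodule hiding (bimodule)

    -- The inverse of n ↦ 𝟏 ⊗ n, from the identification of R^K ⊗ N over R^K with N.
    contract : Element → N.Carrierᴹ
    contract (a ⊗ n)  = κ a N.*ₗ n
    contract (x +ᵗ y) = contract x N.+ᴹ contract y
    contract 0ᵗ       = N.0ᴹ
    contract (-ᵗ x)   = N.-ᴹ contract x

    contract-cong : ∀ {x y} → x ≈ᵗ y → contract x N.≈ᴹ contract y
    contract-cong reflᵗ              = N.≈ᴹ-refl
    contract-cong (symᵗ e)           = N.≈ᴹ-sym (contract-cong e)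
    contract-cong (transᵗ e e′)      = N.≈ᴹ-trans (contract-cong e) (contract-cong e′)
    contract-cong (+-congᵗ e e′)     = N.+ᴹ-cong (contract-cong e) (contract-cong e′)
    contract-cong (neg-congᵗ e)      = N.-ᴹ‿cong (contract-cong e)
    contract-cong (+-assocᵗ _ _ _)   = N.+ᴹ-assoc _ _ _
    contract-cong (+-commᵗ _ _)      = N.+ᴹ-comm _ _
    contract-cong (+-identᵗ _)       = N.+ᴹ-identityˡ _
    contract-cong (+-inverseᵗ _)     = N.-ᴹ‿inverseˡ _
    contract-cong (⊗-cong e e′)      = N.*ₗ-cong (κ-cong e) e′
    contract-cong (⊗-distribʳ m m′ n) = N.≈ᴹ-trans (N.*ₗ-congʳ (κ-+ m m′)) (N.*ₗ-distribʳ n (κ m) (κ m′))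
    contract-cong (⊗-distribˡ m _ _) = N.*ₗ-distribˡ (κ m) _ _
    contract-cong (⊗-balanced m b n) = N.≈ᴹ-trans (N.*ₗ-congʳ (κ-* m b)) (N.*ₗ-assoc (κ m) b n)

    contract-𝟏⊗ : ∀ n → contract (𝟏 ⊗ n) N.≈ᴹ n
    contract-𝟏⊗ n = N.≈ᴹ-trans (N.*ₗ-congʳ κ-1) (N.*ₗ-identityˡ n)

    𝟏⊗-0 : 𝟏 ⊗ N.0ᴹ ≈ᵗ 0ᵗ
    𝟏⊗-0 = GroupProperties.identityˡ-unique (AbelianGroup.group abelianGroup) _ _
      (transᵗ (symᵗ (⊗-distribˡ 𝟏 N.0ᴹ N.0ᴹ)) (⊗-cong M.≈ᴹ-refl (N.+ᴹ-identityˡ _)))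

    𝟏⊗-contract : ∀ x → 𝟏 ⊗ contract x ≈ᵗ x
    𝟏⊗-contract (a ⊗ n)  = transᵗ (symᵗ (⊗-balanced 𝟏 (κ a) n))
      (⊗-cong (M.≈ᴹ-sym (generates a)) N.≈ᴹ-refl)
    𝟏⊗-contract (x +ᵗ y) = transᵗ (⊗-distribˡ 𝟏 _ _) (+-congᵗ (𝟏⊗-contract x) (𝟏⊗-contract y))
    𝟏⊗-contract 0ᵗ       = 𝟏⊗-0
    𝟏⊗-contract (-ᵗ x)   = transᵗ
      (GroupProperties.inverseˡ-unique (AbelianGroup.group abelianGroup) _ _
        (transᵗ (symᵗ (⊗-distribˡ 𝟏 _ _)) (transᵗ (⊗-cong M.≈ᴹ-refl (N.-ᴹ‿inverseˡ _)) 𝟏⊗-0)))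
      (neg-congᵗ (𝟏⊗-contract x))

    contract-degree : IsGraded N → ∀ {j x} → Homogeneousᵗ j x → N.Homogeneous (s ℤ.+ j) (contract x)
    contract-degree gr = go
      where
      open IsGraded gr
      go : ∀ {j x} → Homogeneousᵗ j x → N.Homogeneous (s ℤ.+ j) (contract x)
      go (⊗-homo {i = i} {j = j} a n) =
        ≡.subst (λ l → N.Homogeneous l _) (ℤ.+-assoc s i j) (*∈ (κ-degree a) n)
      go (+-homo a b)   = +∈ (go a) (go b)
      go (0-homo i)     = 0∈ _
      go (neg-homo a)   = neg∈ (go a)
      go (≈-homo e a)   = resp (contract-cong e) (go a)

    𝟏⊗-degree : ∀ {j n} → N.Homogeneous (s ℤ.+ j) n → Homogeneousᵗ j (𝟏 ⊗ n)
    𝟏⊗-degree {j} h = ≡.subst (λ l → Homogeneousᵗ l _)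
      (≡.trans (≡.sym (ℤ.+-assoc (ℤ.- s) s j)) (≡.trans (≡.cong (ℤ._+ j) (ℤ.+-inverseˡ s))
        (ℤ.+-identityˡ j)))
      (⊗-homo degree h)

    module _ {L : Pred S u} {L⊆K : L ⊆ K} (gr : IsGraded N) (X : GradedBimodule (R^ᵣ L) (R^ᵣ J)) {n : ℤ}
             {Φ : GradedBimodule.Carrierᴹ X → GradedBimodule.Carrierᴹ N}
             (iso : IsGradedIsomorphism (restrictˡ L⊆K X ⟨ n ⟩) N Φ) where

      private
        module X = GradedBimodule X
        module Φ = IsGradedIsomorphism iso

      𝟏⊗-isGradedIsomorphism :
        IsGradedIsomorphism (restrictˡ (λ i → K⊆I (L⊆K i)) X ⟨ n ℤ.+ s ⟩) (M ⊗ᵍ N) (λ x → 𝟏 ⊗ Φ x)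
      𝟏⊗-isGradedIsomorphism = record
        { isBimoduleIsomorphism = record
          { isBimoduleMonomorphism = record
            { isBimoduleHomomorphism = record
              { +ᴹ-isGroupHomomorphism = additive⇒isGroupHomomorphism
                  (AbelianGroup.group X.+ᴹ-abelianGroup) (AbelianGroup.group abelianGroup)
                  (λ e → ⊗-cong M.≈ᴹ-refl (Φ.⟦⟧-cong e))
                  (λ x y → transᵗ (⊗-cong M.≈ᴹ-refl (Φ.+ᴹ-homo x y)) (⊗-distribˡ 𝟏 _ _))
              ; *ₗ-homo = λ c x → transᵗ
                  (⊗-cong M.≈ᴹ-refl (N.≈ᴹ-trans (Φ.⟦⟧-cong (X.*ₗ-congʳ (CommutativeRing.refl R)))
                    (Φ.*ₗ-homo (include K⊆I c) x)))
                  (transᵗ (symᵗ (⊗-balanced 𝟏 (include K⊆I c) (Φ x)))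
                    (⊗-cong (central c) N.≈ᴹ-refl))
              ; *ᵣ-homo = λ c x → ⊗-cong M.≈ᴹ-refl (Φ.*ᵣ-homo c x)
              }
            ; injective = λ {x} {y} e → Φ.injective (N.≈ᴹ-trans (N.≈ᴹ-sym (contract-𝟏⊗ (Φ x)))
                (N.≈ᴹ-trans (contract-cong e) (contract-𝟏⊗ (Φ y))))
            }
          ; surjective = λ y → let x , eq = Φ.surjective (contract y) in
              x , λ e → transᵗ (⊗-cong M.≈ᴹ-refl (eq e)) (𝟏⊗-contract y)
          }
        ; graded = λ j x → mk⇔
            (λ h → 𝟏⊗-degree (Equivalence.to (Φ.graded (s ℤ.+ j) x)
              (≡.subst (λ l → X.Homogeneous l x) (ℤ.+-assoc n s j) h)))
            (λ h → ≡.subst (λ l → X.Homogeneous l x) (≡.sym (ℤ.+-assoc n s j))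
              (Equivalence.from (Φ.graded (s ℤ.+ j) x)
                (IsGraded.resp gr (contract-𝟏⊗ (Φ x)) (contract-degree gr h))))
        }

  -- Each removal contributes its own shift, and these telescope to ℓ(I) - ℓ(L).
  restriction : ∀ {I L J} (D : Descent I L) (e : Expr L J) → Σ[ n ∈ ℤ ] Restriction D e n
  restriction [] e = 0ℤ , record
    { isBimoduleIsomorphism = record
      { isBimoduleMonomorphism = record
        { isBimoduleHomomorphism = record
          { +ᴹ-isGroupHomomorphism = additive⇒isGroupHomomorphism G G id (λ _ _ → BS.≈ᴹ-refl e)
          ; *ₗ-homo = λ _ _ → BS.*ₗ-congʳ e (CommutativeRing.refl R)
          ; *ᵣ-homo = λ _ _ → BS.≈ᴹ-refl e
          }
        ; injective = id
        }
      ; surjective = λ y → y , id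
      }
    ; graded = λ j x → mk⇔ (≡.subst (λ l → BS.Homogeneous e l x) (ℤ.+-identityˡ j))
        (≡.subst (λ l → BS.Homogeneous e l x) (≡.sym (ℤ.+-identityˡ j)))
    }
    where G = AbelianGroup.group (BS.+ᴹ-abelianGroup e)
  restriction {I} (_∷_ {K = K} d D) e = let n , iso = restriction D e in
    n ℤ.+ (ℓ (w₀ I) ⊖ ℓ (w₀ K)) ,
    𝟏⊗-isGradedIsomorphism (BSˢ-isFree d) (BS (D ◦ e)) (BS-isGraded (D ◦ e)) (BS e) {n} iso

-- Lower terms and the submodule generated by the one-tensor.

module LowerTerms {u} (em : Classical) {𝒲 : CoxeterSystem u} {𝕜 : HeytingField u u u}
                  (𝔥 : Realization 𝒲 𝕜) (faithful : Realization.ReflectionFaithful 𝔥) where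

  open CoxeterSystem 𝒲 using (ε; _⁻¹; _∙_; Expr; Descent; descent-⊆; _◦_; Coset)
  private module 𝒲 = CoxeterSystem 𝒲
  open Coxeter em 𝒲
  open BruhatOrder em 𝒲 using (Reachable; reachable-resp; <ᶜ⇒unreachable; reduced⇒reachable)
  open Realization 𝔥 using (R; _•_)
  open RealizationTheory em 𝔥 using (•-cong; •-ε)
  open InvariantTheory em 𝔥 faithful using (Twisted; •-inverse)
  open BottSamelson em 𝔥
  open Vanishing em 𝔥 faithful
  open CommutativeRing R

  lower-term-vanishes : ∀ {I J} {p : Coset I J} {x} {M N : GradedBimodule _ _} →
    IsMaximal p x → (T : Twisted ε x (GradedBimodule.bimodule N)) →
    ∀ f → f ∈ Hom<[ p ] M N → ∀ m → Twisted.⟦ T ⟧ (apply M N f m) ≈ 0#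
  lower-term-vanishes {p = p} {x} {M} {N} max T f (l , f≈) m = trans (cong (f≈ m)) (go l)
    where
    open Twisted T
    open GroupProperties 𝒲.group using (ε⁻¹≈ε)
    go : ∀ l → ⟦ sumᴹ N (map (λ φ → Factorization.composite φ m) l) ⟧ ≈ 0#
    go []      = 0-homo
    go (φ ∷ l) = trans (+-homo _ _) (trans (+-cong
      (unreachable⇒zero M• (twisted-∘ {M = BS M•} {N = N} T out) unreachable _) (go l))
      (+-identityʳ 0#))
      where
      open Factorization φ
      unreachable : ε ⁻¹ ∙ x ∉ Reachable M•
      unreachable x∈ = <ᶜ⇒unreachable {p = p} {q = q} M• expresses q∈C max (reachable-resp M•
        (𝒲.trans (𝒲.∙-congʳ ε⁻¹≈ε) (𝒲.identityˡ x)) x∈)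

  -- The action is defined through a preimage z of the one-tensor that surjectivity provides. Both
  -- evaluations send one-tensors to 1, so v applied to the value of z is 1 and that value is 1;
  -- then r acts on it as plain multiplication.
  evaluate-▷ : ∀ {I L J} (D : Descent I L) (K• : Expr L J) n (iso : Restriction D K• n)
    {x} (x∈ : x ∈ Reachable (D ◦ K•)) → ∃[ v ]
    (∀ r → Twisted.⟦ evaluate (D ◦ K•) x∈ ⟧ (Action._▷_ D K• n iso r (1⊗ (D ◦ K•))) ≈ v • proj₁ r)
  evaluate-▷ D K• n iso x∈ with evaluate-prepend D K• x∈
  ... | v , y , y∈ , eq = v , λ r → trans (eq _) (•-cong v (trans (*ₗ-homo r z)
      (trans (*-cong (•-ε (proj₁ r)) z≈1) (*-identityʳ _))))
    where
    open Twisted (evaluate K• y∈)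
    module iso = IsGradedIsomorphism
      {M = restrictˡ (descent-⊆ D) (BS K•) ⟨ n ⟩} {N = BS (D ◦ K•)} {Φ = prepend D K•} iso
    z = iso.Φ⁻¹ (1⊗ (D ◦ K•))
    prepend-z : BS._≈ᴹ_ (D ◦ K•) (prepend D K• z) (1⊗ (D ◦ K•))
    prepend-z = proj₂ (iso.surjective (1⊗ (D ◦ K•))) (BS.≈ᴹ-refl K•)
    z≈1 : ⟦ z ⟧ ≈ 1#
    z≈1 = trans (sym (•-inverse v ⟦ z ⟧)) (•-cong (v ⁻¹) (trans (sym (eq z))
      (trans (Twisted.cong (evaluate (D ◦ K•) x∈) prepend-z) (evaluate-1⊗ (D ◦ K•) x∈))))

  ▷-zero : ∀ {I L J} (D : Descent I L) (K• : Expr L J) n (iso : Restriction D K• n) {r} →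
           proj₁ r ≈ 0# → ∀ y → BS._≈ᴹ_ (D ◦ K•) (Action._▷_ D K• n iso r y) (BS.0ᴹ (D ◦ K•))
  ▷-zero D K• n iso r≈0 y = BS.≈ᴹ-trans (D ◦ K•)
    (iso.⟦⟧-cong (BS.≈ᴹ-trans K• (BS.*ₗ-congʳ K• r≈0) (BS.*ₗ-zeroˡ K• _)))
    iso.0ᴹ-homo
    where
    module iso = IsGradedIsomorphism
      {M = restrictˡ (descent-⊆ D) (BS K•) ⟨ n ⟩} {N = BS (D ◦ K•)} {Φ = prepend D K•} iso

  lower-terms-avoid-R·1⊗ : ∀ {I L J} {p : Coset I J} (D : Descent I L) (K• : Expr L J) →
    IsReducedExpressionFor (D ◦ K•) p → ∀ n (iso : Restriction D K• n) {M} f →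
    f ∈ Hom<[ p ] M (BS (D ◦ K•)) →
    ∀ y → y ∈ (Image M (BS (D ◦ K•)) f ∩ Action.R·1⊗ D K• n iso) →
    BS._≈ᴹ_ (D ◦ K•) y (BS.0ᴹ (D ◦ K•))
  lower-terms-avoid-R·1⊗ {p = p} D K• (maximal , reduced) n iso {M} f f∈ y ((m , fm≈y) , r , y≈r) =
    BS.≈ᴹ-trans (D ◦ K•) y≈r (▷-zero D K• n iso r≈0 _)
    where
    x∈ = reduced⇒reachable (D ◦ K•) reduced
    T = evaluate (D ◦ K•) x∈
    evaluated = evaluate-▷ D K• n iso x∈
    v = proj₁ evaluated
    r≈0 : proj₁ r ≈ 0#
    r≈0 = trans (sym (•-inverse v _)) (•-cong (v ⁻¹) (trans (sym (proj₂ evaluated r))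
      (trans (sym (Twisted.cong T y≈r)) (trans (sym (Twisted.cong T fm≈y))
        (lower-term-vanishes {p = p} {N = BS (D ◦ K•)} maximal T f f∈ m)))))

proposition3p34 :
    ∀ {u} (em : Classical) (𝒲 : CoxeterSystem u) (𝕜 : HeytingField u u u) (𝔥 : Realization 𝒲 𝕜) →
    let open CoxeterSystem 𝒲
        open Coxeter em 𝒲
        open Realization 𝔥
        open BottSamelson em 𝔥
    in
    Balanced → ReflectionFaithful → GeneralizedDemazureSurjectivity em →
    ∀ {I J L : Finitary} (p : Coset I J) (I• : Expr I J) (D : Descent I L) (K• : Expr L J) →
    set L ≐ LR p →
    IsReducedExpressionFor I• p → IsReducedExpressionFor (D ◦ K•) p →
    Σ[ n ∈ ℤ ] Σ[ iso ∈ Restriction D K• n ]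
      (∀ (f : Hom (BS I•) (BS (D ◦ K•))) → f ∈ Hom<[ p ] (BS I•) (BS (D ◦ K•)) →
       ∀ y → y ∈ (Image (BS I•) (BS (D ◦ K•)) f ∩ Action.R·1⊗ D K• n iso) →
       BS._≈ᴹ_ (D ◦ K•) y (BS.0ᴹ (D ◦ K•)))
proposition3p34 em 𝒲 𝕜 𝔥 _ faithful _ p I• D K• _ _ reduced =
  let n , iso = Gradings.restriction em 𝔥 D K• in
  n , iso , LowerTerms.lower-terms-avoid-R·1⊗ em 𝔥 faithful D K• reduced n iso
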